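{- For a connected graph $H$, the following are equivalent: (a) $H$ is product-join-reducible; (b) $H$ is isomorphic to a subgraph of $H(G,e)$ for some $(G,e)\in\mathcal{G}'$; (c) $H$ is isomorphic to a subgraph of $H(G,e)$ for some $(G,e)\in\mathcal{G}''$.
   Context: Multigraphs may have loops and parallel edges. A series-parallel graph is a multigraph with no $K_4$ minor. $\mathcal{G}'$ is the set of pairs $(G,e)$ with $G$ a connected series-parallel multigraph and $e\in E(G)$ neither a bridge nor a loop; $\mathcal{G}''$ is the subset where $G$ is $2$-connected (at least two edges, no loops, connected after deleting any vertex). For $(G,e)\in\mathcal{G}'$, identify subsets of $E(G)\setminus\{e\}$ with vertices of $Q_{e(G)-1}$; let $X(G/e)$ be the sets $S$ with $S\cup\{e\}$ a spanning tree of $G$, and $X(G\setminus e)$ the sets $S$ that are spanning trees of $G$; $H(G,e)$ is the induced subgraph of $Q_{e(G)-1}$ on $X(G/e)\cup X(G\setminus e)$. Product-join: for connected bipartite graphs $H_1,H_2$ with bipartitions $(A_1,B_1)$, $(A_2,B_2)$, the product-join of $H_1$ and $H_2$ along $A_1$ and $A_2$ is the bipartite graph with parts $A_1\times A_2$ and $(A_1\times B_2)\sqcup(B_1\times A_2)$, where $(a_1,a_2)$ is adjacent to $(a_1,b_2)$ for every $b_2$ adjacent to $a_2$ in $H_2$ and to $(b_1,a_2)$ for every $b_1$ adjacent to $a_1$ in $H_1$, and there are no other edges. A graph is product-join-reducible if it can be obtained from copies of $K_2$ by repeatedly taking connected subgraphs and product-joins (along any choice of parts). -}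

module Defs where

open import Data.Nat using (ℕ; _≤_)
open import Data.Fin using (Fin)
open import Data.Fin.Subset using (Subset; _∈_; _∪_; ⁅_⁆)
open import Data.Bool using (Bool; true; false)
open import Data.Maybe using (Maybe; just)
open import Data.Vec using (lookup)
open import Data.Product using (Σ; Σ-syntax; ∃; ∃-syntax; _×_; _,_; proj₁)
open import Data.Sum using (_⊎_; inj₁; inj₂)
open import Data.Empty using (⊥)
open import Relation.Nullary using (¬_)
open import Relation.Binary.PropositionalEquality using (_≡_; _≢_; refl; sym)
open import Relation.Binary.Construct.Closure.ReflexiveTransitive using (Star)

record Multigraph : Set where
  field
    n   : ℕ
    m   : ℕ
    src : Fin m → Fin n
    tgt : Fin m → Fin n
open Multigraph public

module _ (G : Multigraph) where

  Step : (Fin (m G) → Set) → Fin (n G) → Fin (n G) → Set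
  Step P u v = Σ[ t ∈ Fin (m G) ] (P t ×
                 ((src G t ≡ u × tgt G t ≡ v) ⊎ (src G t ≡ v × tgt G t ≡ u)))

  Reach : (Fin (m G) → Set) → Fin (n G) → Fin (n G) → Set
  Reach P = Star (Step P)

  AllEdges : Fin (m G) → Set
  AllEdges _ = Data.Unit.⊤
    where import Data.Unit

  MConnected : Set
  MConnected = ∀ u v → Reach AllEdges u v

  IsLoop : Fin (m G) → Set
  IsLoop t = src G t ≡ tgt G t

  IsBridge : Fin (m G) → Set
  IsBridge e = ¬ Reach (λ t → t ≢ e) (src G e) (tgt G e)

  -- spanning tree: the edge set T spans a connected subgraph containing
  -- all vertices, and is acyclic (no edge of T lies on a cycle of T, i.e.
  -- the ends of any t ∈ T are not joined by a walk in T ∖ {t}; this also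
  -- excludes loops)
  SpanningTree : Subset (m G) → Set
  SpanningTree T =
    (∀ u v → Reach (λ t → t ∈ T) u v) ×
    (∀ t → t ∈ T → ¬ Reach (λ s → s ∈ T × s ≢ t) (src G t) (tgt G t))

  -- K4-minor model: disjoint nonempty connected branch sets B₀..B₃
  -- (β v ≡ just i means v ∈ B_i) with an edge between any two of them
  K4MinorModel : Set
  K4MinorModel =
    Σ[ β ∈ (Fin (n G) → Maybe (Fin 4)) ]
      ((∀ i → ∃[ v ] β v ≡ just i) ×
       (∀ i u v → β u ≡ just i → β v ≡ just i →
          Reach (λ t → β (src G t) ≡ just i × β (tgt G t) ≡ just i) u v) ×
       (∀ i j → i ≢ j → ∃[ t ]
          ((β (src G t) ≡ just i × β (tgt G t) ≡ just j) ⊎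
           (β (src G t) ≡ just j × β (tgt G t) ≡ just i))))

  HasK4Minor : Set
  HasK4Minor = K4MinorModel

  SeriesParallel : Set
  SeriesParallel = ¬ HasK4Minor

  ConnectedWithout : Fin (n G) → Set
  ConnectedWithout w =
    ∀ u v → u ≢ w → v ≢ w →
      Reach (λ t → src G t ≢ w × tgt G t ≢ w) u v

  TwoConnected : Set
  TwoConnected =
    (2 ≤ m G) × (∀ t → ¬ IsLoop t) × MConnected × (∀ w → ConnectedWithout w)

InG′ : (G : Multigraph) → Fin (m G) → Set
InG′ G e = MConnected G × SeriesParallel G × ¬ IsBridge G e × ¬ IsLoop G e

InG″ : (G : Multigraph) → Fin (m G) → Set
InG″ G e = InG′ G e × TwoConnected G

record Graph : Set₁ where
  field
    V    : Set
    _~_  : V → V → Set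
    ~sym : ∀ {x y} → x ~ y → y ~ x
    ~irr : ∀ {x} → ¬ (x ~ x)
open Graph public

Connected : Graph → Set
Connected H = V H × (∀ x y → Star (_~_ H) x y)

IsoToSubgraph : Graph → Graph → Set
IsoToSubgraph H K =
  Σ[ f ∈ (V H → V K) ]
    ((∀ x y → f x ≡ f y → x ≡ y) × (∀ {x y} → _~_ H x y → _~_ K (f x) (f y)))

Bipartition : Graph → Set
Bipartition H = Σ[ c ∈ (V H → Bool) ] (∀ {x y} → _~_ H x y → c x ≢ c y)

K2 : Graph
K2 = record { V = Bool ; _~_ = λ x y → x ≢ y ; ~sym = λ p q → p (sym q)
            ; ~irr = λ p → p refl }

module PJ (H₁ : Graph) (b₁ : Bipartition H₁) (H₂ : Graph) (b₂ : Bipartition H₂) where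
  A₁ = Σ[ v ∈ V H₁ ] proj₁ b₁ v ≡ true
  B₁ = Σ[ v ∈ V H₁ ] proj₁ b₁ v ≡ false
  A₂ = Σ[ v ∈ V H₂ ] proj₁ b₂ v ≡ true
  B₂ = Σ[ v ∈ V H₂ ] proj₁ b₂ v ≡ false

  W : Set
  W = (A₁ × A₂) ⊎ ((A₁ × B₂) ⊎ (B₁ × A₂))

  Adj : W → W → Set
  Adj (inj₁ (a₁ , a₂)) (inj₂ (inj₁ (a₁′ , b₂))) = (proj₁ a₁ ≡ proj₁ a₁′) × _~_ H₂ (proj₁ a₂) (proj₁ b₂)
  Adj (inj₁ (a₁ , a₂)) (inj₂ (inj₂ (b₁ , a₂′))) = (proj₁ a₂ ≡ proj₁ a₂′) × _~_ H₁ (proj₁ a₁) (proj₁ b₁)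
  Adj (inj₂ (inj₁ (a₁′ , b₂))) (inj₁ (a₁ , a₂)) = (proj₁ a₁ ≡ proj₁ a₁′) × _~_ H₂ (proj₁ a₂) (proj₁ b₂)
  Adj (inj₂ (inj₂ (b₁ , a₂′))) (inj₁ (a₁ , a₂)) = (proj₁ a₂ ≡ proj₁ a₂′) × _~_ H₁ (proj₁ a₁) (proj₁ b₁)
  Adj (inj₁ _) (inj₁ _) = ⊥
  Adj (inj₂ _) (inj₂ _) = ⊥

  Adj-sym : ∀ {x y} → Adj x y → Adj y x
  Adj-sym {inj₁ _} {inj₂ (inj₁ _)} p = p
  Adj-sym {inj₁ _} {inj₂ (inj₂ _)} p = p
  Adj-sym {inj₂ (inj₁ _)} {inj₁ _} p = p
  Adj-sym {inj₂ (inj₂ _)} {inj₁ _} p = p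

  Adj-irr : ∀ {x} → ¬ Adj x x
  Adj-irr {inj₁ _} ()
  Adj-irr {inj₂ (inj₁ _)} ()
  Adj-irr {inj₂ (inj₂ _)} ()

  graph : Graph
  graph = record { V = W ; _~_ = Adj ; ~sym = Adj-sym ; ~irr = Adj-irr }

ProductJoin : (H₁ : Graph) → Bipartition H₁ → (H₂ : Graph) → Bipartition H₂ → Graph
ProductJoin = PJ.graph

data PJReducible : Graph → Set₁ where
  base : PJReducible K2
  sub  : ∀ {G H} → PJReducible G → Connected H → IsoToSubgraph H G → PJReducible H
  join : ∀ {H₁ H₂} → PJReducible H₁ → PJReducible H₂ →
         Connected H₁ → Connected H₂ →
         (b₁ : Bipartition H₁) (b₂ : Bipartition H₂) →
         PJReducible (ProductJoin H₁ b₁ H₂ b₂)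

-- Part 3. H(G,e) inside the hypercube.  Vertices of Q_{e(G)-1} are the
-- subsets S of E(G) with e ∉ S; two are adjacent iff they differ in
-- exactly one element.  H(G,e) is the induced subgraph on X(G/e) ∪ X(G∖e).

HypercubeAdj : ∀ {k} → Subset k → Subset k → Set
HypercubeAdj {k} S S′ =
  Σ[ t ∈ Fin k ] (lookup S t ≢ lookup S′ t × (∀ u → u ≢ t → lookup S u ≡ lookup S′ u))

InX : (G : Multigraph) → Fin (m G) → Subset (m G) → Set
InX G e S = lookup S e ≡ false × (SpanningTree G (S ∪ ⁅ e ⁆) ⊎ SpanningTree G S)

IsoToSubgraphOfH : Graph → (G : Multigraph) → Fin (m G) → Set
IsoToSubgraphOfH H G e =
  Σ[ f ∈ (V H → Subset (m G)) ]
    ((∀ x y → f x ≡ f y → x ≡ y) ×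
     (∀ x → InX G e (f x)) ×
     (∀ {x y} → _~_ H x y → HypercubeAdj (f x) (f y)))

{-# OPTIONS --safe #-}
-- Every K t, for a series-parallel term t, is an iterated product-join of copies of K2, and a connected graph is
-- product-join-reducible iff it embeds in some K t (swapping series and parallel swaps the two sides of K t).
-- The vertices of K t are the spanning trees of the network of t and its spanning forests that become trees once the
-- terminals are identified.
-- So K t embeds in H(G,e) for the graph G obtained from a digon {e,f} by expanding f into the network of t by
-- duplications and subdivisions of edges, and these keep G 2-connected and without K4 minor.
-- Conversely, label each edge of G by a term and each vertex of H by a configuration of every label.  Merging
-- parallel edges, merging the two edges at a vertex of degree 2 and deleting a pendant edge preserve this structure;
-- a graph without K4 minor in which none of these applies has only the edge e and one further edge,
-- and then H embeds in K t for the label t of the latter.  The configuration of an edge in every tree or in no tree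
-- is constant because H is connected.
module Submission where

open import Defs
open import Data.Bool using (Bool; true; false; not; _∨_; _∧_)
open import Data.Bool.Properties as Bool using (not-involutive; not-injective; ∨-identityʳ; ∨-zeroʳ)
open import Data.Empty using (⊥; ⊥-elim)
open import Data.Fin using (Fin; zero; suc; punchIn)
open import Data.Fin.Properties using (_≟_; suc-injective; any?; punchIn-injective; punchInᵢ≢i)
open import Data.Fin.Subset using (Subset; ⁅_⁆; _∪_) renaming (_∈_ to _∈ˢ_)
open import Data.Fin.Subset.Properties using (x∈p∪q⁺; x∈⁅x⁆; x≢y⇒x∉⁅y⁆)
open import Data.Maybe.Base using (Maybe; just; nothing)
open import Data.Maybe.Properties using (just-injective; ≡-dec)
open import Data.Nat.Base using (ℕ; zero; suc; _≤_; _<_; z≤n; s≤s)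
open import Data.Nat.Induction using (<-wellFounded)
open import Data.Nat.Properties using (m≤n⇒m≤1+n)
open import Data.Product using (Σ-syntax; ∃; ∃-syntax; _×_; _,_; proj₁; proj₂)
open import Data.Sum using (_⊎_; inj₁; inj₂; [_,_]′)
open import Data.Unit.Base using (⊤; tt)
open import Data.Vec.Base using (lookup; tabulate)
open import Data.Vec.Functional using (_∷_)
open import Data.Vec.Properties
  using (lookup∘tabulate; lookup-zipWith; []=⇒lookup; lookup⇒[]=; tabulate∘lookup; tabulate-cong)
open import Function.Base using (_∘_; id; case_of_)
open import Function.Bundles using (_⇔_; mk⇔)
open import Induction.WellFounded using (Acc; acc)
open import Axiom.UniquenessOfIdentityProofs using (module Decidable⇒UIP)
open import Relation.Nullary using (¬_; Dec; yes; no; does)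
open import Relation.Nullary.Decidable using (_×-dec_; _⊎-dec_; ¬?; decidable-stable)
open import Relation.Binary.Construct.Closure.ReflexiveTransitive
  using (Star; ε; _◅_; _◅◅_; gmap; reverse; kleisliStar)
open import Relation.Binary.PropositionalEquality
  using (_≡_; _≢_; refl; sym; trans; cong; subst; subst₂)

-- Product-joins and terms

-- A pair of configurations is excluded from a series composition when both are forests (the middle
-- vertex is cut off), and from a parallel composition when both are trees (a cycle closes). In
-- either case the excluded pairs form the block B₁ × B₂ that a product-join omits, so the two
-- compositions are one graph operation with the sides exchanged. In the converse `H` is an
-- arbitrary connected subgraph with no evident structure of its own to decompose; hence `G` is
-- reduced and the labels carry `H` along. The reductions must leave `e` alone, so its two ends may
-- have any degree, and the standard fact that minimum degree three forces a K4 minor does not apply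
-- as it stands. The edge `e` compensates: its ends start as two adjacent connected sets `A` and
-- `B`, and the induction runs over pieces `D` attached to them in which every vertex has three
-- neighbours.

true≢false : ∀ {b} → b ≡ true → b ≢ false
true≢false refl ()

bool-≢ : ∀ {a b : Bool} → a ≢ b → a ≡ not b
bool-≢ {true}  {true}  a≢b = ⊥-elim (a≢b refl)
bool-≢ {true}  {false} _   = refl
bool-≢ {false} {true}  _   = refl
bool-≢ {false} {false} a≢b = ⊥-elim (a≢b refl)

not-≢ : ∀ b → b ≢ not b
not-≢ true  ()
not-≢ false ()

Bool-cases : ∀ (b p : Bool) → b ≡ p ⊎ b ≡ not p
Bool-cases true  true  = inj₁ refl
Bool-cases true  false = inj₂ refl
Bool-cases false true  = inj₂ refl
Bool-cases false false = inj₁ refl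

-- Boolean equality, hence an involution in the second argument. It turns colour `p` into colour
-- `true`, the side along which product-joins are taken.
agree : Bool → Bool → Bool
agree true  b = b
agree false b = not b

agree-≡ : ∀ p {b} → b ≡ p → agree p b ≡ true
agree-≡ true  refl = refl
agree-≡ false refl = refl

agree-true : ∀ p {b} → agree p b ≡ true → b ≡ p
agree-true true  q = q
agree-true false {false} _ = refl

agree-not : ∀ p b → agree (not p) b ≡ not (agree p b)
agree-not true  b = refl
agree-not false b = sym (not-involutive b)

agree-not′ : ∀ p b → agree p (not b) ≡ not (agree p b)
agree-not′ true  b = refl
agree-not′ false b = refl

agree-agree : ∀ p b → agree p (agree p b) ≡ b
agree-agree true  b = refl
agree-agree false b = not-involutive b

agree-≢ : ∀ p {a b} → a ≢ b → agree p a ≢ agree p b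
agree-≢ true  a≢b = a≢b
agree-≢ false a≢b = a≢b ∘ not-injective

-- A product-join is the induced subgraph of the Cartesian product on the pairs with at least one
-- coordinate on side `true`. The lemmas below give this coordinate view (`fst`, `snd`, `pair`,
-- `ok`, `adj-fst`, `adj-snd`, `adj-cases`), so that the three summands of `W` need not be inspected
-- again.
module ProductJoins (H₁ : Graph) (b₁ : Bipartition H₁) (H₂ : Graph) (b₂ : Bipartition H₂) where
  open PJ H₁ b₁ H₂ b₂ public using (W; Adj; graph)

  c₁ : V H₁ → Bool
  c₁ = proj₁ b₁

  c₂ : V H₂ → Bool
  c₂ = proj₁ b₂

  fst : W → V H₁
  fst (inj₁ ((a , _) , _))        = a
  fst (inj₂ (inj₁ ((a , _) , _))) = a
  fst (inj₂ (inj₂ ((b , _) , _))) = b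

  snd : W → V H₂
  snd (inj₁ (_ , (a , _)))        = a
  snd (inj₂ (inj₁ (_ , (b , _)))) = b
  snd (inj₂ (inj₂ (_ , (a , _)))) = a

  inA : W → Bool
  inA (inj₁ _) = true
  inA (inj₂ _) = false

  private
    uip : ∀ {a b : Bool} (p q : a ≡ b) → p ≡ q
    uip = Decidable⇒UIP.≡-irrelevant Bool._≟_

    clash : ∀ {A : Set} (c : A → Bool) {x y} → c x ≡ true → c y ≡ false → x ≢ y
    clash c p q refl = true≢false p q

  -- Equations in `Bool` have unique proofs, so the side certificates carry no information;
  -- different summands of `W` disagree on the side of some coordinate.
  pair-injective : ∀ w w′ → fst w ≡ fst w′ → snd w ≡ snd w′ → w ≡ w′
  pair-injective (inj₁ ((_ , p) , _ , q)) (inj₁ ((_ , p′) , _ , q′)) refl refl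
    rewrite uip p p′ | uip q q′ = refl
  pair-injective (inj₁ (_ , _ , q)) (inj₂ (inj₁ (_ , _ , q′))) _ eq = ⊥-elim (clash c₂ q q′ eq)
  pair-injective (inj₁ ((_ , p) , _)) (inj₂ (inj₂ ((_ , p′) , _))) eq _ = ⊥-elim (clash c₁ p p′ eq)
  pair-injective (inj₂ (inj₁ (_ , _ , q))) (inj₁ (_ , _ , q′)) _ eq = ⊥-elim (clash c₂ q′ q (sym eq))
  pair-injective (inj₂ (inj₁ ((_ , p) , _ , q))) (inj₂ (inj₁ ((_ , p′) , _ , q′))) refl refl
    rewrite uip p p′ | uip q q′ = refl
  pair-injective (inj₂ (inj₁ ((_ , p) , _))) (inj₂ (inj₂ ((_ , p′) , _))) eq _ = ⊥-elim (clash c₁ p p′ eq)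
  pair-injective (inj₂ (inj₂ ((_ , p) , _))) (inj₁ ((_ , p′) , _)) eq _ = ⊥-elim (clash c₁ p′ p (sym eq))
  pair-injective (inj₂ (inj₂ ((_ , p) , _))) (inj₂ (inj₁ ((_ , p′) , _))) eq _ = ⊥-elim (clash c₁ p′ p (sym eq))
  pair-injective (inj₂ (inj₂ ((_ , p) , _ , q))) (inj₂ (inj₂ ((_ , p′) , _ , q′))) refl refl
    rewrite uip p p′ | uip q q′ = refl

  pair : ∀ x y → c₁ x ≡ true ⊎ c₂ y ≡ true → Σ[ w ∈ W ] (fst w ≡ x × snd w ≡ y)
  pair x y ok with c₁ x in p | c₂ y in q
  ... | true  | true  = inj₁ ((x , p) , (y , q)) , refl , refl
  ... | true  | false = inj₂ (inj₁ ((x , p) , (y , q))) , refl , refl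
  ... | false | true  = inj₂ (inj₂ ((x , p) , (y , q))) , refl , refl
  pair x y (inj₁ ()) | false | false
  pair x y (inj₂ ()) | false | false

  ok : ∀ w → c₁ (fst w) ≡ true ⊎ c₂ (snd w) ≡ true
  ok (inj₁ ((_ , p) , _))        = inj₁ p
  ok (inj₂ (inj₁ ((_ , p) , _))) = inj₁ p
  ok (inj₂ (inj₂ (_ , _ , q)))   = inj₂ q

  inA-true : ∀ w → c₁ (fst w) ≡ true → c₂ (snd w) ≡ true → inA w ≡ true
  inA-true (inj₁ _) _ _ = refl
  inA-true (inj₂ (inj₁ (_ , _ , q))) _ q′ = ⊥-elim (true≢false q′ q)
  inA-true (inj₂ (inj₂ ((_ , p) , _))) p′ _ = ⊥-elim (true≢false p′ p)

  inA-false : ∀ w → c₁ (fst w) ≡ false ⊎ c₂ (snd w) ≡ false → inA w ≡ false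
  inA-false (inj₁ ((_ , p) , _)) (inj₁ p′) = ⊥-elim (true≢false p p′)
  inA-false (inj₁ (_ , _ , q)) (inj₂ q′) = ⊥-elim (true≢false q q′)
  inA-false (inj₂ _) _ = refl

  adj-fst : ∀ w w′ → _~_ H₁ (fst w) (fst w′) → snd w ≡ snd w′ → Adj w w′
  adj-fst (inj₁ ((_ , p) , _)) (inj₁ ((_ , p′) , _)) x~x′ _ = ⊥-elim (proj₂ b₁ x~x′ (trans p (sym p′)))
  adj-fst (inj₁ (_ , _ , q)) (inj₂ (inj₁ (_ , _ , q′))) _ eq = ⊥-elim (clash c₂ q q′ eq)
  adj-fst (inj₁ _) (inj₂ (inj₂ _)) x~x′ eq = eq , x~x′
  adj-fst (inj₂ (inj₁ (_ , _ , q))) (inj₁ (_ , _ , q′)) _ eq = ⊥-elim (clash c₂ q′ q (sym eq))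
  adj-fst (inj₂ (inj₁ ((_ , p) , _))) (inj₂ (inj₁ ((_ , p′) , _))) x~x′ _ = ⊥-elim (proj₂ b₁ x~x′ (trans p (sym p′)))
  adj-fst (inj₂ (inj₁ (_ , _ , q))) (inj₂ (inj₂ (_ , _ , q′))) _ eq = ⊥-elim (clash c₂ q′ q (sym eq))
  adj-fst (inj₂ (inj₂ _)) (inj₁ _) x~x′ eq = sym eq , ~sym H₁ x~x′
  adj-fst (inj₂ (inj₂ (_ , _ , q))) (inj₂ (inj₁ (_ , _ , q′))) _ eq = ⊥-elim (clash c₂ q q′ eq)
  adj-fst (inj₂ (inj₂ ((_ , p) , _))) (inj₂ (inj₂ ((_ , p′) , _))) x~x′ _ = ⊥-elim (proj₂ b₁ x~x′ (trans p (sym p′)))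

  adj-snd : ∀ w w′ → fst w ≡ fst w′ → _~_ H₂ (snd w) (snd w′) → Adj w w′
  adj-snd (inj₁ (_ , _ , q)) (inj₁ (_ , _ , q′)) _ y~y′ = ⊥-elim (proj₂ b₂ y~y′ (trans q (sym q′)))
  adj-snd (inj₁ _) (inj₂ (inj₁ _)) eq y~y′ = eq , y~y′
  adj-snd (inj₁ ((_ , p) , _)) (inj₂ (inj₂ ((_ , p′) , _))) eq _ = ⊥-elim (clash c₁ p p′ eq)
  adj-snd (inj₂ (inj₁ _)) (inj₁ _) eq y~y′ = sym eq , ~sym H₂ y~y′
  adj-snd (inj₂ (inj₁ (_ , _ , q))) (inj₂ (inj₁ (_ , _ , q′))) _ y~y′ = ⊥-elim (proj₂ b₂ y~y′ (trans q (sym q′)))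
  adj-snd (inj₂ (inj₁ ((_ , p) , _))) (inj₂ (inj₂ ((_ , p′) , _))) eq _ = ⊥-elim (clash c₁ p p′ eq)
  adj-snd (inj₂ (inj₂ ((_ , p) , _))) (inj₁ ((_ , p′) , _)) eq _ = ⊥-elim (clash c₁ p′ p (sym eq))
  adj-snd (inj₂ (inj₂ ((_ , p) , _))) (inj₂ (inj₁ ((_ , p′) , _))) eq _ = ⊥-elim (clash c₁ p′ p (sym eq))
  adj-snd (inj₂ (inj₂ (_ , _ , q))) (inj₂ (inj₂ (_ , _ , q′))) _ y~y′ = ⊥-elim (proj₂ b₂ y~y′ (trans q (sym q′)))

  adj-cases : ∀ w w′ → Adj w w′ →
    (_~_ H₁ (fst w) (fst w′) × snd w ≡ snd w′) ⊎ (fst w ≡ fst w′ × _~_ H₂ (snd w) (snd w′))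
  adj-cases (inj₁ _) (inj₂ (inj₁ _)) adj = inj₂ adj
  adj-cases (inj₁ _) (inj₂ (inj₂ _)) (eq , x~x′) = inj₁ (x~x′ , eq)
  adj-cases (inj₂ (inj₁ _)) (inj₁ _) (eq , y~y′) = inj₂ (sym eq , ~sym H₂ y~y′)
  adj-cases (inj₂ (inj₂ _)) (inj₁ _) (eq , x~x′) = inj₁ (~sym H₁ x~x′ , sym eq)

  bipartition : Bool → Bipartition graph
  bipartition p = colour , λ {w} {w′} → proper w w′
    where
    colour : W → Bool
    colour w = agree p (inA w)
    proper : ∀ w w′ → Adj w w′ → colour w ≢ colour w′
    proper (inj₁ _) (inj₂ _) _ = agree-≢ p λ ()
    proper (inj₂ (inj₁ _)) (inj₁ _) _ = agree-≢ p λ ()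
    proper (inj₂ (inj₂ _)) (inj₁ _) _ = agree-≢ p λ ()

neighbour : ∀ H → (∀ x y → Star (_~_ H) x y) → ∀ {x y} → x ≢ y → ∃[ z ] _~_ H x z
neighbour H conn {x} {y} x≢y with conn x y
... | ε       = ⊥-elim (x≢y refl)
... | s ◅ _ = _ , s

BothColours : (H : Graph) → Bipartition H → Set
BothColours H (c , _) = (∃[ x ] c x ≡ true) × (∃[ x ] c x ≡ false)

module _ (H₁ : Graph) (b₁ : Bipartition H₁) (H₂ : Graph) (b₂ : Bipartition H₂) where
  open ProductJoins H₁ b₁ H₂ b₂

  -- One coordinate can slide freely while the other rests on side `true`. A vertex whose first
  -- coordinate is on the wrong side first moves it to a neighbour, which exists because both
  -- colours occur. A one-vertex factor on the wrong side would leave the join without edges.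
  product-join-connected : Connected H₁ → BothColours H₁ b₁ → Connected H₂ → BothColours H₂ b₂ →
    Connected graph
  product-join-connected (_ , conn₁) ((a₁ , p₁) , _) (_ , conn₂) ((a₂ , p₂) , _) =
    base-point , λ w w′ → reverse (λ {x} {y} → PJ.Adj-sym H₁ b₁ H₂ b₂ {x} {y}) (to-base w) ◅◅ to-base w′
    where
    _⟶_ : W → W → Set
    _⟶_ = Star Adj
    point : ∀ x y → c₁ x ≡ true ⊎ c₂ y ≡ true → W
    point x y ok = proj₁ (pair x y ok)
    base-point : W
    base-point = point a₁ a₂ (inj₁ p₁)
    slide₁ : ∀ {y} → c₂ y ≡ true → ∀ {x x′} → Star (_~_ H₁) x x′ → ∀ w w′ →
             fst w ≡ x → snd w ≡ y → fst w′ ≡ x′ → snd w′ ≡ y → w ⟶ w′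
    slide₁ q ε w w′ refl refl e₁ e₂ rewrite pair-injective w w′ (sym e₁) (sym e₂) = ε
    slide₁ q (_◅_ {j = x″} s path) w w′ refl refl e₁ e₂ with pair x″ (snd w) (inj₂ q)
    ... | u , refl , e = adj-fst w u s (sym e) ◅ slide₁ q path u w′ refl e e₁ e₂
    slide₂ : ∀ {x} → c₁ x ≡ true → ∀ {y y′} → Star (_~_ H₂) y y′ → ∀ w w′ →
             snd w ≡ y → fst w ≡ x → snd w′ ≡ y′ → fst w′ ≡ x → w ⟶ w′
    slide₂ q ε w w′ refl refl e₂ e₁ rewrite pair-injective w w′ (sym e₁) (sym e₂) = ε
    slide₂ q (_◅_ {j = y″} s path) w w′ refl refl e₂ e₁ with pair (fst w) y″ (inj₁ q)
    ... | u , e , refl = adj-snd w u (sym e) s ◅ slide₂ q path u w′ refl e e₂ e₁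
    from-true : ∀ w → c₁ (fst w) ≡ true → base-point ⟶ w
    from-true w p with pair (fst w) a₂ (inj₁ p) | pair a₁ a₂ (inj₁ p₁)
    ... | u , e , e′ | v , f , f′ =
      slide₁ p₂ (conn₁ a₁ (fst w)) v u f f′ e e′ ◅◅ slide₂ p (conn₂ a₂ (snd w)) u w e′ e refl refl
    to-base : ∀ w → base-point ⟶ w
    to-base w with c₁ (fst w) in p
    ... | true = from-true w p
    ... | false with neighbour H₁ conn₁ {fst w} {a₁} (λ eq → true≢false p₁ (trans (cong c₁ (sym eq)) p))
    ... | x , s with ok w
    ... | inj₁ p′ = ⊥-elim (true≢false p′ p)
    ... | inj₂ q with pair x (snd w) (inj₂ q)
    ... | u , refl , e =
      from-true u (bool-≢ λ q′ → proj₂ b₁ s (trans p (sym q′)))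
        ◅◅ adj-fst u w (~sym H₁ s) e ◅ ε

recolour : ∀ H → Bool → Bipartition H → Bipartition H
recolour H p (c , proper) = (λ v → agree p (c v)) , λ s → agree-≢ p (proper s)

recolour-both : ∀ H p b → BothColours H b → BothColours H (recolour H p b)
recolour-both H true  b both = both
recolour-both H false b ((x , px) , (y , py)) = (y , cong not py) , (x , cong not px)

-- join true is series composition and join false is parallel composition.
data Term : Set where
  leaf : Term
  join : Bool → Term → Term → Term

mutual
  -- Recolouring by `p` makes colour `p` the side `A` of both factors: a series composition keeps
  -- the pairs with at least one tree, a parallel composition those with at least one forest.
  K : Term → Graph
  K leaf         = K2
  K (join p t u) = ProductJoin (K t) (recolour (K t) p (bip t)) (K u) (recolour (K u) p (bip u))

  -- Colour true: the edges chosen inside the network join its two terminals.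
  bip : (t : Term) → Bipartition (K t)
  bip leaf         = (λ b → b) , λ b≢b′ → b≢b′
  bip (join p t u) = ProductJoins.bipartition (K t) (recolour (K t) p (bip t)) (K u) (recolour (K u) p (bip u)) p

colour : ∀ t → V (K t) → Bool
colour t = proj₁ (bip t)

module Join (p : Bool) (t u : Term) where
  open ProductJoins (K t) (recolour (K t) p (bip t)) (K u) (recolour (K u) p (bip u)) public

  joinable : ∀ x y → colour t x ≡ p ⊎ colour u y ≡ p → Σ[ w ∈ W ] (fst w ≡ x × snd w ≡ y)
  joinable x y (inj₁ e) = pair x y (inj₁ (agree-≡ p e))
  joinable x y (inj₂ e) = pair x y (inj₂ (agree-≡ p e))

  colour-both : ∀ w → colour t (fst w) ≡ p → colour u (snd w) ≡ p → colour (join p t u) w ≡ p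
  colour-both w e f = trans (cong (agree p) (inA-true w (agree-≡ p e) (agree-≡ p f))) (lemma p)
    where
    lemma : ∀ p → agree p true ≡ p
    lemma true  = refl
    lemma false = refl

  colour-one : ∀ w → colour t (fst w) ≡ not p ⊎ colour u (snd w) ≡ not p → colour (join p t u) w ≡ not p
  colour-one w e = trans (cong (agree p) (inA-false w (lemma e))) (lemma′ p)
    where
    agree-¬ : ∀ p {b} → b ≡ not p → agree p b ≡ false
    agree-¬ true  e = e
    agree-¬ false e = cong not e
    lemma : colour t (fst w) ≡ not p ⊎ colour u (snd w) ≡ not p → c₁ (fst w) ≡ false ⊎ c₂ (snd w) ≡ false
    lemma (inj₁ e) = inj₁ (agree-¬ p e)
    lemma (inj₂ e) = inj₂ (agree-¬ p e)
    lemma′ : ∀ p → agree p false ≡ not p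
    lemma′ true  = refl
    lemma′ false = refl

  some : ∀ w → colour t (fst w) ≡ p ⊎ colour u (snd w) ≡ p
  some w with ok w
  ... | inj₁ e = inj₁ (agree-true p e)
  ... | inj₂ e = inj₂ (agree-true p e)

K-both : ∀ t → BothColours (K t) (bip t)
K-both leaf = (true , refl) , (false , refl)
K-both (join p t u) = answer p (K-both t) (K-both u)
  where
  pick : ∀ {t} → BothColours (K t) (bip t) → ∀ b → ∃[ x ] colour t x ≡ b
  pick (x , _) true  = x
  pick (_ , y) false = y
  answer : ∀ p → BothColours (K t) (bip t) → BothColours (K u) (bip u) → BothColours (K (join p t u)) (bip (join p t u))
  answer p bt bu with pick {t} bt p | pick {u} bu p | pick {u} bu (not p)
  ... | x , ex | y , ey | z , ez with Join.joinable p t u x y (inj₁ ex) | Join.joinable p t u x z (inj₁ ex)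
  ... | w , e₁ , e₂ | w′ , _ , e₃ =
    both p (Join.colour-both p t u w (trans (cong (colour t) e₁) ex) (trans (cong (colour u) e₂) ey))
           (Join.colour-one p t u w′ (inj₂ (trans (cong (colour u) e₃) ez)))
    where
    both : ∀ q → colour (join p t u) w ≡ q → colour (join p t u) w′ ≡ not q → BothColours (K (join p t u)) (bip (join p t u))
    both true  e f = (w , e) , (w′ , f)
    both false e f = (w′ , f) , (w , e)

K-connected : ∀ t → Connected (K t)
K-connected leaf = true , λ where
  true  true  → ε
  true  false → (λ ()) ◅ ε
  false true  → (λ ()) ◅ ε
  false false → ε
K-connected (join p t u) = product-join-connected (K t) (recolour (K t) p (bip t)) (K u) (recolour (K u) p (bip u))
  (K-connected t) (recolour-both (K t) p (bip t) (K-both t))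
  (K-connected u) (recolour-both (K u) p (bip u) (K-both u))

K-reducible : ∀ t → PJReducible (K t)
K-reducible leaf = base
K-reducible (join p t u) = join (K-reducible t) (K-reducible u) (K-connected t) (K-connected u)
  (recolour (K t) p (bip t)) (recolour (K u) p (bip u))

-- Product-joins depend on the sides, so they are functorial only for embeddings that respect
-- colours.
record ColourEmbedding (H : Graph) (b : Bipartition H) (H′ : Graph) (b′ : Bipartition H′) : Set where
  field
    embed           : V H → V H′
    embed-injective : ∀ x y → embed x ≡ embed y → x ≡ y
    embed-adjacent  : ∀ {x y} → _~_ H x y → _~_ H′ (embed x) (embed y)
    embed-coloured  : ∀ x → proj₁ b′ (embed x) ≡ proj₁ b x
open ColourEmbedding

module _ {H₁ b₁ H₂ b₂ H₁′ b₁′ H₂′ b₂′} (f₁ : ColourEmbedding H₁ b₁ H₁′ b₁′) (f₂ : ColourEmbedding H₂ b₂ H₂′ b₂′) where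
  private
    module X = ProductJoins H₁ b₁ H₂ b₂
    module Y = ProductJoins H₁′ b₁′ H₂′ b₂′

    image : ∀ w → Σ[ w′ ∈ Y.W ] (Y.fst w′ ≡ embed f₁ (X.fst w) × Y.snd w′ ≡ embed f₂ (X.snd w))
    image w = Y.pair _ _ (good (X.ok w))
      where
      good : X.c₁ (X.fst w) ≡ true ⊎ X.c₂ (X.snd w) ≡ true → _
      good (inj₁ e) = inj₁ (trans (embed-coloured f₁ _) e)
      good (inj₂ e) = inj₂ (trans (embed-coloured f₂ _) e)

  -- A pair of colour-preserving maps sends allowed pairs to allowed pairs and keeps the block A₁ ×
  -- A₂. The parameters only say which colour that block receives: `p` in the source, `q` in the
  -- target, and `r` reconciles the two. Duality needs `r` to be `false`.
  join-embedding : ∀ p q r → (∀ b → agree q b ≡ agree r (agree p b)) →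
    ColourEmbedding X.graph (X.bipartition p) Y.graph (recolour Y.graph r (Y.bipartition q))
  join-embedding p q r pq = record
    { embed           = λ w → proj₁ (image w)
    ; embed-injective = λ w w′ eq →
        let (_ , e₁ , e₂) = image w
            (_ , e₁′ , e₂′) = image w′
        in X.pair-injective w w′
             (embed-injective f₁ _ _ (trans (sym e₁) (trans (cong Y.fst eq) e₁′)))
             (embed-injective f₂ _ _ (trans (sym e₂) (trans (cong Y.snd eq) e₂′)))
    ; embed-adjacent  = λ {w} {w′} s → adj w w′ (X.adj-cases w w′ s)
    ; embed-coloured  = λ w → trans (cong (agree r) (pq _)) (trans (agree-agree r _) (cong (agree p) (same-side w)))
    }
    where
    adj : ∀ w w′ → (_~_ H₁ (X.fst w) (X.fst w′) × X.snd w ≡ X.snd w′) ⊎ (X.fst w ≡ X.fst w′ × _~_ H₂ (X.snd w) (X.snd w′)) →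
          Y.Adj (proj₁ (image w)) (proj₁ (image w′))
    adj w w′ s with image w | image w′
    adj w w′ (inj₁ (s , eq)) | v , e₁ , e₂ | v′ , e₁′ , e₂′ =
      Y.adj-fst v v′ (subst₂ (_~_ H₁′) (sym e₁) (sym e₁′) (embed-adjacent f₁ s)) (trans e₂ (trans (cong (embed f₂) eq) (sym e₂′)))
    adj w w′ (inj₂ (eq , s)) | v , e₁ , e₂ | v′ , e₁′ , e₂′ =
      Y.adj-snd v v′ (trans e₁ (trans (cong (embed f₁) eq) (sym e₁′))) (subst₂ (_~_ H₂′) (sym e₂) (sym e₂′) (embed-adjacent f₂ s))
    same-side : ∀ w → Y.inA (proj₁ (image w)) ≡ X.inA w
    same-side w with image w
    ... | v , e₁ , e₂ = side (Y.c₁ (Y.fst v)) (Y.c₂ (Y.snd v)) refl refl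
      where
      k₁ : Y.c₁ (Y.fst v) ≡ X.c₁ (X.fst w)
      k₁ = trans (cong Y.c₁ e₁) (embed-coloured f₁ _)
      k₂ : Y.c₂ (Y.snd v) ≡ X.c₂ (X.snd w)
      k₂ = trans (cong Y.c₂ e₂) (embed-coloured f₂ _)
      side : ∀ a b → Y.c₁ (Y.fst v) ≡ a → Y.c₂ (Y.snd v) ≡ b → Y.inA v ≡ X.inA w
      side true true p q = trans (Y.inA-true v p q) (sym (X.inA-true w (trans (sym k₁) p) (trans (sym k₂) q)))
      side false _ p q = trans (Y.inA-false v (inj₁ p)) (sym (X.inA-false w (inj₁ (trans (sym k₁) p))))
      side true false p q = trans (Y.inA-false v (inj₂ q)) (sym (X.inA-false w (inj₂ (trans (sym k₂) q))))

dual : Term → Term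
dual leaf         = leaf
dual (join p t u) = join (not p) (dual t) (dual u)

recolour-embedding : ∀ H b H′ b′ p → ColourEmbedding H b H′ (recolour H′ false b′) →
  ColourEmbedding H (recolour H p b) H′ (recolour H′ (not p) b′)
recolour-embedding H b H′ b′ p f = record
  { embed = embed f ; embed-injective = embed-injective f ; embed-adjacent = embed-adjacent f
  ; embed-coloured = λ x → trans (agree-not p _) (trans (sym (agree-not′ p _)) (cong (agree p) (embed-coloured f x)))
  }

-- Dualising reverses the colours of both factors and at the same time replaces `p` by `not p`. The
-- two reversals cancel in the choice of side `A`, so the same pairs are allowed; only the colour of
-- the result is reversed.
dual-embedding : ∀ t → ColourEmbedding (K t) (bip t) (K (dual t)) (recolour (K (dual t)) false (bip (dual t)))
dual-embedding leaf = record
  { embed = not ; embed-injective = λ _ _ → not-injective ; embed-adjacent = λ x≢y → x≢y ∘ not-injective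
  ; embed-coloured = not-involutive }
dual-embedding (join p t u) =
  join-embedding (recolour-embedding (K t) (bip t) (K (dual t)) (bip (dual t)) p (dual-embedding t))
    (recolour-embedding (K u) (bip u) (K (dual u)) (bip (dual u)) p (dual-embedding u))
  
    p (not p) false (agree-not p)

embedding-trans : ∀ H H′ H″ → IsoToSubgraph H H′ → IsoToSubgraph H′ H″ → IsoToSubgraph H H″
embedding-trans H H′ H″ (f , f-inj , f-adj) (g , g-inj , g-adj) =
  (g ∘ f) , (λ x y → f-inj x y ∘ g-inj _ _) , g-adj ∘ f-adj

bipartition-along : ∀ H (b b′ : Bipartition H) {x y} → Star (_~_ H) x y →
  proj₁ b x ≡ proj₁ b′ x → proj₁ b y ≡ proj₁ b′ y
bipartition-along H b b′ ε e = e
bipartition-along H b b′ (s ◅ path) e = bipartition-along H b b′ path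
  (not-injective (trans (sym (bool-≢ (proj₂ b s))) (trans e (bool-≢ (proj₂ b′ s)))))

bipartition-unique : ∀ H → Connected H → (b b′ : Bipartition H) →
  (∀ x → proj₁ b x ≡ proj₁ b′ x) ⊎ (∀ x → not (proj₁ b x) ≡ proj₁ b′ x)
bipartition-unique H (x₀ , conn) b b′ with Bool-cases (proj₁ b′ x₀) (proj₁ b x₀)
... | inj₁ e = inj₁ λ x → bipartition-along H b b′ (conn x₀ x) (sym e)
... | inj₂ e = inj₂ λ x → bipartition-along H (recolour H false b) b′ (conn x₀ x) (sym e)

-- A product-join may use any bipartition of its factors, whereas `K t` comes with a fixed one. A
-- connected graph has only two bipartitions, so the colouring pulled back from `K t` is `b` or its
-- reverse, and `dual` repairs the second case. The target is written with `recolour` by `true`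
-- because factors appear so in `K (join true t u)`.
coloured-term : ∀ H → Connected H → (b : Bipartition H) → Σ[ t ∈ Term ] IsoToSubgraph H (K t) →
  Σ[ t ∈ Term ] ColourEmbedding H b (K t) (recolour (K t) true (bip t))
coloured-term H conn b (t , f , f-inj , f-adj)
  with bipartition-unique H conn b ((λ x → colour t (f x)) , λ s → proj₂ (bip t) (f-adj s))
... | inj₁ e = t , record { embed = f ; embed-injective = f-inj ; embed-adjacent = f-adj ; embed-coloured = λ x → sym (e x) }
... | inj₂ e = dual t , record
  { embed = embed δ ∘ f ; embed-injective = λ x y → f-inj x y ∘ embed-injective δ _ _ ; embed-adjacent = embed-adjacent δ ∘ f-adj
  ; embed-coloured = λ x → not-injective (trans (embed-coloured δ (f x)) (sym (e x))) }
  where δ = dual-embedding t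

reducible-term : ∀ {H} → PJReducible H → Σ[ t ∈ Term ] IsoToSubgraph H (K t)
reducible-term base = leaf , (λ x → x) , (λ _ _ e → e) , λ s → s
reducible-term (sub {G} {H} red _ emb) with reducible-term red
... | t , f = t , embedding-trans H G (K t) emb f
reducible-term (join {H₁} {H₂} red₁ red₂ conn₁ conn₂ b₁ b₂)
  with coloured-term H₁ conn₁ b₁ (reducible-term red₁) | coloured-term H₂ conn₂ b₂ (reducible-term red₂)
... | t , f | u , g = join true t u , embed h , embed-injective h , λ {x} {y} → embed-adjacent h {x} {y}
  where h = join-embedding f g true true true (λ b → refl)

-- Walks and trees

Mask : ℕ → Set
Mask k = Fin k → Bool

infix 4 _∋_
_∋_ : ∀ {k} → Mask k → Fin k → Set
S ∋ t = S t ≡ true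

_[_≔_] : ∀ {k} {a} {A : Set a} → (Fin k → A) → Fin k → A → Fin k → A
(h [ i ≔ a ]) j with j ≟ i
... | yes _ = a
... | no  _ = h j

set-same : ∀ {k a} {A : Set a} (h : Fin k → A) i {a : A} → (h [ i ≔ a ]) i ≡ a
set-same h i with i ≟ i
... | yes _   = refl
... | no  i≢i = ⊥-elim (i≢i refl)

set-other : ∀ {k a} {A : Set a} (h : Fin k → A) i {a : A} {j} → j ≢ i → (h [ i ≔ a ]) j ≡ h j
set-other h i {j = j} j≢i with j ≟ i
... | yes j≡i = ⊥-elim (j≢i j≡i)
... | no  _   = refl

graph : ∀ {k l} → (Fin l → Fin k) → (Fin l → Fin k) → Multigraph
graph {k} {l} s t = record { n = k ; m = l ; src = s ; tgt = t }

Ends : (G : Multigraph) → Fin (m G) → Fin (n G) → Fin (n G) → Set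
Ends G t u v = (src G t ≡ u × tgt G t ≡ v) ⊎ (src G t ≡ v × tgt G t ≡ u)

module _ (G : Multigraph) where

  Ends-sym : ∀ {t u v} → Ends G t u v → Ends G t v u
  Ends-sym (inj₁ e) = inj₂ e
  Ends-sym (inj₂ e) = inj₁ e

  edge : ∀ {P u v} t → P t → Ends G t u v → Reach G P u v
  edge t p e = (t , p , e) ◅ ε

  step : ∀ {P} t → P t → Reach G P (src G t) (tgt G t)
  step t p = edge t p (inj₁ (refl , refl))

  stay : ∀ {P u v} → u ≡ v → Reach G P u v
  stay refl = ε

  reach-sym : ∀ {P u v} → Reach G P u v → Reach G P v u
  reach-sym = reverse λ (t , p , e) → t , p , Ends-sym e

  reach-mono : ∀ {P Q : Fin (m G) → Set} → (∀ t → P t → Q t) → ∀ {u v} → Reach G P u v → Reach G Q u v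
  reach-mono f = gmap id λ (t , p , e) → t , f t p , e

reach-map : ∀ G G′ {P : Fin (m G) → Set} {P′} (g : Fin (n G) → Fin (n G′)) →
  (∀ t → P t → Reach G′ P′ (g (src G t)) (g (tgt G t))) →
  ∀ {u v} → Reach G P u v → Reach G′ P′ (g u) (g v)
reach-map G G′ g f = kleisliStar g λ where
  (t , p , inj₁ (refl , refl)) → f t p
  (t , p , inj₂ (refl , refl)) → reach-sym G′ (f t p)

-- The predicate `A` restricts the vertices to be spanned, since vertices removed by a reduction
-- stay in the vertex type.
IsTree : (G : Multigraph) → (Fin (n G) → Set) → Mask (m G) → Set
IsTree G A S =
  (∀ u v → A u → A v → Reach G (S ∋_) u v) ×
  (∀ t → S ∋ t → ¬ Reach G (λ s → S ∋ s × s ≢ t) (src G t) (tgt G t))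

tree-no-loop : ∀ G {A S} → IsTree G A S → ∀ t → S ∋ t → src G t ≢ tgt G t
tree-no-loop G (_ , acyclic) t p eq = acyclic t p (stay G eq)

orient : ∀ G {P u v} e → Ends G e u v → Reach G P u v → Reach G P (src G e) (tgt G e)
orient G e (inj₁ (refl , refl)) r = r
orient G e (inj₂ (refl , refl)) r = reach-sym G r

-- Walks translate edge by edge: `σ` transports spanning forwards and `π` pulls cycles back.
-- Injectivity of `π` on `S′` prevents a cycle of two parallel edges from collapsing onto a single
-- edge.
tree-rename : ∀ {k l l′} (s t : Fin l → Fin k) (s′ t′ : Fin l′ → Fin k) {A S S′}
  (σ : Fin l → Fin l′) (π : Fin l′ → Fin l) →
  (∀ e → S ∋ e → S′ ∋ σ e × Ends (graph s′ t′) (σ e) (s e) (t e)) →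
  (∀ e → S′ ∋ e → S ∋ π e × Ends (graph s t) (π e) (s′ e) (t′ e)) →
  (∀ e e′ → S′ ∋ e → S′ ∋ e′ → π e ≡ π e′ → e ≡ e′) →
  IsTree (graph s t) A S → IsTree (graph s′ t′) A S′
tree-rename s t s′ t′ σ π to from π-inj (spans , acyclic) =
  (λ u v a b → reach-map G G′ id (λ e p → edge G′ (σ e) (proj₁ (to e p)) (proj₂ (to e p))) (spans u v a b)) ,
  λ e p r → acyclic (π e) (proj₁ (from e p)) (orient G (π e) (proj₂ (from e p))
    (reach-map G′ G id (λ e′ (q , e′≢e) → edge G (π e′) (proj₁ (from e′ q) , e′≢e ∘ π-inj e′ e q p) (proj₂ (from e′ q))) r))
  where
  G = graph s t
  G′ = graph s′ t′

-- K4 minors from vertices with three neighbours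

size : ∀ {k} → Mask k → ℕ
size {zero}  S = 0
size {suc k} S with S zero
... | true  = suc (size (S ∘ suc))
... | false = size (S ∘ suc)

size-≤ : ∀ {k} (S T : Mask k) → (∀ v → S ∋ v → T ∋ v) → size S ≤ size T
size-≤ {zero}  S T S⊆T = z≤n
size-≤ {suc k} S T S⊆T with S zero in p | T zero in q
... | true  | true  = s≤s (size-≤ (S ∘ suc) (T ∘ suc) (S⊆T ∘ suc))
... | true  | false = ⊥-elim (true≢false (S⊆T zero p) q)
... | false | true  = m≤n⇒m≤1+n (size-≤ (S ∘ suc) (T ∘ suc) (S⊆T ∘ suc))
... | false | false = size-≤ (S ∘ suc) (T ∘ suc) (S⊆T ∘ suc)

size-< : ∀ {k} (S T : Mask k) → (∀ v → S ∋ v → T ∋ v) → ∀ v → S v ≡ false → T ∋ v → size S < size T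
size-< {suc k} S T S⊆T v p q with S zero in p₀ | T zero in q₀
size-< {suc k} S T S⊆T v p q | true | false = ⊥-elim (true≢false (S⊆T zero p₀) q₀)
size-< {suc k} S T S⊆T v p q | false | true = s≤s (size-≤ (S ∘ suc) (T ∘ suc) (S⊆T ∘ suc))
size-< {suc k} S T S⊆T zero p q | true | true = ⊥-elim (true≢false p₀ p)
size-< {suc k} S T S⊆T (suc v) p q | true | true = s≤s (size-< (S ∘ suc) (T ∘ suc) (S⊆T ∘ suc) v p q)
size-< {suc k} S T S⊆T zero p q | false | false = ⊥-elim (true≢false q q₀)
size-< {suc k} S T S⊆T (suc v) p q | false | false = size-< (S ∘ suc) (T ∘ suc) (S⊆T ∘ suc) v p q

module _ {k : ℕ} where

  infixl 6 _⊔_ _∖_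

  _⊔_ _∖_ : Mask k → Mask k → Mask k
  (S ⊔ T) v = S v ∨ T v
  (S ∖ T) v = S v ∧ not (T v)

  only : Fin k → Mask k
  only u v = does (v ≟ u)

  ⊔-left : ∀ (S T : Mask k) {v} → S ∋ v → (S ⊔ T) ∋ v
  ⊔-left S T p rewrite p = refl

  ⊔-right : ∀ (S T : Mask k) {v} → T ∋ v → (S ⊔ T) ∋ v
  ⊔-right S T {v} p rewrite p = ∨-zeroʳ (S v)

  ⊔-cases : ∀ (S T : Mask k) {v} → (S ⊔ T) ∋ v → S ∋ v ⊎ T ∋ v
  ⊔-cases S T {v} p with S v
  ... | true  = inj₁ refl
  ... | false = inj₂ p

  ∖-intro : ∀ (S T : Mask k) {v} → S ∋ v → T v ≡ false → (S ∖ T) ∋ v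
  ∖-intro S T p q rewrite p | q = refl

  ∖-⊆ : ∀ (S T : Mask k) {v} → (S ∖ T) ∋ v → S ∋ v
  ∖-⊆ S T {v} p with S v
  ... | true = refl

  ∖-∉ : ∀ (S T : Mask k) {v} → (S ∖ T) ∋ v → T v ≡ false
  ∖-∉ S T {v} p with S v | T v
  ... | true | false = refl

  only-self : ∀ u → only u ∋ u
  only-self u with u ≟ u
  ... | yes _ = refl
  ... | no u≢u = ⊥-elim (u≢u refl)

  only-≡ : ∀ u {v} → only u ∋ v → v ≡ u
  only-≡ u {v} p with v ≟ u
  ... | yes e = e

  only-≢ : ∀ u {v} → v ≢ u → only u v ≡ false
  only-≢ u {v} v≢u with v ≟ u
  ... | yes e = ⊥-elim (v≢u e)
  ... | no _ = refl

  ∉-only : ∀ u {v} → only u v ≡ false → v ≢ u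
  ∉-only u p refl = true≢false (only-self u) p

member : ∀ {k} (S : Mask k) v → S ∋ v ⊎ S v ≡ false
member S v = Bool-cases (S v) true

Disjoint : ∀ {k} → Mask k → Mask k → Set
Disjoint S T = ∀ v → S ∋ v → ¬ (T ∋ v)

search : ∀ {k} {P Q : Fin k → Set} → (∀ v → P v ⊎ Q v) → ∃ P ⊎ (∀ v → Q v)
search {zero} f = inj₂ λ ()
search {suc k} f with f zero | search (f ∘ suc)
... | inj₁ p | _ = inj₁ (zero , p)
... | inj₂ q | inj₁ (v , p) = inj₁ (suc v , p)
... | inj₂ q | inj₂ qs = inj₂ λ { zero → q ; (suc v) → qs v }

symmetric-pairs : ∀ (R : Fin 4 → Fin 4 → Set) → (∀ {i j} → R i j → R j i) →
  R zero (suc zero) → R zero (suc (suc zero)) → R zero (suc (suc (suc zero))) →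
  R (suc zero) (suc (suc zero)) → R (suc zero) (suc (suc (suc zero))) →
  R (suc (suc zero)) (suc (suc (suc zero))) → ∀ i j → i ≢ j → R i j
symmetric-pairs R s r₀₁ r₀₂ r₀₃ r₁₂ r₁₃ r₂₃ = λ where
  zero zero 0≢0 → ⊥-elim (0≢0 refl)
  zero (suc zero) _ → r₀₁
  zero (suc (suc zero)) _ → r₀₂
  zero (suc (suc (suc zero))) _ → r₀₃
  (suc zero) zero _ → s r₀₁
  (suc zero) (suc zero) 1≢1 → ⊥-elim (1≢1 refl)
  (suc zero) (suc (suc zero)) _ → r₁₂
  (suc zero) (suc (suc (suc zero))) _ → r₁₃
  (suc (suc zero)) zero _ → s r₀₂
  (suc (suc zero)) (suc zero) _ → s r₁₂
  (suc (suc zero)) (suc (suc zero)) 2≢2 → ⊥-elim (2≢2 refl)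
  (suc (suc zero)) (suc (suc (suc zero))) _ → r₂₃
  (suc (suc (suc zero))) zero _ → s r₀₃
  (suc (suc (suc zero))) (suc zero) _ → s r₁₃
  (suc (suc (suc zero))) (suc (suc zero)) _ → s r₂₃
  (suc (suc (suc zero))) (suc (suc (suc zero))) 3≢3 → ⊥-elim (3≢3 refl)

module Minors (G : Multigraph) where

  Vertices : Set
  Vertices = Mask (n G)

  Adjacent : Fin (n G) → Fin (n G) → Set
  Adjacent u v = ∃[ t ] Ends G t u v

  adjacent? : ∀ u v → Dec (Adjacent u v)
  adjacent? u v = any? λ t → ((src G t ≟ u) ×-dec (tgt G t ≟ v)) ⊎-dec ((src G t ≟ v) ×-dec (tgt G t ≟ u))

  adjacent-sym : ∀ {u v} → Adjacent u v → Adjacent v u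
  adjacent-sym (t , e) = t , Ends-sym G e

  Inside : Vertices → Fin (m G) → Set
  Inside S t = S ∋ src G t × S ∋ tgt G t

  ends-inside : ∀ (S : Vertices) t {u v} → Ends G t u v → S ∋ u → S ∋ v → Inside S t
  ends-inside S t (inj₁ (refl , refl)) p q = p , q
  ends-inside S t (inj₂ (refl , refl)) p q = q , p

  inside-ends : ∀ (S : Vertices) t {u v} → Ends G t u v → Inside S t → S ∋ v
  inside-ends S t (inj₁ (refl , refl)) (p , q) = q
  inside-ends S t (inj₂ (refl , refl)) (p , q) = p

  Conn : Vertices → Set
  Conn S = ∀ u v → S ∋ u → S ∋ v → Reach G (Inside S) u v

  Touches : Vertices → Fin (n G) → Set
  Touches S v = ∃[ u ] (S ∋ u × Adjacent u v)

  Touch : Vertices → Vertices → Set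
  Touch S T = ∃[ v ] (T ∋ v × Touches S v)

  touch? : ∀ S T → Dec (Touch S T)
  touch? S T = any? λ v → (T v Bool.≟ true) ×-dec any? λ u → (S u Bool.≟ true) ×-dec adjacent? u v

  touch-sym : ∀ {S T} → Touch S T → Touch T S
  touch-sym (v , q , u , p , uv) = u , p , v , q , adjacent-sym uv

  only-conn : ∀ u → Conn (only u)
  only-conn u v w p q = stay G (trans (only-≡ u p) (sym (only-≡ u q)))

  inside-mono : ∀ {S T : Vertices} → (∀ v → S ∋ v → T ∋ v) → ∀ {u v} → Reach G (Inside S) u v → Reach G (Inside T) u v
  inside-mono S⊆T = reach-mono G λ t (p , q) → S⊆T _ p , S⊆T _ q

  ⊔-conn : ∀ S T → Conn S → Conn T → Touch S T → Conn (S ⊔ T)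
  ⊔-conn S T cS cT (y , y∈T , x , x∈S , t , e) u v p q = reach-sym G (from-x u p) ◅◅ from-x v q
    where
    from-x : ∀ v → (S ⊔ T) ∋ v → Reach G (Inside (S ⊔ T)) x v
    from-x v p with ⊔-cases S T p
    ... | inj₁ v∈S = inside-mono {S} (λ _ → ⊔-left S T) (cS x v x∈S v∈S)
    ... | inj₂ v∈T = edge G t (ends-inside (S ⊔ T) t e (⊔-left S T x∈S) (⊔-right S T y∈T)) e
                     ◅◅ inside-mono {T} (λ _ → ⊔-right S T) (cT y v y∈T v∈T)

  crossing : ∀ {P u v} (X : Vertices) → Reach G P u v → X ∋ u → X v ≡ false →
    ∃[ t ] ∃[ a ] ∃[ b ] (P t × Ends G t a b × X ∋ a × X b ≡ false)
  crossing X ε p q = ⊥-elim (true≢false p q)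
  crossing X (_◅_ {i = a} {j = b} (t , pt , e) r) p q with member X b
  ... | inj₁ p′ = crossing X r p′ q
  ... | inj₂ q′ = t , a , b , pt , e , p , q′

  Closed : Vertices → Vertices → Set
  Closed D X = ∀ u v → X ∋ u → D ∋ v → Adjacent u v → X ∋ v

  record Component (D : Vertices) (x : Fin (n G)) : Set where
    field
      part   : Vertices
      root   : part ∋ x
      within : ∀ v → part ∋ v → D ∋ v
      conn   : Conn part
      closed : Closed D part

  closed-reach : ∀ {D X} → Closed D X → ∀ {u v} → Reach G (Inside D) u v → X ∋ u → X ∋ v
  closed-reach cl ε p = p
  closed-reach {D} cl ((t , i , e) ◅ r) p = closed-reach {D} cl r (cl _ _ p (inside-ends D t e i) (t , e))

  component : ∀ D x → D ∋ x → Component D x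
  component D x x∈D = grow (only x) (<-wellFounded _) (only-self x)
      (λ v p → subst (D ∋_) (sym (only-≡ x p)) x∈D) (only-conn x)
    where
    grow : ∀ X → Acc _<_ (size (D ∖ X)) → X ∋ x → (∀ v → X ∋ v → D ∋ v) → Conn X → Component D x
    grow X (acc smaller) x∈X X⊆D cX with touch? X (D ∖ X)
    ... | no ¬t = record
      { part = X ; root = x∈X ; within = X⊆D ; conn = cX
      ; closed = λ u v u∈X v∈D uv → bool-≢ λ v∉X → ¬t (v , ∖-intro D X v∈D v∉X , u , u∈X , uv) }
    ... | yes (v , v∈D∖X , touches) = grow (X ⊔ only v) (smaller shrink) (⊔-left X (only v) x∈X)
        (λ w p → case ⊔-cases X (only v) p of λ where
          (inj₁ w∈X) → X⊆D w w∈X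
          (inj₂ w≡v) → subst (D ∋_) (sym (only-≡ v w≡v)) (∖-⊆ D X v∈D∖X))
        (⊔-conn X (only v) cX (only-conn v) (v , only-self v , touches))
      where
      shrink : size (D ∖ (X ⊔ only v)) < size (D ∖ X)
      shrink = size-< (D ∖ (X ⊔ only v)) (D ∖ X)
        (λ w p → ∖-intro D X (∖-⊆ D (X ⊔ only v) p)
          (bool-≢ λ w∈X → true≢false (⊔-left X (only v) w∈X) (∖-∉ D (X ⊔ only v) p)))
        v (bool-≢ λ p → true≢false (⊔-right X (only v) (only-self v)) (∖-∉ D (X ⊔ only v) p)) v∈D∖X

  -- `X` is joined to the rest of `D` only through `u`, so sending all of `X` to `u` maps walks in
  -- `D` to walks in the rest; hence the rest stays connected.
  module Removal (D : Vertices) (cD : Conn D) (u : Fin (n G)) (u∈D : D ∋ u)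
    (X : Vertices) (X⊆ : ∀ v → X ∋ v → (D ∖ only u) ∋ v) (closed : Closed (D ∖ only u) X) where

    X⊆D : ∀ v → X ∋ v → D ∋ v
    X⊆D v p = ∖-⊆ D (only u) (X⊆ v p)

    u∉X : X u ≡ false
    u∉X = bool-≢ λ p → true≢false (only-self u) (∖-∉ D (only u) (X⊆ u p))

    u∈rest : (D ∖ X) ∋ u
    u∈rest = ∖-intro D X u∈D u∉X

    smaller : size X < size D
    smaller = size-< X D X⊆D u u∉X u∈D

    leaves-to-u : ∀ {v w} → X ∋ v → D ∋ w → Adjacent v w → X w ≡ false → w ≡ u
    leaves-to-u {v} {w} v∈X w∈D vw w∉X with w ≟ u
    ... | yes e = e
    ... | no w≢u = ⊥-elim (true≢false (closed v w v∈X (∖-intro D (only u) w∈D (only-≢ u w≢u)) vw) w∉X)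

    collapse : Fin (n G) → Fin (n G)
    collapse v = [ (λ _ → u) , (λ _ → v) ]′ (member X v)

    collapse-out : ∀ {v} → X v ≡ false → collapse v ≡ v
    collapse-out {v} q with member X v
    ... | inj₁ p = ⊥-elim (true≢false p q)
    ... | inj₂ _ = refl

    rest-conn : Conn (D ∖ X)
    rest-conn a b p q = subst₂ (Reach G (Inside (D ∖ X))) (collapse-out (∖-∉ D X p)) (collapse-out (∖-∉ D X q))
      (reach-map G G collapse along (cD a b (∖-⊆ D X p) (∖-⊆ D X q)))
      where
      along : ∀ t → Inside D t → Reach G (Inside (D ∖ X)) (collapse (src G t)) (collapse (tgt G t))
      along t (i , j) with member X (src G t) | member X (tgt G t)
      ... | inj₁ _ | inj₁ _ = ε
      ... | inj₁ p | inj₂ q = stay G (sym (leaves-to-u p j (t , inj₁ (refl , refl)) q))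
      ... | inj₂ p | inj₁ q = stay G (leaves-to-u q i (t , inj₂ (refl , refl)) p)
      ... | inj₂ p | inj₂ q = step G t (∖-intro D X i p , ∖-intro D X j q)

    rest-touches : ∀ x → X ∋ x → Touch (D ∖ X) X
    rest-touches x x∈X with crossing X (cD x u (X⊆D x x∈X) u∈D) x∈X u∉X
    ... | t , a , b , i , e , a∈X , b∉X =
      a , a∈X , b , ∖-intro D X (inside-ends D t e i) b∉X , t , Ends-sym G e

  four-branch-sets : (B : Fin 4 → Vertices) → (∀ i j → i ≢ j → Disjoint (B i) (B j)) →
    (∀ i → ∃[ v ] B i ∋ v) → (∀ i → Conn (B i)) → (∀ i j → i ≢ j → Touch (B i) (B j)) → K4MinorModel G
  four-branch-sets B disjoint nonempty conn touch =
    β , (λ i → let (v , p) = nonempty i in v , to p) ,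
    (λ i u v p q → reach-mono G (λ t (a , b) → to a , to b) (conn i u v (from p) (from q))) ,
    λ i j i≢j → let (v , q , u , p , t , e) = touch i j i≢j in t , colours t e (to p) (to q)
    where
    β : Fin (n G) → Maybe (Fin 4)
    β v with any? (λ i → B i v Bool.≟ true)
    ... | yes (i , _) = just i
    ... | no _ = nothing
    to : ∀ {i v} → B i ∋ v → β v ≡ just i
    to {i} {v} p with any? (λ i → B i v Bool.≟ true)
    ... | no none = ⊥-elim (none (i , p))
    ... | yes (j , q) with j ≟ i
    ... | yes refl = refl
    ... | no j≢i = ⊥-elim (disjoint j i j≢i v q p)
    from : ∀ {i v} → β v ≡ just i → B i ∋ v
    from {i} {v} e with any? (λ i → B i v Bool.≟ true)
    from {i} {v} refl | yes (_ , p) = p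
    colours : ∀ t {u v i j} → Ends G t u v → β u ≡ just i → β v ≡ just j →
      (β (src G t) ≡ just i × β (tgt G t) ≡ just j) ⊎ (β (src G t) ≡ just j × β (tgt G t) ≡ just i)
    colours t (inj₁ (refl , refl)) p q = inj₁ (p , q)
    colours t (inj₂ (refl , refl)) p q = inj₂ (q , p)

  K4-of : ∀ A B C D → Conn A → Conn B → Conn C → Conn D →
    Disjoint A B → Disjoint A C → Disjoint A D → Disjoint B C → Disjoint B D → Disjoint C D →
    Touch A B → Touch A C → Touch A D → Touch B C → Touch B D → Touch C D → K4MinorModel G
  K4-of A B C D cA cB cC cD dAB dAC dAD dBC dBD dCD AB AC AD BC BD CD =
    four-branch-sets S
      (symmetric-pairs (λ i j → Disjoint (S i) (S j)) (λ d v p q → d v q p) dAB dAC dAD dBC dBD dCD)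
      (λ where
        zero → let (_ , _ , v , p , _) = AB in v , p
        (suc zero) → let (v , p , _) = AB in v , p
        (suc (suc zero)) → let (v , p , _) = AC in v , p
        (suc (suc (suc zero))) → let (v , p , _) = AD in v , p)
      (λ { zero → cA ; (suc zero) → cB ; (suc (suc zero)) → cC ; (suc (suc (suc zero))) → cD })
      (symmetric-pairs (λ i j → Touch (S i) (S j)) touch-sym AB AC AD BC BD CD)
    where
    S : Fin 4 → Vertices
    S zero = A
    S (suc zero) = B
    S (suc (suc zero)) = C
    S (suc (suc (suc zero))) = D

  Separates : (A B D : Vertices) → Fin (n G) → Set
  Separates A B D u = ∀ a b → (D ∖ only u) ∋ a → (D ∖ only u) ∋ b → Touches A a → Touches B b →
    ¬ Reach G (Inside (D ∖ only u)) a b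

  -- The case k = 2 of Menger's theorem, in the form needed here: delete a vertex u of D next to A.
  -- If a component X of D - u meets both sides and the rest of D still touches B, then A, B, X and
  -- D - X are the branch sets of a K4; if the rest does not touch B, it is absorbed into A.
  K4-or-separator : ∀ A B D → Acc _<_ (size D) → Conn A → Conn B → Conn D →
    Disjoint A B → Disjoint A D → Disjoint B D → Touch A B → Touch A D → Touch B D →
    K4MinorModel G ⊎ ∃[ u ] (D ∋ u × Separates A B D u)
  K4-or-separator A B D (acc smaller-acc) cA cB cD dAB dAD dBD AB (u , u∈D , u-A) BD
    with search {P = Linked} {Q = Unlinked} linked?
    where
    D-u = D ∖ only u
    Linked Unlinked : Fin (n G) → Set
    Linked b = Σ[ b∈ ∈ D-u ∋ b ] let X = Component.part (component D-u b b∈) in Touch A X × Touch B X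
    Unlinked b = ∀ a → D-u ∋ a → D-u ∋ b → Touches A a → Touches B b → ¬ Reach G (Inside D-u) a b
    linked? : ∀ b → Linked b ⊎ Unlinked b
    linked? b with member D-u b
    ... | inj₂ b∉ = inj₂ λ _ _ b∈ → ⊥-elim (true≢false b∈ b∉)
    ... | inj₁ b∈ with touch? A (Component.part (component D-u b b∈)) | touch? B (Component.part (component D-u b b∈))
    ... | yes AX | yes BX = inj₁ (b∈ , AX , BX)
    ... | _ | no ¬BX = inj₂ λ _ _ _ _ b-B _ → ¬BX (b , Component.root (component D-u b b∈) , b-B)
    ... | no ¬AX | yes _ = inj₂ λ a _ _ a-A _ r → ¬AX (a ,
      closed-reach (Component.closed (component D-u b b∈)) (reach-sym G r) (Component.root (component D-u b b∈)) , a-A)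
  ... | inj₂ unlinked = inj₂ (u , u∈D , λ a b → unlinked b a)
  ... | inj₁ (b , b∈ , AX , BX) with touch? B (D ∖ Component.part (component (D ∖ only u) b b∈))
  ... | yes BR = inj₁ (K4-of A B X R cA cB conn rest-conn dAB
          (λ v p q → dAD v p (X⊆D v q)) (λ v p q → dAD v p (∖-⊆ D X q))
          (λ v p q → dBD v p (X⊆D v q)) (λ v p q → dBD v p (∖-⊆ D X q))
          (λ v p q → true≢false p (∖-∉ D X q))
          AB AX (u , u∈rest , u-A) BX BR (touch-sym (rest-touches b root)))
    where
    open Component (component (D ∖ only u) b b∈) renaming (part to X)
    open Removal D cD u u∈D X within closed
    R = D ∖ X
  ... | no ¬BR = conclude (K4-or-separator (A ⊔ R) B X (smaller-acc smaller)
          (⊔-conn A R cA rest-conn (u , u∈rest , u-A)) cB conn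
          (λ v p q → [ (λ p → dAB v p q) , (λ p → dBD v q (∖-⊆ D X p)) ]′ (⊔-cases A R p))
          (λ v p q → [ (λ p → dAD v p (X⊆D v q)) , (λ p → true≢false q (∖-∉ D X p)) ]′ (⊔-cases A R p))
          (λ v p q → dBD v p (X⊆D v q))
          (let (v , q , w , p , e) = AB in v , q , w , ⊔-left A R p , e)
          (let (v , q , w , p , e) = AX in v , q , w , ⊔-left A R p , e)
          BX)
    where
    open Component (component (D ∖ only u) b b∈) renaming (part to X)
    open Removal D cD u u∈D X within closed
    R = D ∖ X
    -- Here the rest `R` does not touch `B`, so `c` lies in `X`. A walk from `c` back to `a` either
    -- stays in `X` or has a first vertex outside; the vertex before that one is touched by `R`.
    -- Either way a walk inside `X` joins a neighbour of `A ⊔ R` to a neighbour of `B`.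
    lift : ∀ w → Separates (A ⊔ R) B X w → Separates A B D w
    lift w sep a c a∈ c∈ a-A c-B r = back (reach-sym G r) c∈X ε
      where
      in-X : ∀ {v} → (D ∖ only w) ∋ v → X ∋ v → (X ∖ only w) ∋ v
      in-X v∈ v∈X = ∖-intro X (only w) v∈X (∖-∉ D (only w) v∈)
      c∈X : X ∋ c
      c∈X = bool-≢ λ c∉X → ¬BR (c , ∖-intro D X (∖-⊆ D (only w) c∈) c∉X , c-B)
      back : ∀ {v} → Reach G (Inside (D ∖ only w)) v a → X ∋ v → Reach G (Inside (X ∖ only w)) v c → ⊥
      back {v} ε v∈X r = sep v c (in-X a∈ v∈X) (in-X c∈ c∈X) (let (x , p , e) = a-A in x , ⊔-left A R p , e) c-B r
      back {v} (_◅_ {j = v′} (t , i , e) r′) v∈X r with inside-ends (D ∖ only w) t (Ends-sym G e) i | inside-ends (D ∖ only w) t e i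
      ... | v∈ | v′∈ with member X v′
      ... | inj₁ v′∈X = back r′ v′∈X
              (edge G t (ends-inside (X ∖ only w) t (Ends-sym G e) (in-X v′∈ v′∈X) (in-X v∈ v∈X)) (Ends-sym G e) ◅◅ r)
      ... | inj₂ v′∉X = sep v c (in-X v∈ v∈X) (in-X c∈ c∈X)
              (v′ , ⊔-right A R (∖-intro D X (∖-⊆ D (only w) v′∈) v′∉X) , t , Ends-sym G e) c-B r
    conclude : K4MinorModel G ⊎ ∃[ w ] (X ∋ w × Separates (A ⊔ R) B X w) → K4MinorModel G ⊎ ∃[ w ] (D ∋ w × Separates A B D w)
    conclude (inj₁ K4) = inj₁ K4
    conclude (inj₂ (w , w∈X , sep)) = inj₂ (w , X⊆D w w∈X , lift w sep)

  ThreeNeighbours : Fin (n G) → Set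
  ThreeNeighbours v = ∃[ x ] ∃[ y ] ∃[ z ] ((x ≢ y × x ≢ z × y ≢ z) ×
    (x ≢ v × Adjacent v x) × (y ≢ v × Adjacent v y) × (z ≢ v × Adjacent v z))

  -- Minimum degree 3 forces a K4: if a vertex u of D separates A from B, then some component of D - u
  -- is again attached at only two vertices, one of them u, and is smaller.
  K4-of-piece : ∀ A B D s w → Acc _<_ (size D) → Conn A → Conn B → Conn D →
    Disjoint A B → Disjoint A D → Disjoint B D → Touch A B → Touch A D → A ∋ s → B ∋ w →
    (∀ v x → D ∋ v → Adjacent v x → D ∋ x ⊎ (x ≡ s ⊎ x ≡ w)) →
    (∀ v → D ∋ v → ThreeNeighbours v) → K4MinorModel G
  K4-of-piece A B D s w (acc smaller-acc) cA cB cD dAB dAD dBD AB AD s∈A w∈B bounded degree with touch? B D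
  -- The piece cannot reach `w`, so it hangs on `s` alone. The vertex `u` next to `A` becomes a new
  -- attachment: `only u` and `A` are now the two sides, and a component of the piece without `u`
  -- hangs on `u` and `s`.
  ... | no ¬BD = K4-of-piece (only u) A X u s (smaller-acc smaller) (only-conn u) cA conn
          (λ v p q → dAD v q (subst (D ∋_) (sym (only-≡ u p)) u∈D))
          (λ v p q → true≢false p (∖-∉ D (only u) (within v q)))
          (λ v p q → dAD v p (X⊆D v q))
          (touch-sym (u , only-self u , u-A)) (x , root , u , only-self u , ux) (only-self u) s∈A
          bounded′ (λ v p → degree v (X⊆D v p))
    where
    u = proj₁ AD
    u∈D = proj₁ (proj₂ AD)
    u-A = proj₂ (proj₂ AD)
    not-w : ∀ {v x} → D ∋ v → Adjacent v x → x ≢ w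
    not-w v∈D vx refl = ¬BD (_ , v∈D , _ , w∈B , adjacent-sym vx)
    inner : ∀ {x} → x ≢ u → Adjacent u x → x ≢ s → (D ∖ only u) ∋ x
    inner x≢u ux x≢s with bounded u _ u∈D ux
    ... | inj₁ x∈D = ∖-intro D (only u) x∈D (only-≢ u x≢u)
    ... | inj₂ (inj₁ x≡s) = ⊥-elim (x≢s x≡s)
    ... | inj₂ (inj₂ x≡w) = ⊥-elim (not-w u∈D ux x≡w)
    inner-neighbour : ∃[ x ] ((D ∖ only u) ∋ x × Adjacent u x)
    inner-neighbour with degree u u∈D
    ... | x , y , _ , (x≢y , _) , (x≢u , ux) , (y≢u , uy) , _ with x ≟ s
    ... | no x≢s = x , inner x≢u ux x≢s , ux
    ... | yes refl = y , inner y≢u uy (x≢y ∘ sym) , uy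
    x = proj₁ inner-neighbour
    ux = proj₂ (proj₂ inner-neighbour)
    open Component (component (D ∖ only u) x (proj₁ (proj₂ inner-neighbour))) renaming (part to X)
    open Removal D cD u u∈D X within closed
    bounded′ : ∀ v y → X ∋ v → Adjacent v y → X ∋ y ⊎ (y ≡ u ⊎ y ≡ s)
    bounded′ v y v∈X vy with bounded v y (X⊆D v v∈X) vy
    ... | inj₂ (inj₁ y≡s) = inj₂ (inj₂ y≡s)
    ... | inj₂ (inj₂ y≡w) = ⊥-elim (not-w (X⊆D v v∈X) vy y≡w)
    ... | inj₁ y∈D with member X y
    ... | inj₁ y∈X = inj₁ y∈X
    ... | inj₂ y∉X = inj₂ (inj₁ (leaves-to-u v∈X y∈D vy y∉X))
  ... | yes BD with K4-or-separator A B D (<-wellFounded _) cA cB cD dAB dAD dBD AB AD BD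
  ... | inj₁ K4 = K4
  ... | inj₂ (u , u∈D , sep) = by-side (touch? A X)
    where
    inner : ∀ {x} → x ≢ u → Adjacent u x → x ≢ s → x ≢ w → (D ∖ only u) ∋ x
    inner x≢u ux x≢s x≢w with bounded u _ u∈D ux
    ... | inj₁ x∈D = ∖-intro D (only u) x∈D (only-≢ u x≢u)
    ... | inj₂ (inj₁ x≡s) = ⊥-elim (x≢s x≡s)
    ... | inj₂ (inj₂ x≡w) = ⊥-elim (x≢w x≡w)
    -- Neighbours of `u` outside `D` can only be `s` and `w`, so one of three distinct neighbours
    -- lies in `D`.
    inner-neighbour : ∃[ x ] ((D ∖ only u) ∋ x × Adjacent u x)
    inner-neighbour with degree u u∈D
    ... | x , y , z , (x≢y , x≢z , y≢z) , (x≢u , ux) , (y≢u , uy) , (z≢u , uz)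
      with x ≟ s | x ≟ w | y ≟ s | y ≟ w
    ... | no x≢s   | no x≢w   | _        | _        = x , inner x≢u ux x≢s x≢w , ux
    ... | _        | _        | no y≢s   | no y≢w   = y , inner y≢u uy y≢s y≢w , uy
    ... | yes refl | _        | yes refl | _        = ⊥-elim (x≢y refl)
    ... | _        | yes refl | _        | yes refl = ⊥-elim (x≢y refl)
    ... | yes refl | _        | _        | yes refl = z , inner z≢u uz (x≢z ∘ sym) (y≢z ∘ sym) , uz
    ... | _        | yes refl | yes refl | _        = z , inner z≢u uz (y≢z ∘ sym) (x≢z ∘ sym) , uz
    x = proj₁ inner-neighbour
    ux = proj₂ (proj₂ inner-neighbour)
    open Component (component (D ∖ only u) x (proj₁ (proj₂ inner-neighbour))) renaming (part to X)
    open Removal D cD u u∈D X within closed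
    R = D ∖ X
    touch-rest : ∀ {S} → Touch S D → ¬ Touch S X → Touch S R
    touch-rest (v , v∈D , v-S) ¬SX = v , ∖-intro D X v∈D (bool-≢ λ v∈X → ¬SX (v , v∈X , v-S)) , v-S
    -- As `u` separates, `X` misses one of the two sides. That side absorbs the rest of `D`, and `u`
    -- replaces its old attachment. Everything is quantified again so that `by-side` can exchange
    -- `A` and `B`.
    recurse : ∀ A B s w → Conn A → Conn B → Disjoint A B → Disjoint A D → Disjoint B D → Touch A B → Touch A D →
      A ∋ s → B ∋ w → (∀ v x → D ∋ v → Adjacent v x → D ∋ x ⊎ (x ≡ s ⊎ x ≡ w)) → ¬ Touch A X → K4MinorModel G
    recurse A B s w cA cB dAB dAD dBD AB AD s∈A w∈B bounded ¬AX =
      K4-of-piece (A ⊔ R) B X u w (smaller-acc smaller)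
        (⊔-conn A R cA rest-conn (touch-rest AD ¬AX)) cB conn
        (λ v p q → [ (λ p → dAB v p q) , (λ p → dBD v q (∖-⊆ D X p)) ]′ (⊔-cases A R p))
        (λ v p q → [ (λ p → dAD v p (X⊆D v q)) , (λ p → true≢false q (∖-∉ D X p)) ]′ (⊔-cases A R p))
        (λ v p q → dBD v p (X⊆D v q))
        (let (v , q , w , p , e) = AB in v , q , w , ⊔-left A R p , e)
        (x , root , u , ⊔-right A R u∈rest , ux)
        (⊔-right A R u∈rest) w∈B bounded′ (λ v p → degree v (X⊆D v p))
      where
      bounded′ : ∀ v y → X ∋ v → Adjacent v y → X ∋ y ⊎ (y ≡ u ⊎ y ≡ w)
      bounded′ v y v∈X vy with bounded v y (X⊆D v v∈X) vy
      ... | inj₂ (inj₁ refl) = ⊥-elim (¬AX (v , v∈X , y , s∈A , adjacent-sym vy))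
      ... | inj₂ (inj₂ y≡w) = inj₂ (inj₂ y≡w)
      ... | inj₁ y∈D with member X y
      ... | inj₁ y∈X = inj₁ y∈X
      ... | inj₂ y∉X = inj₂ (inj₁ (leaves-to-u v∈X y∈D vy y∉X))
    by-side : Dec (Touch A X) → K4MinorModel G
    by-side (no ¬AX) = recurse A B s w cA cB dAB dAD dBD AB AD s∈A w∈B bounded ¬AX
    by-side (yes (a , a∈X , a-A)) = recurse B A w s cB cA (λ v p q → dAB v q p) dBD dAD (touch-sym AB) BD w∈B s∈A
      (λ v y p vy → case bounded v y p vy of λ where
        (inj₁ y∈D)        → inj₁ y∈D
        (inj₂ (inj₁ y≡s)) → inj₂ (inj₂ y≡s)
        (inj₂ (inj₂ y≡w)) → inj₂ (inj₁ y≡w))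
      λ (b , b∈X , b-B) → sep a b (within a a∈X) (within b b∈X) a-A b-B
        (inside-mono {X} within (conn a b a∈X b∈X))

-- Reductions of labelled graphs

module _ {k l : ℕ} (s t s′ t′ : Fin l → Fin k) {A A′ : Fin k → Set} {T T′ : Mask l} where
  private
    G G′ : Multigraph
    G  = graph s t
    G′ = graph s′ t′

  -- `v` is a leaf of the tree, so retracting it to `u` preserves walks. The graph `G′` has to agree
  -- with `G` only on the surviving tree edges, which lets the same lemma serve a pendant edge and a
  -- vertex of degree two whose tree uses one of its edges.
  tree-prune : ∀ f {v u} → T ∋ f → Ends G f v u → u ≢ v →
    (∀ g → T ∋ g → g ≢ f → s g ≢ v × t g ≢ v) →
    (∀ g → T ∋ g → g ≢ f → T′ ∋ g) → (∀ g → T′ ∋ g → T ∋ g × g ≢ f) →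
    (∀ g → T ∋ g → g ≢ f → s′ g ≡ s g × t′ g ≡ t g) → (∀ a → A′ a → A a × a ≢ v) →
    IsTree G A T → IsTree G′ A′ T′
  tree-prune f {v} {u} f∈T ef u≢v off-v to from same A′⊆ (spans , acyclic) =
    (λ a b a∈ b∈ → subst₂ (Reach G′ (T′ ∋_)) (π-other (proj₂ (A′⊆ a a∈))) (π-other (proj₂ (A′⊆ b b∈)))
      (reach-map G G′ π along (spans a b (proj₁ (A′⊆ a a∈)) (proj₁ (A′⊆ b b∈))))) ,
    λ g g∈ r → let (g∈T , g≢f) = from g g∈ ; (e₁ , e₂) = same g g∈T g≢f in
      acyclic g g∈T (subst₂ (Reach G _) e₁ e₂ (reach-map G′ G id
        (λ h (h∈ , h≢g) → let (h∈T , h≢f) = from h h∈ ; (d₁ , d₂) = same h h∈T h≢f in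
          edge G h (h∈T , h≢g) (inj₁ (sym d₁ , sym d₂))) r))
    where
    π : Fin k → Fin k
    π = id [ v ≔ u ]
    π-other : ∀ {a} → a ≢ v → π a ≡ a
    π-other = set-other id v
    π-v : π v ≡ u
    π-v = set-same id v
    collapsed : ∀ {a b} → Ends G f a b → Ends G f v u → π a ≡ u × π b ≡ u
    collapsed (inj₁ (refl , refl)) (inj₁ (refl , refl)) = π-v , π-other u≢v
    collapsed (inj₁ (refl , refl)) (inj₂ (refl , refl)) = π-other u≢v , π-v
    collapsed (inj₂ (refl , refl)) (inj₁ (refl , refl)) = π-other u≢v , π-v
    collapsed (inj₂ (refl , refl)) (inj₂ (refl , refl)) = π-v , π-other u≢v
    along : ∀ g → T ∋ g → Reach G′ (T′ ∋_) (π (s g)) (π (t g))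
    along g g∈ with g ≟ f
    ... | yes refl = let (p , q) = collapsed (inj₁ (refl , refl)) ef in stay G′ (trans p (sym q))
    ... | no g≢f = let (e₁ , e₂) = same g g∈ g≢f ; (n₁ , n₂) = off-v g g∈ g≢f in
          edge G′ g (to g g∈ g≢f) (inj₁ (trans e₁ (sym (π-other n₁)) , trans e₂ (sym (π-other n₂))))

  -- The path u-v-w of the tree becomes the single edge `f`. Spanning follows by retracting `v` to
  -- `u`. A cycle through the new `f` closes up, via the old `f`, to a cycle through `f′`; any other
  -- cycle is expanded along the old path.
  tree-contract : ∀ f f′ {v u w} → f ≢ f′ → T ∋ f → T ∋ f′ → Ends G f v u → Ends G f′ v w → u ≢ v → w ≢ v →
    (∀ g → g ≢ f → g ≢ f′ → T ∋ g → s g ≢ v × t g ≢ v) →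
    T′ ∋ f → T′ f′ ≡ false → Ends G′ f u w →
    (∀ g → g ≢ f → g ≢ f′ → T′ g ≡ T g × s′ g ≡ s g × t′ g ≡ t g) → (∀ a → A′ a → A a × a ≢ v) →
    IsTree G A T → IsTree G′ A′ T′
  tree-contract f f′ {v} {u} {w} f≢f′ f∈ f′∈ ef ef′ u≢v w≢v off-v f∈′ f′∉′ ef″ same A′⊆ (spans , acyclic) =
    (λ a b a∈ b∈ → subst₂ (Reach G′ (T′ ∋_)) (π-other (proj₂ (A′⊆ a a∈))) (π-other (proj₂ (A′⊆ b b∈)))
      (reach-map G G′ π along (spans a b (proj₁ (A′⊆ a a∈)) (proj₁ (A′⊆ b b∈))))) , acyc
    where
    π : Fin k → Fin k
    π = id [ v ≔ u ]
    π-other : ∀ {a} → a ≢ v → π a ≡ a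
    π-other = set-other id v
    π-v : π v ≡ u
    π-v = set-same id v
    through : ∀ {P} g x → Ends G g v x → Reach G′ P (π v) (π x) → Reach G′ P (π (s g)) (π (t g))
    through g x (inj₁ (refl , refl)) r = r
    through g x (inj₂ (refl , refl)) r = reach-sym G′ r
    along : ∀ g → T ∋ g → Reach G′ (T′ ∋_) (π (s g)) (π (t g))
    along g g∈ with g ≟ f | g ≟ f′
    ... | yes refl | _ = through f u ef (stay G′ (trans π-v (sym (π-other u≢v))))
    ... | no _ | yes refl = through f′ w ef′
          (subst₂ (Reach G′ (T′ ∋_)) (sym π-v) (sym (π-other w≢v)) (edge G′ f f∈′ ef″))
    ... | no g≢f | no g≢f′ = let (p , e₁ , e₂) = same g g≢f g≢f′ ; (n₁ , n₂) = off-v g g≢f g≢f′ g∈ in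
          edge G′ g (trans p g∈) (inj₁ (trans e₁ (sym (π-other n₁)) , trans e₂ (sym (π-other n₂))))
    ≢f′ : ∀ {g} → T′ ∋ g → g ≢ f′
    ≢f′ p refl = true≢false p f′∉′
    acyc : ∀ g → T′ ∋ g → ¬ Reach G′ (λ h → T′ ∋ h × h ≢ g) (s′ g) (t′ g)
    acyc g g∈ r with g ≟ f
    ... | yes refl = acyclic f′ f′∈ (orient G f′ ef′ (edge G f (f∈ , f≢f′) ef ◅◅ back ef″))
      where
      old : Reach G (λ h → T ∋ h × h ≢ f′) (s′ f) (t′ f)
      old = reach-map G′ G id (λ h (h∈ , h≢f) → let (p , e₁ , e₂) = same h h≢f (≢f′ h∈) in
        edge G h (trans (sym p) h∈ , ≢f′ h∈) (inj₁ (sym e₁ , sym e₂))) r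
      back : Ends G′ f u w → Reach G (λ h → T ∋ h × h ≢ f′) u w
      back (inj₁ (p , q)) = subst₂ (Reach G _) p q old
      back (inj₂ (p , q)) = reach-sym G (subst₂ (Reach G _) p q old)
    ... | no g≢f = let (p , e₁ , e₂) = same g g≢f (≢f′ g∈) in
          acyclic g (trans (sym p) g∈) (subst₂ (Reach G _) e₁ e₂ (reach-map G′ G id expand r))
      where
      expand : ∀ h → T′ ∋ h × h ≢ g → Reach G (λ h → T ∋ h × h ≢ g) (s′ h) (t′ h)
      expand h (h∈ , h≢g) with h ≟ f
      ... | no h≢f = let (p , e₁ , e₂) = same h h≢f (≢f′ h∈) in
              edge G h (trans (sym p) h∈ , h≢g) (inj₁ (sym e₁ , sym e₂))
      ... | yes refl = orient′ ef″
        where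
        detour : Reach G (λ h → T ∋ h × h ≢ g) u w
        detour = edge G f (f∈ , h≢g) (Ends-sym G ef) ◅◅ edge G f′ (f′∈ , λ f′≡g → ≢f′ g∈ (sym f′≡g)) ef′
        orient′ : Ends G′ f u w → Reach G (λ h → T ∋ h × h ≢ g) (s′ f) (t′ f)
        orient′ (inj₁ (refl , refl)) = detour
        orient′ (inj₂ (refl , refl)) = reach-sym G detour

module _ {k l : ℕ} (s t s′ t′ : Fin l → Fin k) where
  private
    G G′ : Multigraph
    G  = graph s t
    G′ = graph s′ t′

  model-subgraph : (∀ e → s′ e ≡ t′ e ⊎ ∃[ e′ ] Ends G e′ (s′ e) (t′ e)) → K4MinorModel G′ → K4MinorModel G
  model-subgraph keep (β , nonempty , conn , adj) =
    β , nonempty , (λ i u v p q → reach-map G′ G id (along i) (conn i u v p q)) ,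
    λ i j i≢j → let (e , c) = adj i j i≢j in move i≢j e c (keep e)
    where
    along : ∀ i e → β (s′ e) ≡ just i × β (t′ e) ≡ just i →
      Reach G (λ e → β (s e) ≡ just i × β (t e) ≡ just i) (s′ e) (t′ e)
    along i e (p , q) with keep e
    ... | inj₁ loop = stay G loop
    ... | inj₂ (e′ , inj₁ (a , b)) = edge G e′ (trans (cong β a) p , trans (cong β b) q) (inj₁ (a , b))
    ... | inj₂ (e′ , inj₂ (a , b)) = edge G e′ (trans (cong β a) q , trans (cong β b) p) (inj₂ (a , b))
    Joins : Fin 4 → Fin 4 → Set
    Joins i j = ∃[ e ] ((β (s e) ≡ just i × β (t e) ≡ just j) ⊎ (β (s e) ≡ just j × β (t e) ≡ just i))
    move : ∀ {i j} → i ≢ j → ∀ e → (β (s′ e) ≡ just i × β (t′ e) ≡ just j) ⊎ (β (s′ e) ≡ just j × β (t′ e) ≡ just i) →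
      s′ e ≡ t′ e ⊎ ∃[ e′ ] Ends G e′ (s′ e) (t′ e) → Joins i j
    move i≢j e (inj₁ (p , q)) (inj₁ loop) = ⊥-elim (i≢j (just-injective (trans (sym p) (trans (cong β loop) q))))
    move i≢j e (inj₂ (p , q)) (inj₁ loop) = ⊥-elim (i≢j (just-injective (trans (sym q) (trans (cong β (sym loop)) p))))
    move i≢j e (inj₁ (p , q)) (inj₂ (e′ , inj₁ (a , b))) = e′ , inj₁ (trans (cong β a) p , trans (cong β b) q)
    move i≢j e (inj₁ (p , q)) (inj₂ (e′ , inj₂ (a , b))) = e′ , inj₂ (trans (cong β a) q , trans (cong β b) p)
    move i≢j e (inj₂ (p , q)) (inj₂ (e′ , inj₁ (a , b))) = e′ , inj₂ (trans (cong β a) p , trans (cong β b) q)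
    move i≢j e (inj₂ (p , q)) (inj₂ (e′ , inj₂ (a , b))) = e′ , inj₁ (trans (cong β a) q , trans (cong β b) p)

  -- The vertex `v` joins the branch set of `u`: then the old `f` lies inside that set and `f′`
  -- takes the part of the contracted edge.
  model-uncontract : ∀ f f′ {v u w} → Ends G f v u → Ends G f′ v w → u ≢ v → w ≢ v →
    s′ f ≡ u → t′ f ≡ w → s′ f′ ≡ t′ f′ →
    (∀ g → g ≢ f → g ≢ f′ → s′ g ≡ t′ g ⊎ (s′ g ≡ s g × t′ g ≡ t g × s g ≢ v × t g ≢ v)) →
    K4MinorModel G′ → K4MinorModel G
  model-uncontract f f′ {v} {u} {w} ef ef′ u≢v w≢v s′f t′f loop same (β′ , _ , conn , adj) =
    β , nonempty , conn′ , adj′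
    where
    β : Fin k → Maybe (Fin 4)
    β = β′ [ v ≔ β′ u ]
    β-v : β v ≡ β′ u
    β-v = set-same β′ v
    β-other : ∀ {a} → a ≢ v → β a ≡ β′ a
    β-other = set-other β′ v
    InB : Fin 4 → Fin l → Set
    InB i g = β (s g) ≡ just i × β (t g) ≡ just i
    Joins : Fin 4 → Fin 4 → Fin l → Set
    Joins i j e = (β (s e) ≡ just i × β (t e) ≡ just j) ⊎ (β (s e) ≡ just j × β (t e) ≡ just i)
    joins : ∀ {i j a b} e → Ends G e a b → β a ≡ just i → β b ≡ just j → Joins i j e
    joins e (inj₁ (refl , refl)) p q = inj₁ (p , q)
    joins e (inj₂ (refl , refl)) p q = inj₂ (q , p)
    joins-sym : ∀ {i j e} → Joins i j e → Joins j i e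
    joins-sym (inj₁ (p , q)) = inj₂ (p , q)
    joins-sym (inj₂ (p , q)) = inj₁ (p , q)
    inB : ∀ {i a b} e → Ends G e a b → β a ≡ just i → β b ≡ just i → InB i e
    inB e (inj₁ (refl , refl)) p q = p , q
    inB e (inj₂ (refl , refl)) p q = q , p
    data Kind (g : Fin l) : Set where
      is-f    : g ≡ f → Kind g
      is-loop : s′ g ≡ t′ g → Kind g
      is-kept : s′ g ≡ s g → t′ g ≡ t g → s g ≢ v → t g ≢ v → Kind g
    kind : ∀ g → Kind g
    kind g with g ≟ f | g ≟ f′
    ... | yes e | _ = is-f e
    ... | no _ | yes refl = is-loop loop
    ... | no g≢f | no g≢f′ with same g g≢f g≢f′
    ... | inj₁ e = is-loop e
    ... | inj₂ (a , b , c , d) = is-kept a b c d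
    move : ∀ {i j} → i ≢ j → ∀ g → β′ (s′ g) ≡ just i → β′ (t′ g) ≡ just j → ∃[ e ] Joins i j e
    move i≢j g p q with kind g
    ... | is-loop e = ⊥-elim (i≢j (just-injective (trans (sym p) (trans (cong β′ e) q))))
    ... | is-kept a b c d = g , inj₁
          (trans (β-other c) (trans (cong β′ (sym a)) p) , trans (β-other d) (trans (cong β′ (sym b)) q))
    ... | is-f refl = f′ , joins f′ ef′ (trans β-v (trans (cong β′ (sym s′f)) p))
          (trans (β-other w≢v) (trans (cong β′ (sym t′f)) q))
    adj′ : ∀ i j → i ≢ j → ∃[ e ] Joins i j e
    adj′ i j i≢j with adj i j i≢j
    ... | g , inj₁ (p , q) = move i≢j g p q
    ... | g , inj₂ (p , q) with move (i≢j ∘ sym) g p q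
    ... | e , c = e , joins-sym c
    -- The colour that `β′` gave to `v` has been overwritten, so nonemptiness is not inherited. It
    -- is recovered from an edge to some other branch set, here the one numbered `punchIn i zero`.
    nonempty : ∀ i → ∃[ a ] β a ≡ just i
    nonempty i with adj′ i (punchIn i zero) (punchInᵢ≢i i zero ∘ sym)
    ... | e , inj₁ (p , _) = s e , p
    ... | e , inj₂ (_ , p) = t e , p
    along : ∀ i g → β′ (s′ g) ≡ just i × β′ (t′ g) ≡ just i → Reach G (InB i) (s′ g) (t′ g)
    along i g (p , q) with kind g
    ... | is-loop e = stay G e
    ... | is-kept a b c d = edge G g
          (trans (β-other c) (trans (cong β′ (sym a)) p) , trans (β-other d) (trans (cong β′ (sym b)) q))
          (inj₁ (sym a , sym b))
    ... | is-f refl = subst₂ (Reach G (InB i)) (sym s′f) (sym t′f)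
          (edge G f (inB f ef v∈ u∈) (Ends-sym G ef) ◅◅ edge G f′ (inB f′ ef′ v∈ w∈) ef′)
      where
      v∈ : β v ≡ just i
      v∈ = trans β-v (trans (cong β′ (sym s′f)) p)
      u∈ : β u ≡ just i
      u∈ = trans (β-other u≢v) (trans (cong β′ (sym s′f)) p)
      w∈ : β w ≡ just i
      w∈ = trans (β-other w≢v) (trans (cong β′ (sym t′f)) q)
    retract : ∀ i a → β a ≡ just i → ∃[ b ] (β′ b ≡ just i × Reach G (InB i) a b)
    retract i a p with a ≟ v
    ... | no a≢v = a , p , ε
    ... | yes refl = u , p , edge G f (inB f ef (trans β-v p) (trans (β-other u≢v) p)) ef
    conn′ : ∀ i a b → β a ≡ just i → β b ≡ just i → Reach G (InB i) a b
    conn′ i a b p q =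
      let (a′ , p′ , ra) = retract i a p
          (b′ , q′ , rb) = retract i b q
      in ra ◅◅ reach-map G′ G id (along i) (conn i a′ b′ p′ q′) ◅◅ reach-sym G rb

-- Edge labels: configurations of networks indexed by the vertices of `H`

module Labels (H : Graph) where

  -- An edge of a reduced graph stands for the network `term` of original edges, and `at x` is the
  -- configuration of that network in the tree belonging to `x`. Initially every term is `leaf` and
  -- `at` is a membership bit.
  record Label : Set where
    field
      term : Term
      at   : V H → V (K term)
  open Label public

  chosen : Label → V H → Bool
  chosen L x = colour (term L) (at L x)

  Same Moves : Label → V H → V H → Set
  Same  L x y = at L x ≡ at L y
  Moves L x y = _~_ (K (term L)) (at L x) (at L y)

  moves-recolours : ∀ L {x y} → Moves L x y → chosen L x ≢ chosen L y
  moves-recolours L = proj₂ (bip (term L))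

  -- The label of a deleted edge: in no tree, and constant, so that it neither distinguishes
  -- vertices of `H` nor moves.
  absent : Label
  absent = record { term = leaf ; at = λ _ → false }

  -- The hypothesis `ok` says that the two configurations never form an excluded pair, so together
  -- they are a vertex of the product-join.
  module Merge (p : Bool) (L M : Label) (ok : ∀ x → chosen L x ≡ p ⊎ chosen M x ≡ p) where
    open Join p (term L) (term M) hiding (graph; ok)

    combine : ∀ x → Σ[ w ∈ W ] (fst w ≡ at L x × snd w ≡ at M x)
    combine x = joinable (at L x) (at M x) (ok x)

    merge : Label
    merge = record { term = join p (term L) (term M) ; at = proj₁ ∘ combine }

    merge-both : ∀ x → chosen L x ≡ p → chosen M x ≡ p → chosen merge x ≡ p
    merge-both x e f = let (w , e₁ , e₂) = combine x in
      colour-both w (trans (cong (colour (term L)) e₁) e) (trans (cong (colour (term M)) e₂) f)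

    merge-one : ∀ x → chosen L x ≡ not p ⊎ chosen M x ≡ not p → chosen merge x ≡ not p
    merge-one x (inj₁ e) = let (w , e₁ , e₂) = combine x in
      colour-one w (inj₁ (trans (cong (colour (term L)) e₁) e))
    merge-one x (inj₂ f) = let (w , e₁ , e₂) = combine x in
      colour-one w (inj₂ (trans (cong (colour (term M)) e₂) f))

    merge-same⁻ : ∀ x y → Same merge x y → Same L x y × Same M x y
    merge-same⁻ x y e = let (_ , a₁ , a₂) = combine x ; (_ , b₁ , b₂) = combine y in
      trans (sym a₁) (trans (cong fst e) b₁) , trans (sym a₂) (trans (cong snd e) b₂)

    merge-same : ∀ x y → Same L x y → Same M x y → Same merge x y
    merge-same x y e f = let (v , a₁ , a₂) = combine x ; (w , b₁ , b₂) = combine y in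
      pair-injective v w (trans a₁ (trans e (sym b₁))) (trans a₂ (trans f (sym b₂)))

    merge-left : ∀ x y → Moves L x y → Same M x y → Moves merge x y
    merge-left x y s f = let (v , a₁ , a₂) = combine x ; (w , b₁ , b₂) = combine y in
      adj-fst v w (subst₂ (_~_ (K (term L))) (sym a₁) (sym b₁) s) (trans a₂ (trans f (sym b₂)))

    merge-right : ∀ x y → Same L x y → Moves M x y → Moves merge x y
    merge-right x y e s = let (v , a₁ , a₂) = combine x ; (w , b₁ , b₂) = combine y in
      adj-snd v w (trans a₁ (trans e (sym b₁))) (subst₂ (_~_ (K (term M))) (sym a₂) (sym b₂) s)

  -- This is the embedding of `H` into a cube, with configurations in place of bits. The edge `e` is
  -- exempt because it is not a coordinate of that cube: its membership may change along with the
  -- one moving label.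
  record Faithful {k} (e : Fin k) (lab : Fin k → Label) : Set where
    field
      inj : ∀ x y → (∀ t → t ≢ e → Same (lab t) x y) → x ≡ y
      adj : ∀ {x y} → _~_ H x y → ∃[ t ] (t ≢ e × Moves (lab t) x y × (∀ g → g ≢ e → g ≢ t → Same (lab g) x y))
  open Faithful public

  module _ {k} {e : Fin k} {lab : Fin k → Label} (faithful : Faithful e lab) where

    -- A move in `K (term L)` always changes the colour, so a label of fixed colour never moves
    -- along an edge of `H`.
    constant : Connected H → ∀ t {b} → t ≢ e → (∀ x → chosen (lab t) x ≡ b) → ∀ x y → Same (lab t) x y
    constant (_ , conn) t t≢e fixed x y = along (conn x y)
      where
      along : ∀ {x y} → Star (_~_ H) x y → Same (lab t) x y
      along ε = refl
      along (s ◅ path) with adj faithful s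
      ... | g , g≢e , moves , same with t ≟ g
      ... | yes refl = ⊥-elim (moves-recolours (lab t) moves (trans (fixed _) (sym (fixed _))))
      ... | no t≢g = trans (same t t≢e t≢g) (along path)

    faithful-remove : ∀ f → f ≢ e → (∀ x y → Same (lab f) x y) → Faithful e (lab [ f ≔ absent ])
    faithful-remove f f≢e fixed = record { inj = inj′ ; adj = adj′ }
      where
      lab′ : Fin k → Label
      lab′ = lab [ f ≔ absent ]
      inj′ : ∀ x y → (∀ t → t ≢ e → Same (lab′ t) x y) → x ≡ y
      inj′ x y same = inj faithful x y old
        where
        old : ∀ t → t ≢ e → Same (lab t) x y
        old t t≢e with t ≟ f
        ... | yes refl = fixed x y
        ... | no t≢f = subst (λ L → Same L x y) (set-other lab f t≢f) (same t t≢e)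
      adj′ : ∀ {x y} → _~_ H x y → ∃[ t ] (t ≢ e × Moves (lab′ t) x y × (∀ g → g ≢ e → g ≢ t → Same (lab′ g) x y))
      adj′ {x} {y} s with adj faithful s
      ... | t , t≢e , moves , same with t ≟ f
      ... | yes refl = ⊥-elim (moves-recolours (lab t) moves (cong (colour (term (lab t))) (fixed x y)))
      ... | no t≢f = t , t≢e , subst (λ L → Moves L x y) (sym (set-other lab f t≢f)) moves , new
        where
        new : ∀ g → g ≢ e → g ≢ t → Same (lab′ g) x y
        new g g≢e g≢t with g ≟ f
        ... | yes _ = refl
        ... | no _ = same g g≢e g≢t

    module MergeAt (p : Bool) (f f′ : Fin k) (f≢f′ : f ≢ f′) (f≢e : f ≢ e) (f′≢e : f′ ≢ e)
      (ok : ∀ x → chosen (lab f) x ≡ p ⊎ chosen (lab f′) x ≡ p) where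
      open Merge p (lab f) (lab f′) ok public

      lab′ : Fin k → Label
      lab′ = (lab [ f ≔ merge ]) [ f′ ≔ absent ]

      lab′-f : lab′ f ≡ merge
      lab′-f = trans (set-other (lab [ f ≔ merge ]) f′ f≢f′) (set-same lab f)

      lab′-f′ : lab′ f′ ≡ absent
      lab′-f′ = set-same (lab [ f ≔ merge ]) f′

      lab′-other : ∀ {g} → g ≢ f → g ≢ f′ → lab′ g ≡ lab g
      lab′-other g≢f g≢f′ = trans (set-other (lab [ f ≔ merge ]) f′ g≢f′) (set-other lab f g≢f)

      faithful′ : Faithful e lab′
      faithful′ = record { inj = inj′ ; adj = adj′ }
        where
        inj′ : ∀ x y → (∀ t → t ≢ e → Same (lab′ t) x y) → x ≡ y
        inj′ x y same = inj faithful x y old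
          where
          merged : Same (lab f) x y × Same (lab f′) x y
          merged = merge-same⁻ x y (subst (λ L → Same L x y) lab′-f (same f f≢e))
          old : ∀ t → t ≢ e → Same (lab t) x y
          old t t≢e with t ≟ f | t ≟ f′
          ... | yes refl | _ = proj₁ merged
          ... | no _ | yes refl = proj₂ merged
          ... | no t≢f | no t≢f′ = subst (λ L → Same L x y) (lab′-other t≢f t≢f′) (same t t≢e)
        others : ∀ {x y} g → g ≢ f → (g ≢ f′ → Same (lab g) x y) → Same (lab′ g) x y
        others {x} {y} g g≢f same with g ≟ f′
        ... | yes _ = refl
        ... | no g≢f′ = subst (λ L → Same L x y) (sym (set-other lab f g≢f)) (same g≢f′)
        merged : ∀ {x y} → Same (lab f) x y → Same (lab f′) x y → Same (lab′ f) x y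
        merged {x} {y} p q = subst (λ L → Same L x y) (sym lab′-f) (merge-same x y p q)
        adj′ : ∀ {x y} → _~_ H x y → ∃[ t ] (t ≢ e × Moves (lab′ t) x y × (∀ g → g ≢ e → g ≢ t → Same (lab′ g) x y))
        adj′ {x} {y} s with adj faithful s
        ... | t , t≢e , moves , same with t ≟ f | t ≟ f′
        ... | yes refl | _ = f , f≢e ,
              subst (λ L → Moves L x y) (sym lab′-f) (merge-left x y moves (same f′ f′≢e (f≢f′ ∘ sym))) ,
              λ g g≢e g≢f → others g g≢f λ _ → same g g≢e g≢f
        ... | no _ | yes refl = f , f≢e ,
              subst (λ L → Moves L x y) (sym lab′-f) (merge-right x y (same f f≢e f≢f′) moves) ,
              λ g g≢e g≢f → others g g≢f λ g≢f′ → same g g≢e g≢f′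
        ... | no t≢f | no t≢f′ = t , t≢e , subst (λ L → Moves L x y) (sym (lab′-other t≢f t≢f′)) moves , new
          where
          new : ∀ g → g ≢ e → g ≢ t → Same (lab′ g) x y
          new g g≢e g≢t with g ≟ f
          ... | yes refl = merged (same f f≢e g≢t) (same f′ f′≢e (t≢f′ ∘ sym))
          ... | no g≢f = others g g≢f λ _ → same g g≢e g≢t

-- The three reductions and the irreducible case

module Reduction (H : Graph) (connected-H : Connected H) where
  open Labels H

  x₀ : V H
  x₀ = proj₁ connected-H

  -- The trees of `tree` may contain `e`, so both kinds of vertices of H(G,e) are treated as
  -- spanning trees of the alive part. By `alive-ends` only loops can sit at dead vertices.
  record State : Set where
    field
      G        : Multigraph
      e        : Fin (m G)
      alive    : Mask (n G)
      proper   : src G e ≢ tgt G e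
      alive-e  : alive ∋ src G e × alive ∋ tgt G e
      alive-ends : ∀ t → src G t ≢ tgt G t → alive ∋ src G t × alive ∋ tgt G t
      no-K4    : SeriesParallel G
      lab      : Fin (m G) → Label
      tree     : ∀ x → IsTree G (alive ∋_) (λ t → chosen (lab t) x)
      faithful : Faithful e lab

  non-loops : (G : Multigraph) → Mask (m G)
  non-loops G t = not (does (src G t ≟ tgt G t))

  non-loop-intro : ∀ G t → src G t ≢ tgt G t → non-loops G ∋ t
  non-loop-intro G t p with src G t ≟ tgt G t
  ... | yes e = ⊥-elim (p e)
  ... | no _ = refl

  non-loop-elim : ∀ G t → non-loops G ∋ t → src G t ≢ tgt G t
  non-loop-elim G t p with src G t ≟ tgt G t
  ... | no ¬e = ¬e

  loop-intro : ∀ G t → src G t ≡ tgt G t → non-loops G t ≡ false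
  loop-intro G t e with src G t ≟ tgt G t
  ... | yes _ = refl
  ... | no ¬e = ⊥-elim (¬e e)

  measure : State → ℕ
  measure S = size (non-loops (State.G S))

  module _ (S : State) where
    open State S

    T : V H → Mask (m G)
    T x t = chosen (lab t) x

    At : Fin (m G) → Fin (n G) → Set
    At t v = src G t ≢ tgt G t × (src G t ≡ v ⊎ tgt G t ≡ v)

    at? : ∀ t v → Dec (At t v)
    at? t v = ¬? (src G t ≟ tgt G t) ×-dec ((src G t ≟ v) ⊎-dec (tgt G t ≟ v))

    Internal : Fin (n G) → Set
    Internal v = alive ∋ v × v ≢ src G e × v ≢ tgt G e

    internal? : ∀ v → Dec (Internal v)
    internal? v = (alive v Bool.≟ true) ×-dec (¬? (v ≟ src G e) ×-dec ¬? (v ≟ tgt G e))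

    at-≢e : ∀ {t v} → Internal v → At t v → t ≢ e
    at-≢e (_ , p , q) (_ , inj₁ r) refl = p (sym r)
    at-≢e (_ , p , q) (_ , inj₂ r) refl = q (sym r)

    other-end : ∀ {t v} → At t v → ∃[ u ] (u ≢ v × Ends G t v u)
    other-end {t} (p , inj₁ refl) = tgt G t , p ∘ sym , inj₁ (refl , refl)
    other-end {t} (p , inj₂ refl) = src G t , p , inj₂ (refl , refl)

    alive-end : ∀ {t v u} → At t v → Ends G t v u → alive ∋ u
    alive-end {t} (p , _) (inj₁ (_ , refl)) = proj₂ (alive-ends t p)
    alive-end {t} (p , _) (inj₂ (refl , _)) = proj₁ (alive-ends t p)

    tree-at : ∀ {v} → Internal v → ∀ x → ∃[ t ] (T x ∋ t × At t v)
    tree-at {v} (v-alive , v≢s , _) x with proj₁ (tree x) v (src G e) v-alive (proj₁ alive-e)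
    ... | ε = ⊥-elim (v≢s refl)
    ... | (t , t∈ , inj₁ (p , _)) ◅ _ = t , t∈ , tree-no-loop G (tree x) t t∈ , inj₁ p
    ... | (t , t∈ , inj₂ (_ , p)) ◅ _ = t , t∈ , tree-no-loop G (tree x) t t∈ , inj₂ p

    Parallel : Fin (m G) → Fin (m G) → Set
    Parallel f f′ = f ≢ e × f′ ≢ e × f ≢ f′ × src G f ≢ tgt G f × Ends G f′ (src G f) (tgt G f)

    parallel? : Dec (∃[ f ] ∃[ f′ ] Parallel f f′)
    parallel? = any? λ f → any? λ f′ → ¬? (f ≟ e) ×-dec (¬? (f′ ≟ e) ×-dec (¬? (f ≟ f′) ×-dec
      (¬? (src G f ≟ tgt G f) ×-dec (((src G f′ ≟ src G f) ×-dec (tgt G f′ ≟ tgt G f)) ⊎-dec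
                                     ((src G f′ ≟ tgt G f) ×-dec (tgt G f′ ≟ src G f))))))

    same-ends-parallel : ∀ {f f′ a b} → f ≢ e → f′ ≢ e → f ≢ f′ → a ≢ b → Ends G f a b → Ends G f′ a b → Parallel f f′
    same-ends-parallel f≢e f′≢e f≢f′ a≢b (inj₁ (refl , refl)) ef′ = f≢e , f′≢e , f≢f′ , a≢b , ef′
    same-ends-parallel f≢e f′≢e f≢f′ a≢b (inj₂ (refl , refl)) ef′ = f≢e , f′≢e , f≢f′ , a≢b ∘ sym , Ends-sym G ef′

    -- Deleted edges become loops labelled `absent`, so that vertex and edge types never change.
    module Loopify (f : Fin (m G)) (nl : src G f ≢ tgt G f) where
      t′ : Fin (m G) → Fin (n G)
      t′ = tgt G [ f ≔ src G f ]

      G′ : Multigraph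
      G′ = graph (src G) t′

      at-f : src G f ≡ t′ f
      at-f = sym (set-same (tgt G) f)

      off-f : ∀ {g} → g ≢ f → t′ g ≡ tgt G g
      off-f = set-other (tgt G) f

      kept : ∀ g → src G g ≢ t′ g → g ≢ f × src G g ≢ tgt G g
      kept g p = g≢f , λ q → p (trans q (sym (off-f g≢f)))
        where
        g≢f : g ≢ f
        g≢f refl = p at-f

      no-K4′ : SeriesParallel G′
      no-K4′ = no-K4 ∘ model-subgraph (src G) (tgt G) (src G) t′ λ g → case g ≟ f of λ where
        (yes refl) → inj₁ at-f
        (no g≢f)   → inj₂ (g , inj₁ (refl , sym (off-f g≢f)))

      smaller : size (non-loops G′) < measure S
      smaller = size-< (non-loops G′) (non-loops G)
        (λ g p → non-loop-intro G g (proj₂ (kept g (non-loop-elim G′ g p))))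
        f (loop-intro G′ f at-f) (non-loop-intro G f nl)

    -- Two parallel edges in one tree would form a cycle, so at most one is chosen: exactly the
    -- condition for a parallel composition of their labels.
    merge-parallel : ∀ {f f′} → Parallel f f′ → Σ[ S′ ∈ State ] measure S′ < measure S
    merge-parallel {f} {f′} (f≢e , f′≢e , f≢f′ , nl , ef′) = record
      { G = G′ ; e = e ; alive = alive
      ; proper = λ p → proper (trans p (off-f (f′≢e ∘ sym)))
      ; alive-e = proj₁ alive-e , subst (alive ∋_) (sym (off-f (f′≢e ∘ sym))) (proj₂ alive-e)
      ; alive-ends = λ t p → let (t≢f′ , q) = kept t p ; (a , b) = alive-ends t q in
          a , subst (alive ∋_) (sym (off-f t≢f′)) b
      ; no-K4 = no-K4′
      ; lab = lab′
      ; tree = tree′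
      ; faithful = faithful′
      } , smaller
      where
      nl′ : src G f′ ≢ tgt G f′
      nl′ p = case ef′ of λ where
        (inj₁ (a , b)) → nl (trans (sym a) (trans p b))
        (inj₂ (a , b)) → nl (trans (sym b) (trans (sym p) a))
      not-both : ∀ x → T x ∋ f → T x f′ ≡ false
      not-both x p = bool-≢ λ q → proj₂ (tree x) f p (edge G f′ (q , f≢f′ ∘ sym) ef′)
      one-free : ∀ x → T x f ≡ false ⊎ T x f′ ≡ false
      one-free x with member (T x) f
      ... | inj₁ p = inj₂ (not-both x p)
      ... | inj₂ q = inj₁ q
      open Loopify f′ nl′
      open MergeAt faithful false f f′ f≢f′ f≢e f′≢e one-free
      T′ : V H → Mask (m G)
      T′ x t = chosen (lab′ t) x
      T′-f′ : ∀ x → ¬ (T′ x ∋ f′)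
      T′-f′ x p rewrite lab′-f′ = case p of λ ()
      T′-other : ∀ x {g} → g ≢ f → g ≢ f′ → T′ x g ≡ T x g
      T′-other x g≢f g≢f′ = cong (λ L → chosen L x) (lab′-other g≢f g≢f′)
      T′-f : ∀ x → T′ x f ≡ chosen merge x
      T′-f x = cong (λ L → chosen L x) lab′-f
      -- The old edge that the merged edge represents in the tree of `x`, whenever the merged edge
      -- is chosen.
      rep : V H → Fin (m G)
      rep x = [ (λ _ → f) , (λ _ → f′) ]′ (member (T x) f)
      rep-∈ : ∀ x → T′ x ∋ f → T x ∋ rep x
      rep-∈ x p with member (T x) f
      ... | inj₁ q = q
      ... | inj₂ q = bool-≢ λ r → true≢false p (trans (T′-f x) (merge-both x q r))
      rep-ends : ∀ x → Ends G (rep x) (src G f) (tgt G f)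
      rep-ends x with member (T x) f
      ... | inj₁ _ = inj₁ (refl , refl)
      ... | inj₂ _ = ef′
      rep-≢ : ∀ x {g} → g ≢ f → g ≢ f′ → g ≢ rep x
      rep-≢ x g≢f g≢f′ with member (T x) f
      ... | inj₁ _ = g≢f
      ... | inj₂ _ = g≢f′
      σ : Fin (m G) → Fin (m G)
      σ = id [ f′ ≔ f ]
      tree′ : ∀ x → IsTree G′ (alive ∋_) (T′ x)
      tree′ x = tree-rename (src G) (tgt G) (src G) t′ σ π to from π-inj (tree x)
        where
        π : Fin (m G) → Fin (m G)
        π = id [ f ≔ rep x ]
        flip-ends : Ends G f′ (src G f) (tgt G f) → Ends G′ f (src G f′) (tgt G f′)
        flip-ends (inj₁ (a , b)) = inj₁ (sym a , trans (off-f f≢f′) (sym b))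
        flip-ends (inj₂ (a , b)) = inj₂ (sym b , trans (off-f f≢f′) (sym a))
        to : ∀ g → T x ∋ g → T′ x ∋ σ g × Ends G′ (σ g) (src G g) (tgt G g)
        to g p with g ≟ f′
        ... | yes refl = trans (T′-f x) (merge-one x (inj₂ p)) , flip-ends ef′
        ... | no g≢f′ = keeps (g ≟ f) , inj₁ (refl , off-f g≢f′)
          where
          keeps : Dec (g ≡ f) → T′ x ∋ g
          keeps (yes refl) = trans (T′-f x) (merge-one x (inj₁ p))
          keeps (no g≢f) = trans (T′-other x g≢f g≢f′) p
        from : ∀ g → T′ x ∋ g → T x ∋ π g × Ends G (π g) (src G g) (t′ g)
        from g p with g ≟ f
        ... | yes refl = rep-∈ x p , subst (Ends G (rep x) (src G f)) (sym (off-f f≢f′)) (rep-ends x)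
        ... | no g≢f = trans (sym (T′-other x g≢f g≢f′)) p , inj₁ (refl , sym (off-f g≢f′))
          where
          g≢f′ : g ≢ f′
          g≢f′ refl = T′-f′ x p
        π-inj : ∀ g h → T′ x ∋ g → T′ x ∋ h → π g ≡ π h → g ≡ h
        π-inj g h p q eq with g ≟ f | h ≟ f
        ... | yes refl | yes refl = refl
        ... | yes refl | no h≢f = ⊥-elim (rep-≢ x h≢f (λ { refl → T′-f′ x q }) (sym eq))
        ... | no g≢f | yes refl = ⊥-elim (rep-≢ x g≢f (λ { refl → T′-f′ x p }) eq)
        ... | no _ | no _ = eq

    -- Every tree must reach `v` and can do so only through `f`. Hence `f` is always chosen, its
    -- label is constant, and forgetting it loses nothing.
    remove-pendant : ∀ {v f} → Internal v → At f v → (∀ g → At g v → g ≡ f) → Σ[ S′ ∈ State ] measure S′ < measure S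
    remove-pendant {v} {f} iv@(_ , v≢s , v≢t) fv unique = record
      { G = G′ ; e = e ; alive = alive ∖ only v
      ; proper = λ p → proper (trans p (off-f e≢f))
      ; alive-e = survive (proj₁ alive-e) (v≢s ∘ sym) ,
          subst ((alive ∖ only v) ∋_) (sym (off-f e≢f)) (survive (proj₂ alive-e) (v≢t ∘ sym))
      ; alive-ends = λ t p → let (t≢f , q) = kept t p ; (a , b) = alive-ends t q in
          survive a (λ r → t≢f (unique t (q , inj₁ r))) ,
          subst ((alive ∖ only v) ∋_) (sym (off-f t≢f)) (survive b (λ r → t≢f (unique t (q , inj₂ r))))
      ; no-K4 = no-K4′
      ; lab = lab [ f ≔ absent ]
      ; tree = tree′
      ; faithful = faithful-remove faithful f (at-≢e iv fv) (constant faithful connected-H f (at-≢e iv fv) always)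
      } , smaller
      where
      open Loopify f (proj₁ fv)
      e≢f : e ≢ f
      e≢f = at-≢e iv fv ∘ sym
      survive : ∀ {u} → alive ∋ u → u ≢ v → (alive ∖ only v) ∋ u
      survive p u≢v = ∖-intro alive (only v) p (only-≢ v u≢v)
      always : ∀ x → T x ∋ f
      always x with tree-at iv x
      ... | t , p , tv with unique t tv
      ... | refl = p
      T′ : V H → Mask (m G)
      T′ x t = chosen ((lab [ f ≔ absent ]) t) x
      T′-f : ∀ x → ¬ (T′ x ∋ f)
      T′-f x p rewrite set-same lab f {absent} = case p of λ ()
      T′-other : ∀ x {g} → g ≢ f → T′ x g ≡ T x g
      T′-other x g≢f = cong (λ L → chosen L x) (set-other lab f g≢f)
      tree′ : ∀ x → IsTree G′ ((alive ∖ only v) ∋_) (T′ x)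
      tree′ x = let (u , u≢v , ef) = other-end fv in
        tree-prune (src G) (tgt G) (src G) t′ f (always x) ef u≢v
          (λ g p g≢f → let nl = tree-no-loop G (tree x) g p in
            (λ r → g≢f (unique g (nl , inj₁ r))) , λ r → g≢f (unique g (nl , inj₂ r)))
          (λ g p g≢f → trans (T′-other x g≢f) p)
          (λ g p → let g≢f = λ { refl → T′-f x p } in trans (sym (T′-other x g≢f)) p , g≢f)
          (λ g p g≢f → refl , off-f g≢f)
          (λ a p → ∖-⊆ alive (only v) p , ∉-only v (∖-∉ alive (only v) p))
          (tree x)

    -- Every tree reaches `v` through `f` or `f′`, so the pair of configurations is allowed in a
    -- series composition. The merged edge `f` is chosen when both are; otherwise `v` is a leaf of
    -- the tree and is pruned.
    merge-series : ∀ {v f f′} → Internal v → At f v → At f′ v → f ≢ f′ → (∀ g → At g v → g ≡ f ⊎ g ≡ f′) →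
      Σ[ S′ ∈ State ] measure S′ < measure S
    merge-series {v} {f} {f′} iv@(_ , v≢s , v≢t) fv f′v f≢f′ pair = record
      { G = G′ ; e = e ; alive = alive ∖ only v
      ; proper = λ p → proper (trans (sym (proj₁ (off e≢f e≢f′))) (trans p (proj₂ (off e≢f e≢f′))))
      ; alive-e = subst ((alive ∖ only v) ∋_) (sym (proj₁ (off e≢f e≢f′))) (survive (proj₁ alive-e) (v≢s ∘ sym)) ,
          subst ((alive ∖ only v) ∋_) (sym (proj₂ (off e≢f e≢f′))) (survive (proj₂ alive-e) (v≢t ∘ sym))
      ; alive-ends = alive-ends′
      ; no-K4 = no-K4 ∘ model-uncontract (src G) (tgt G) s′ t′ f f′ ef ef′ u≢v w≢v s′-f t′-f loop-f′ kinds
      ; lab = lab′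
      ; tree = tree′
      ; faithful = faithful′
      } , size-< (non-loops G′) (non-loops G) still f′ (loop-intro G′ f′ loop-f′) (non-loop-intro G f′ (proj₁ f′v))
      where
      f≢e : f ≢ e
      f≢e = at-≢e iv fv
      f′≢e : f′ ≢ e
      f′≢e = at-≢e iv f′v
      e≢f : e ≢ f
      e≢f = f≢e ∘ sym
      e≢f′ : e ≢ f′
      e≢f′ = f′≢e ∘ sym
      u = proj₁ (other-end fv)
      u≢v = proj₁ (proj₂ (other-end fv))
      ef = proj₂ (proj₂ (other-end fv))
      w = proj₁ (other-end f′v)
      w≢v = proj₁ (proj₂ (other-end f′v))
      ef′ = proj₂ (proj₂ (other-end f′v))
      s′ t′ : Fin (m G) → Fin (n G)
      s′ = (src G [ f ≔ u ]) [ f′ ≔ w ]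
      t′ = (tgt G [ f ≔ w ]) [ f′ ≔ w ]
      G′ : Multigraph
      G′ = graph s′ t′
      s′-f : s′ f ≡ u
      s′-f = trans (set-other (src G [ f ≔ u ]) f′ f≢f′) (set-same (src G) f)
      t′-f : t′ f ≡ w
      t′-f = trans (set-other (tgt G [ f ≔ w ]) f′ f≢f′) (set-same (tgt G) f)
      loop-f′ : s′ f′ ≡ t′ f′
      loop-f′ = trans (set-same (src G [ f ≔ u ]) f′) (sym (set-same (tgt G [ f ≔ w ]) f′))
      off : ∀ {g} → g ≢ f → g ≢ f′ → s′ g ≡ src G g × t′ g ≡ tgt G g
      off g≢f g≢f′ = trans (set-other (src G [ f ≔ u ]) f′ g≢f′) (set-other (src G) f g≢f) ,
                     trans (set-other (tgt G [ f ≔ w ]) f′ g≢f′) (set-other (tgt G) f g≢f)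
      survive : ∀ {x} → alive ∋ x → x ≢ v → (alive ∖ only v) ∋ x
      survive p x≢v = ∖-intro alive (only v) p (only-≢ v x≢v)
      not-at : ∀ {g} → g ≢ f → g ≢ f′ → ¬ At g v
      not-at g≢f g≢f′ gv = [ g≢f , g≢f′ ]′ (pair _ gv)
      off-v : ∀ {g} → g ≢ f → g ≢ f′ → src G g ≢ tgt G g → src G g ≢ v × tgt G g ≢ v
      off-v g≢f g≢f′ nl = (λ r → not-at g≢f g≢f′ (nl , inj₁ r)) , λ r → not-at g≢f g≢f′ (nl , inj₂ r)
      non-loop-off : ∀ {g} → g ≢ f → g ≢ f′ → s′ g ≢ t′ g → src G g ≢ tgt G g
      non-loop-off g≢f g≢f′ nl r = let (a , b) = off g≢f g≢f′ in nl (trans a (trans r (sym b)))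
      alive-ends′ : ∀ g → s′ g ≢ t′ g → (alive ∖ only v) ∋ s′ g × (alive ∖ only v) ∋ t′ g
      alive-ends′ g nl = by-cases (g ≟ f) (g ≟ f′)
        where
        by-cases : Dec (g ≡ f) → Dec (g ≡ f′) → (alive ∖ only v) ∋ s′ g × (alive ∖ only v) ∋ t′ g
        by-cases (yes refl) _ = subst ((alive ∖ only v) ∋_) (sym s′-f) (survive (alive-end fv ef) u≢v) ,
                                subst ((alive ∖ only v) ∋_) (sym t′-f) (survive (alive-end f′v ef′) w≢v)
        by-cases (no _) (yes refl) = ⊥-elim (nl loop-f′)
        by-cases (no g≢f) (no g≢f′) =
          let (a , b) = off g≢f g≢f′
              nl′ = non-loop-off g≢f g≢f′ nl
              (p , q) = alive-ends g nl′
              (y , z) = off-v g≢f g≢f′ nl′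
          in subst ((alive ∖ only v) ∋_) (sym a) (survive p y) , subst ((alive ∖ only v) ∋_) (sym b) (survive q z)
      kinds : ∀ g → g ≢ f → g ≢ f′ →
        s′ g ≡ t′ g ⊎ (s′ g ≡ src G g × t′ g ≡ tgt G g × src G g ≢ v × tgt G g ≢ v)
      kinds g g≢f g≢f′ with s′ g ≟ t′ g
      ... | yes l = inj₁ l
      ... | no nl = let (a , b) = off g≢f g≢f′ ; (y , z) = off-v g≢f g≢f′ (non-loop-off g≢f g≢f′ nl) in
            inj₂ (a , b , y , z)
      still : ∀ g → non-loops G′ ∋ g → non-loops G ∋ g
      still g p = non-loop-intro G g (by-cases (g ≟ f) (g ≟ f′))
        where
        by-cases : Dec (g ≡ f) → Dec (g ≡ f′) → src G g ≢ tgt G g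
        by-cases (yes refl) _ = proj₁ fv
        by-cases (no _) (yes refl) = proj₁ f′v
        by-cases (no g≢f) (no g≢f′) = non-loop-off g≢f g≢f′ (non-loop-elim G′ g p)
      one-used : ∀ x → T x f ≡ true ⊎ T x f′ ≡ true
      one-used x with tree-at iv x
      ... | t , p , tv with pair t tv
      ... | inj₁ refl = inj₁ p
      ... | inj₂ refl = inj₂ p
      open MergeAt faithful true f f′ f≢f′ f≢e f′≢e one-used
      T′ : V H → Mask (m G)
      T′ x t = chosen (lab′ t) x
      T′-f′ : ∀ x → T′ x f′ ≡ false
      T′-f′ x = cong (λ L → chosen L x) lab′-f′
      T′-f : ∀ x → T′ x f ≡ chosen merge x
      T′-f x = cong (λ L → chosen L x) lab′-f
      T′-other : ∀ x {g} → g ≢ f → g ≢ f′ → T′ x g ≡ T x g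
      T′-other x g≢f g≢f′ = cong (λ L → chosen L x) (lab′-other g≢f g≢f′)
      alive′⊆ : ∀ a → (alive ∖ only v) ∋ a → alive ∋ a × a ≢ v
      alive′⊆ a p = ∖-⊆ alive (only v) p , ∉-only v (∖-∉ alive (only v) p)
      -- `h` is the edge at `v` that the tree uses and `h′` the one that it avoids; the last
      -- hypotheses only identify the pair `h`, `h′` with `f`, `f′` in either order.
      drop : ∀ x h h′ {y} → T x ∋ h → T x h′ ≡ false → T′ x f ≡ false → Ends G h v y → y ≢ v →
        (∀ g → g ≢ h → g ≢ h′ → g ≢ f × g ≢ f′) → (∀ g → g ≢ f → g ≢ f′ → g ≢ h) →
        IsTree G′ ((alive ∖ only v) ∋_) (T′ x)
      drop x h h′ h∈ h′∉ f∉′ eh y≢v two two′ = tree-prune (src G) (tgt G) s′ t′ h h∈ eh y≢v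
          (λ g p g≢h → let (a , b) = apart g p g≢h in off-v a b (tree-no-loop G (tree x) g p))
          (λ g p g≢h → let (a , b) = apart g p g≢h in trans (T′-other x a b) p)
          (λ g p → let (a , b) = apart′ g p in trans (sym (T′-other x a b)) p , two′ g a b)
          (λ g p g≢h → let (a , b) = apart g p g≢h in off a b)
          alive′⊆ (tree x)
        where
        apart : ∀ g → T x ∋ g → g ≢ h → g ≢ f × g ≢ f′
        apart g p g≢h = two g g≢h λ { refl → true≢false p h′∉ }
        apart′ : ∀ g → T′ x ∋ g → g ≢ f × g ≢ f′
        apart′ g p = (λ { refl → true≢false p f∉′ }) , λ { refl → true≢false p (T′-f′ x) }
      tree′ : ∀ x → IsTree G′ ((alive ∖ only v) ∋_) (T′ x)
      tree′ x with member (T x) f | member (T x) f′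
      ... | inj₁ p | inj₁ q = tree-contract (src G) (tgt G) s′ t′ f f′ f≢f′ p q ef ef′ u≢v w≢v
            (λ g g≢f g≢f′ r → off-v g≢f g≢f′ (tree-no-loop G (tree x) g r))
            (trans (T′-f x) (merge-both x p q)) (T′-f′ x) (inj₁ (s′-f , t′-f))
            (λ g g≢f g≢f′ → T′-other x g≢f g≢f′ , off g≢f g≢f′)
            alive′⊆ (tree x)
      ... | inj₁ p | inj₂ q = drop x f f′ p q (trans (T′-f x) (merge-one x (inj₂ q))) ef u≢v
            (λ g a b → a , b) (λ g a b → a)
      ... | inj₂ p | inj₁ q = drop x f′ f q p (trans (T′-f x) (merge-one x (inj₁ p))) ef′ w≢v
            (λ g a b → b , a) (λ g a b → b)
      ... | inj₂ p | inj₂ q with one-used x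
      ... | inj₁ p′ = ⊥-elim (true≢false p′ p)
      ... | inj₂ q′ = ⊥-elim (true≢false q′ q)

    open Minors G

    -- The tree of `x₀` supplies a first edge at `v`. One or two edges in all permit a reduction;
    -- three of them have distinct far ends because no parallel pair is left.
    reduce-or-degree : ¬ (∃[ f ] ∃[ f′ ] Parallel f f′) → ∀ v →
      Σ[ S′ ∈ State ] (measure S′ < measure S) ⊎ (Internal v → ThreeNeighbours v)
    reduce-or-degree ¬parallel v with internal? v
    ... | no ¬iv = inj₂ (⊥-elim ∘ ¬iv)
    ... | yes iv with tree-at iv x₀
    ... | f , _ , fv with any? (λ g → ¬? (g ≟ f) ×-dec at? g v)
    ... | no none = inj₁ (remove-pendant iv fv λ g gv → decidable-stable (g ≟ f) λ g≢f → none (g , g≢f , gv))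
    ... | yes (g , g≢f , gv) with any? (λ h → (¬? (h ≟ f) ×-dec ¬? (h ≟ g)) ×-dec at? h v)
    ... | no none = inj₁ (merge-series iv fv gv (g≢f ∘ sym) two)
      where
      two : ∀ h → At h v → h ≡ f ⊎ h ≡ g
      two h hv with h ≟ f | h ≟ g
      ... | yes p | _ = inj₁ p
      ... | no _ | yes q = inj₂ q
      ... | no p | no q = ⊥-elim (none (h , (p , q) , hv))
    ... | yes (h , (h≢f , h≢g) , hv) =
      let (x , x≢v , ex) = other-end fv
          (y , y≢v , ey) = other-end gv
          (z , z≢v , ez) = other-end hv
      in inj₂ λ _ → x , y , z ,
        (distinct fv gv (g≢f ∘ sym) ex ey x≢v , distinct fv hv (h≢f ∘ sym) ex ez x≢v , distinct gv hv (h≢g ∘ sym) ey ez y≢v) ,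
        (x≢v , f , ex) , (y≢v , g , ey) , (z≢v , h , ez)
      where
      distinct : ∀ {f g x y} → At f v → At g v → f ≢ g → Ends G f v x → Ends G g v y → x ≢ v → x ≢ y
      distinct fv gv f≢g ex ey x≢v refl =
        ¬parallel (_ , _ , same-ends-parallel (at-≢e iv fv) (at-≢e iv gv) f≢g (x≢v ∘ sym) ex ey)

    -- The piece is the component of `v` among the internal vertices, so it is attached only at the
    -- ends of `e`, and `e` provides the contact between the two sides. Which end the piece touches
    -- is not known in advance, hence the two orientations in `start`.
    K4-of-internal : ∀ v → Internal v → (∀ v → Internal v → ThreeNeighbours v) → K4MinorModel G
    K4-of-internal v iv degree = start leave
      where
      s w : Fin (n G)
      s = src G e
      w = tgt G e
      I : Vertices
      I = (alive ∖ only s) ∖ only w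
      I-intro : ∀ {a} → Internal a → I ∋ a
      I-intro (p , q , r) = ∖-intro (alive ∖ only s) (only w) (∖-intro alive (only s) p (only-≢ s q)) (only-≢ w r)
      I-elim : ∀ {a} → I ∋ a → Internal a
      I-elim {a} p = ∖-⊆ alive (only s) (∖-⊆ (alive ∖ only s) (only w) p) ,
        ∉-only s (∖-∉ alive (only s) (∖-⊆ (alive ∖ only s) (only w) p)) , ∉-only w (∖-∉ (alive ∖ only s) (only w) p)
      open Component (component I v (I-intro iv)) renaming (part to D)
      s∉D : ∀ {a} → D ∋ a → a ≢ s
      s∉D p = proj₁ (proj₂ (I-elim (within _ p)))
      w∉D : ∀ {a} → D ∋ a → a ≢ w
      w∉D p = proj₂ (proj₂ (I-elim (within _ p)))
      alive-other : ∀ {a b} t → Ends G t a b → a ≢ b → alive ∋ b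
      alive-other t (inj₁ (refl , refl)) a≢b = proj₂ (alive-ends t a≢b)
      alive-other t (inj₂ (refl , refl)) a≢b = proj₁ (alive-ends t (a≢b ∘ sym))
      bounded : ∀ a b → D ∋ a → Adjacent a b → D ∋ b ⊎ (b ≡ s ⊎ b ≡ w)
      bounded a b p (t , ends) with a ≟ b | b ≟ s | b ≟ w
      ... | yes refl | _ | _ = inj₁ p
      ... | no _ | yes q | _ = inj₂ (inj₁ q)
      ... | no _ | no _ | yes q = inj₂ (inj₂ q)
      ... | no a≢b | no b≢s | no b≢w =
            inj₁ (closed a b p (I-intro (alive-other t ends a≢b , b≢s , b≢w)) (t , ends))
      -- The tree of `x₀` joins `v` to `s`, so one of its edges leaves `D`; by closedness that edge
      -- ends at `s` or `w`.
      leave : Touch (only s) D ⊎ Touch (only w) D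
      leave with crossing D (proj₁ (tree x₀) v s (proj₁ iv) (proj₁ alive-e)) root (bool-≢ λ p → s∉D p refl)
      ... | t , a , b , _ , ends , a∈ , b∉ with bounded a b a∈ (t , ends)
      ... | inj₁ b∈ = ⊥-elim (true≢false b∈ b∉)
      ... | inj₂ (inj₁ refl) = inj₁ (a , a∈ , b , only-self b , t , Ends-sym G ends)
      ... | inj₂ (inj₂ refl) = inj₂ (a , a∈ , b , only-self b , t , Ends-sym G ends)
      apart : ∀ a → (only s) ∋ a → ¬ ((only w) ∋ a)
      apart a p q = proper (trans (sym (only-≡ s {a} p)) (only-≡ w q))
      sw : Touch (only s) (only w)
      sw = w , only-self w , s , only-self s , e , inj₁ (refl , refl)
      start : Touch (only s) D ⊎ Touch (only w) D → K4MinorModel G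
      start (inj₁ sD) = K4-of-piece (only s) (only w) D s w (<-wellFounded _) (only-conn s) (only-conn w) conn
        apart (λ a p q → s∉D q (only-≡ s p)) (λ a p q → w∉D q (only-≡ w p)) sw sD (only-self s) (only-self w)
        bounded (λ a p → degree a (I-elim (within a p)))
      start (inj₂ wD) = K4-of-piece (only w) (only s) D w s (<-wellFounded _) (only-conn w) (only-conn s) conn
        (λ a p q → apart a q p) (λ a p q → w∉D q (only-≡ w p)) (λ a p q → s∉D q (only-≡ s p)) (touch-sym sw) wD
        (only-self w) (only-self s)
        (λ a b p ab → case bounded a b p ab of λ where
          (inj₁ q) → inj₁ q
          (inj₂ (inj₁ q)) → inj₂ (inj₂ q)
          (inj₂ (inj₂ q)) → inj₂ (inj₁ q))
        (λ a p → degree a (I-elim (within a p)))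

    loop-constant : ∀ t → t ≢ e → src G t ≡ tgt G t → ∀ x y → Same (lab t) x y
    loop-constant t t≢e l = constant faithful connected-H t t≢e λ x →
      bool-≢ λ p → tree-no-loop G (tree x) t p l

    -- All edges but loops now join the ends of `e`, and at most one of them differs from `e`.
    -- Labels of loops are constant, so the label of that one edge alone is faithful and embeds `H`.
    -- If there is no such edge, `H` is a single vertex and fits into `K2`.
    terminal : ¬ (∃[ f ] ∃[ f′ ] Parallel f f′) → (∀ v → ¬ Internal v) → PJReducible H
    terminal ¬parallel none with any? (λ f → ¬? (f ≟ e) ×-dec ¬? (src G f ≟ tgt G f))
    ... | no no-edge = sub base connected-H ((λ _ → true) ,
          (λ x y _ → inj faithful x y λ t t≢e → fixed t t≢e x y) ,
          λ s → let (t , t≢e , moves , _) = adj faithful s in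
            ⊥-elim (moves-recolours (lab t) moves (cong (colour (term (lab t))) (fixed t t≢e _ _))))
      where
      fixed : ∀ t → t ≢ e → ∀ x y → Same (lab t) x y
      fixed t t≢e = loop-constant t t≢e
        (decidable-stable (src G t ≟ tgt G t) λ nl → no-edge (t , t≢e , nl))
    ... | yes (f , f≢e , nl) = sub (K-reducible (term (lab f))) connected-H (at (lab f) ,
          (λ x y eq → inj faithful x y λ t t≢e → same x y eq t t≢e) , λ s → moved s)
      where
      end : ∀ {v} → alive ∋ v → v ≡ src G e ⊎ v ≡ tgt G e
      end {v} p with v ≟ src G e | v ≟ tgt G e
      ... | yes q | _ = inj₁ q
      ... | no _ | yes q = inj₂ q
      ... | no q | no r = ⊥-elim (none v (p , q , r))
      ends-e : ∀ t → src G t ≢ tgt G t → Ends G t (src G e) (tgt G e)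
      ends-e t nl with end (proj₁ (alive-ends t nl)) | end (proj₂ (alive-ends t nl))
      ... | inj₁ p | inj₂ q = inj₁ (p , q)
      ... | inj₂ p | inj₁ q = inj₂ (p , q)
      ... | inj₁ p | inj₁ q = ⊥-elim (nl (trans p (sym q)))
      ... | inj₂ p | inj₂ q = ⊥-elim (nl (trans p (sym q)))
      loop : ∀ t → t ≢ e → t ≢ f → src G t ≡ tgt G t
      loop t t≢e t≢f = decidable-stable (src G t ≟ tgt G t) λ nl′ →
        ¬parallel (f , t , same-ends-parallel f≢e t≢e (t≢f ∘ sym) proper (ends-e f nl) (ends-e t nl′))
      same : ∀ x y → Same (lab f) x y → ∀ t → t ≢ e → Same (lab t) x y
      same x y eq t t≢e with t ≟ f
      ... | yes refl = eq
      ... | no t≢f = loop-constant t t≢e (loop t t≢e t≢f) x y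
      moved : ∀ {x y} → _~_ H x y → Moves (lab f) x y
      moved {x} {y} s with adj faithful s
      ... | t , t≢e , moves , _ with t ≟ f
      ... | yes refl = moves
      ... | no t≢f = ⊥-elim (moves-recolours (lab t) moves
              (cong (colour (term (lab t))) (loop-constant t t≢e (loop t t≢e t≢f) x y)))

  state-reducible : ∀ S → Acc _<_ (measure S) → PJReducible H
  state-reducible S (acc smaller) with parallel? S
  ... | yes (f , f′ , p) = let (S′ , less) = merge-parallel S p in state-reducible S′ (smaller less)
  ... | no ¬parallel with search (reduce-or-degree S ¬parallel)
  ... | inj₁ (_ , S′ , less) = state-reducible S′ (smaller less)
  ... | inj₂ degree with any? (internal? S)
  ... | yes (v , iv) = ⊥-elim (State.no-K4 S (K4-of-internal S v iv degree))
  ... | no none = terminal S ¬parallel λ v iv → none (v , iv)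

-- From subgraphs of H(G,e) to reducible graphs

lookup-∪⁅⁆-same : ∀ {k} (T : Subset k) e → lookup (T ∪ ⁅ e ⁆) e ≡ true
lookup-∪⁅⁆-same T e = []=⇒lookup (x∈p∪q⁺ {p = T} (inj₂ (x∈⁅x⁆ e)))

lookup-∪⁅⁆-other : ∀ {k} (T : Subset k) e {g} → g ≢ e → lookup (T ∪ ⁅ e ⁆) g ≡ lookup T g
lookup-∪⁅⁆-other T e {g} g≢e = trans (lookup-zipWith _∨_ g T ⁅ e ⁆)
  (trans (cong (lookup T g ∨_) (bool-≢ λ p → x≢y⇒x∉⁅y⁆ g≢e (lookup⇒[]= g ⁅ e ⁆ p))) (∨-identityʳ _))

SpanningTree⇒tree : ∀ G T S → (∀ t → lookup T t ≡ S t) → ∀ {A} → SpanningTree G T → IsTree G A S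
SpanningTree⇒tree G T S e (spans , acyclic) =
  (λ u v _ _ → reach-mono G (λ t p → off p) (spans u v)) ,
  λ t p r → acyclic t (on p) (reach-mono G (λ s (q , s≢t) → on q , s≢t) r)
  where
  on : ∀ {t} → S ∋ t → t ∈ˢ T
  on {t} p = lookup⇒[]= t T (trans (e t) p)
  off : ∀ {t} → t ∈ˢ T → S ∋ t
  off {t} p = trans (sym (e t)) ([]=⇒lookup p)

lookup-ext : ∀ {k} (S T : Subset k) → (∀ i → lookup S i ≡ lookup T i) → S ≡ T
lookup-ext S T e = trans (sym (tabulate∘lookup S)) (trans (tabulate-cong e) (tabulate∘lookup T))

subgraph⇒reducible : ∀ H → Connected H → ∀ G e → InG′ G e → IsoToSubgraphOfH H G e → PJReducible H
subgraph⇒reducible H conn G e (_ , no-K4 , _ , no-loop) (place , place-inj , in-X , place-adj) =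
  state-reducible initial (<-wellFounded _)
  where
  open Reduction H conn
  open Labels H
  -- The bit of `e` records which alternative of `InX` holds, so that `edge-set x` is a spanning
  -- tree of `G` in both cases.
  e-in : ∀ x → InX G e (place x) → Bool
  e-in x (_ , inj₁ _) = true
  e-in x (_ , inj₂ _) = false
  edge-set : V H → Mask (m G)
  edge-set x = lookup (place x) [ e ≔ e-in x (in-X x) ]
  off-e : ∀ x {t} → t ≢ e → edge-set x t ≡ lookup (place x) t
  off-e x = set-other (lookup (place x)) e
  is-tree : ∀ x → IsTree G (λ v → true ≡ true) (edge-set x)
  is-tree x with in-X x
  ... | _ , inj₁ st = SpanningTree⇒tree G (place x ∪ ⁅ e ⁆) _ same st
    where
    same : ∀ t → lookup (place x ∪ ⁅ e ⁆) t ≡ (lookup (place x) [ e ≔ true ]) t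
    same t with t ≟ e
    ... | yes refl = lookup-∪⁅⁆-same (place x) e
    ... | no t≢e = lookup-∪⁅⁆-other (place x) e t≢e
  ... | e∉ , inj₂ st = SpanningTree⇒tree G (place x) _ same st
    where
    same : ∀ t → lookup (place x) t ≡ (lookup (place x) [ e ≔ false ]) t
    same t with t ≟ e
    ... | yes refl = e∉
    ... | no _ = refl
  lab : Fin (m G) → Label
  lab t = record { term = leaf ; at = λ x → edge-set x t }
  faithful : Faithful e lab
  faithful = record { inj = injective′ ; adj = adjacent′ }
    where
    injective′ : ∀ x y → (∀ t → t ≢ e → edge-set x t ≡ edge-set y t) → x ≡ y
    injective′ x y same = place-inj x y (lookup-ext (place x) (place y) lookup≡)
      where
      lookup≡ : ∀ t → lookup (place x) t ≡ lookup (place y) t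
      lookup≡ t with t ≟ e
      ... | yes refl = trans (proj₁ (in-X x)) (sym (proj₁ (in-X y)))
      ... | no t≢e = trans (sym (off-e x t≢e)) (trans (same t t≢e) (off-e y t≢e))
    adjacent′ : ∀ {x y} → _~_ H x y →
      ∃[ t ] (t ≢ e × edge-set x t ≢ edge-set y t × (∀ g → g ≢ e → g ≢ t → edge-set x g ≡ edge-set y g))
    adjacent′ {x} {y} s with place-adj s
    ... | t , differ , same = t , t≢e , (λ eq → differ (trans (sym (off-e x t≢e)) (trans eq (off-e y t≢e)))) ,
          λ g g≢e g≢t → trans (off-e x g≢e) (trans (same g g≢t) (sym (off-e y g≢e)))
      where
      t≢e : t ≢ e
      t≢e refl = differ (trans (proj₁ (in-X x)) (sym (proj₁ (in-X y))))
  initial : State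
  initial = record
    { G = G ; e = e ; alive = λ _ → true ; proper = no-loop ; alive-e = refl , refl
    ; alive-ends = λ _ _ → refl , refl ; no-K4 = no-K4 ; lab = lab ; tree = is-tree ; faithful = faithful }

-- Expanding an edge into a network

-- The invariant of the expansion. That no edge at all is a bridge keeps the graph connected when
-- the vertex subdividing an edge is deleted.
record Robust (G : Multigraph) : Set where
  field
    two-edges   : 2 ≤ m G
    connected   : MConnected G
    no-K4       : SeriesParallel G
    no-loop     : ∀ t → ¬ IsLoop G t
    no-bridge   : ∀ t → Reach G (_≢ t) (src G t) (tgt G t)
    no-cut      : ∀ w → ConnectedWithout G w
open Robust

Tree : (G : Multigraph) → Mask (m G) → Set
Tree G = IsTree G (λ _ → ⊤)

-- Both operations turn `f` into the two edges `suc f` and `zero`, whose bits are `b` and `b′`.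
split : ∀ {k} → Mask k → Fin k → Bool → Bool → Mask (suc k)
split S f b b′ = b′ ∷ (S [ f ≔ b ])

split-off : ∀ {k} (S : Mask k) f {b g} → (S [ f ≔ b ]) ∋ g → g ≢ f → S ∋ g
split-off S f p g≢f = trans (sym (set-other S f g≢f)) p

split-on : ∀ {k} (S : Mask k) f {b g} → S ∋ g → g ≢ f → (S [ f ≔ b ]) ∋ g
split-on S f p g≢f = trans (set-other S f g≢f) p

split-f : ∀ {k} (S : Mask k) f {b} → (S [ f ≔ b ]) ∋ f → b ≡ true
split-f S f p = trans (sym (set-same S f)) p

module Duplicate (G : Multigraph) (f : Fin (m G)) where

  G₁ : Multigraph
  G₁ = graph (src G f ∷ src G) (tgt G f ∷ tgt G)

  π : Fin (suc (m G)) → Fin (m G)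
  π = f ∷ id

  up : ∀ {P P₁ u v} → (∀ g → P g → P₁ (suc g)) → Reach G P u v → Reach G₁ P₁ u v
  up h = reach-map G G₁ id λ g p → step G₁ (suc g) (h g p)

  robust : Robust G → Robust G₁
  robust R = record
    { two-edges = m≤n⇒m≤1+n (two-edges R)
    ; connected = λ u v → up (λ _ _ → tt) (connected R u v)
    ; no-K4     = no-K4 R ∘ model
    ; no-loop   = λ { zero → no-loop R f ; (suc g) → no-loop R g }
    ; no-bridge = bridge
    ; no-cut    = λ w u v u≢w v≢w → up (λ _ p → p) (no-cut R w u v u≢w v≢w)
    }
    where
    bridge : ∀ t → Reach G₁ (_≢ t) (src G₁ t) (tgt G₁ t)
    bridge zero = step G₁ (suc f) λ ()
    bridge (suc g) = up (λ _ h≢g → h≢g ∘ suc-injective) (no-bridge R g)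
    model : K4MinorModel G₁ → K4MinorModel G
    model (β , nonempty , conn , adj) =
      β , nonempty , (λ i u v p q → reach-map G₁ G id (λ where
          zero    p → step G f p
          (suc g) p → step G g p) (conn i u v p q)) ,
      λ i j i≢j → case adj i j i≢j of λ where
        (zero  , e) → f , e
        (suc g , e) → g , e

  π-ends : ∀ t → Ends G (π t) (src G₁ t) (tgt G₁ t)
  π-ends zero    = inj₁ (refl , refl)
  π-ends (suc _) = inj₁ (refl , refl)

  -- The alternatives unfold `Joined false`: neither copy, only the new one, only the old one. A
  -- tree contains at most one copy, so each case merely renames edges.
  tree : ∀ {S b b₁ b₂} → S f ≡ b →
    (b ≡ false × b₁ ≡ false × b₂ ≡ false) ⊎ (b ≡ true × b₁ ≡ false × b₂ ≡ true) ⊎ (b ≡ true × b₁ ≡ true × b₂ ≡ false) →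
    Tree G S → Tree G₁ (split S f b₁ b₂)
  tree {S} Sf (inj₁ (refl , refl , refl)) =
    tree-rename (src G) (tgt G) (src G₁) (tgt G₁) suc π
      (λ g p → split-on S f p (λ { refl → true≢false p Sf }) , inj₁ (refl , refl))
      (λ { (suc g) p → split-off S f p (λ { refl → case split-f S f p of λ () }) , π-ends (suc g) })
      (λ { (suc g) (suc g′) _ _ refl → refl })
  tree {S} Sf (inj₂ (inj₁ (refl , refl , refl))) =
    tree-rename (src G) (tgt G) (src G₁) (tgt G₁) (suc [ f ≔ zero ]) π to from inj
      where
      ne : ∀ {g} → split S f false true ∋ suc g → g ≢ f
      ne p refl = case split-f S f p of λ ()
      to : ∀ g → S ∋ g → split S f false true ∋ (suc [ f ≔ zero ]) g × Ends G₁ ((suc [ f ≔ zero ]) g) (src G g) (tgt G g)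
      to g p with g ≟ f
      ... | yes refl = refl , inj₁ (refl , refl)
      ... | no g≢f = split-on S f p g≢f , inj₁ (refl , refl)
      from : ∀ t → split S f false true ∋ t → S ∋ π t × Ends G (π t) (src G₁ t) (tgt G₁ t)
      from zero _ = Sf , π-ends zero
      from (suc g) p = split-off S f p (ne p) , π-ends (suc g)
      inj : ∀ t t′ → split S f false true ∋ t → split S f false true ∋ t′ → π t ≡ π t′ → t ≡ t′
      inj zero    zero     _ _ _ = refl
      inj zero    (suc g′) _ p′ e = ⊥-elim (ne p′ (sym e))
      inj (suc g) zero     p _ e = ⊥-elim (ne p e)
      inj (suc g) (suc g′) _ _ refl = refl
  tree {S} Sf (inj₂ (inj₂ (refl , refl , refl))) =
    tree-rename (src G) (tgt G) (src G₁) (tgt G₁) suc π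
      (λ g p → on g p , inj₁ (refl , refl))
      (λ { (suc g) p → off g p , π-ends (suc g) })
      (λ { (suc g) (suc g′) _ _ refl → refl })
      where
      on : ∀ g → S ∋ g → split S f true false ∋ suc g
      on g p with g ≟ f
      ... | yes _ = refl
      ... | no _ = p
      off : ∀ g → split S f true false ∋ suc g → S ∋ g
      off g p with g ≟ f
      ... | yes refl = Sf
      ... | no _ = p

-- The new vertex is `zero`; the edge `suc f` is the half from the source of `f` to it, and the edge
-- `zero` the half from it to the target.
module Subdivide (G : Multigraph) (f : Fin (m G)) where

  G₁ : Multigraph
  G₁ = graph (zero ∷ (λ g → suc (src G g))) (suc (tgt G f) ∷ ((λ g → suc (tgt G g)) [ f ≔ zero ]))

  a b : Fin (n G)
  a = src G f
  b = tgt G f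

  tgt-f : tgt G₁ (suc f) ≡ zero
  tgt-f = set-same (λ g → suc (tgt G g)) f

  tgt-other : ∀ {g} → g ≢ f → tgt G₁ (suc g) ≡ suc (tgt G g)
  tgt-other g≢f = set-other (λ g → suc (tgt G g)) f g≢f

  first-half : ∀ {P} → P (suc f) → Reach G₁ P (suc a) zero
  first-half p = edge G₁ (suc f) p (inj₁ (refl , tgt-f))

  second-half : ∀ {P} → P zero → Reach G₁ P zero (suc b)
  second-half p = step G₁ zero p

  up : ∀ {P P₁ u v} → (∀ g → g ≢ f → P g → P₁ (suc g)) → (P f → P₁ (suc f) × P₁ zero) →
    Reach G P u v → Reach G₁ P₁ (suc u) (suc v)
  up {P} {P₁} h hf = reach-map G G₁ suc go
    where
    go : ∀ g → P g → Reach G₁ P₁ (suc (src G g)) (suc (tgt G g))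
    go g p with g ≟ f
    ... | yes refl = first-half (proj₁ (hf p)) ◅◅ second-half (proj₂ (hf p))
    ... | no g≢f = edge G₁ (suc g) (h g g≢f p) (inj₁ (refl , tgt-other g≢f))

  -- The vertex `x` is the image of the new vertex. For an end of `f`, the half at that end
  -- contracts to a point and the other half becomes `f`.
  down : ∀ x {P P₁ u v} → (∀ g → g ≢ f → P₁ (suc g) → P g) →
    (P₁ (suc f) → Reach G P a x) → (P₁ zero → Reach G P x b) →
    Reach G₁ P₁ u v → Reach G P ((x ∷ id) u) ((x ∷ id) v)
  down x {P} {P₁} h h₁ h₂ = reach-map G₁ G (x ∷ id) go
    where
    go : ∀ g → P₁ g → Reach G P ((x ∷ id) (src G₁ g)) ((x ∷ id) (tgt G₁ g))
    go zero p = h₂ p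
    go (suc g) p with g ≟ f
    ... | yes refl = h₁ p
    ... | no g≢f = step G g (h g g≢f p)

  at-zero : ∀ t → src G₁ t ≡ zero ⊎ tgt G₁ t ≡ zero → t ≡ zero ⊎ t ≡ suc f
  at-zero zero _ = inj₁ refl
  at-zero (suc g) (inj₂ e) with g ≟ f
  ... | yes refl = inj₂ refl
  ... | no _ = case e of λ ()

  half-models : ∀ {β} x → x ≡ a ⊎ x ≡ b → (∀ i → β zero ≡ just i → β (suc x) ≡ just i) →
    (∀ i → ∃[ v ] β v ≡ just i) →
    (∀ i u v → β u ≡ just i → β v ≡ just i →
       Reach G₁ (λ t → β (src G₁ t) ≡ just i × β (tgt G₁ t) ≡ just i) u v) →
    (∀ i j → i ≢ j → ∃[ t ] ((β (src G₁ t) ≡ just i × β (tgt G₁ t) ≡ just j) ⊎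
                             (β (src G₁ t) ≡ just j × β (tgt G₁ t) ≡ just i))) →
    K4MinorModel G
  half-models {β} x x∈ab near nonempty conn adj =
    β ∘ suc ,
    (λ i → case nonempty i of λ { (zero , e) → x , near i e ; (suc v , e) → v , e }) ,
    (λ i u v p q → down x (λ g g≢f (e , e′) → e , trans (cong β (sym (tgt-other g≢f))) e′)
      (λ (e , e′) → to-x i e (near i (trans (cong β (sym tgt-f)) e′)) x∈ab)
      (λ (e , e′) → from-x i (near i e) e′ x∈ab)
      (conn i (suc u) (suc v) p q)) ,
    λ i j i≢j → let (t , e) = adj i j i≢j in adjacent i j i≢j t e x∈ab
    where
    InB : Fin 4 → Fin (m G) → Set
    InB i t = β (suc (src G t)) ≡ just i × β (suc (tgt G t)) ≡ just i
    to-x : ∀ i → β (suc a) ≡ just i → β (suc x) ≡ just i → x ≡ a ⊎ x ≡ b → Reach G (InB i) a x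
    to-x i e e′ (inj₁ refl) = ε
    to-x i e e′ (inj₂ refl) = step G f (e , e′)
    from-x : ∀ i → β (suc x) ≡ just i → β (suc b) ≡ just i → x ≡ a ⊎ x ≡ b → Reach G (InB i) x b
    from-x i e e′ (inj₁ refl) = step G f (e , e′)
    from-x i e e′ (inj₂ refl) = ε
    Joined : Fin 4 → Fin 4 → Set
    Joined i j = ∃[ t ] ((β (suc (src G t)) ≡ just i × β (suc (tgt G t)) ≡ just j) ⊎
                         (β (suc (src G t)) ≡ just j × β (suc (tgt G t)) ≡ just i))
    other : ∀ {i j v} → i ≢ j → β v ≡ just i → β v ≢ just j
    other i≢j e e′ = i≢j (just-injective (trans (sym e) e′))
    adjacent : ∀ i j → i ≢ j → ∀ t → (β (src G₁ t) ≡ just i × β (tgt G₁ t) ≡ just j) ⊎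
                             (β (src G₁ t) ≡ just j × β (tgt G₁ t) ≡ just i) → x ≡ a ⊎ x ≡ b → Joined i j
    adjacent i j i≢j zero (inj₁ (e , e′)) (inj₁ refl) = f , inj₁ (near i e , e′)
    adjacent i j i≢j zero (inj₁ (e , e′)) (inj₂ refl) = ⊥-elim (other i≢j (near i e) e′)
    adjacent i j i≢j zero (inj₂ (e , e′)) (inj₁ refl) = f , inj₂ (near j e , e′)
    adjacent i j i≢j zero (inj₂ (e , e′)) (inj₂ refl) = ⊥-elim (other i≢j e′ (near j e))
    adjacent i j i≢j (suc g) e x∈ab = by-cases (g ≟ f)
      where
      Colours : Fin (suc (n G)) → Set
      Colours v = (β (suc (src G g)) ≡ just i × β v ≡ just j) ⊎ (β (suc (src G g)) ≡ just j × β v ≡ just i)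
      halved : g ≡ f → Colours zero → x ≡ a ⊎ x ≡ b → Joined i j
      halved refl (inj₁ (e , e′)) (inj₁ refl) = ⊥-elim (other i≢j e (near j e′))
      halved refl (inj₁ (e , e′)) (inj₂ refl) = f , inj₁ (e , near j e′)
      halved refl (inj₂ (e , e′)) (inj₁ refl) = ⊥-elim (other i≢j (near i e′) e)
      halved refl (inj₂ (e , e′)) (inj₂ refl) = f , inj₂ (e , near i e′)
      by-cases : Dec (g ≡ f) → Joined i j
      by-cases (no g≢f) = g , subst Colours (tgt-other g≢f) e
      by-cases (yes g≡f) = halved g≡f (subst Colours (trans (cong (tgt G₁ ∘ suc) g≡f) tgt-f) e) x∈ab

  model : K4MinorModel G₁ → K4MinorModel G
  model (β , nonempty , conn , adj) = answer (β zero) refl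
    where
    answer : ∀ c → β zero ≡ c → K4MinorModel G
    answer nothing e₀ = half-models a (inj₁ refl) (λ i e → case trans (sym e₀) e of λ ()) nonempty conn adj
    answer (just i) e₀ with ≡-dec _≟_ (β (suc a)) (just i) | ≡-dec _≟_ (β (suc b)) (just i)
    ... | yes ea | _ = half-models a (inj₁ refl) (λ j e → trans ea (trans (sym e₀) e)) nonempty conn adj
    ... | no _ | yes eb = half-models b (inj₂ refl) (λ j e → trans eb (trans (sym e₀) e)) nonempty conn adj
    ... | no ¬a | no ¬b = ⊥-elim (pigeon (toward zero) (toward (suc zero)) (toward (suc (suc zero))))
      where
      -- The branch set of the subdividing vertex is a singleton, so it has at most two neighbouring branch sets.
      alone : ∀ v → β v ≡ just i → zero ≡ v
      alone v ev with conn i zero v e₀ ev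
      ... | ε = refl
      ... | (t , (p , q) , e) ◅ _ with at-zero t ([ inj₁ ∘ proj₁ , inj₂ ∘ proj₂ ]′ e)
      ... | inj₁ refl = ⊥-elim (¬b q)
      ... | inj₂ refl = ⊥-elim (¬a p)
      far-end : ∀ j t → (β (src G₁ t) ≡ just i × β (tgt G₁ t) ≡ just j) ⊎
                (β (src G₁ t) ≡ just j × β (tgt G₁ t) ≡ just i) → i ≢ j → β (suc a) ≡ just j ⊎ β (suc b) ≡ just j
      far-end j t e i≢j with at-zero t ([ inj₁ ∘ sym ∘ alone _ ∘ proj₁ , inj₂ ∘ sym ∘ alone _ ∘ proj₂ ]′ e)
      far-end j t (inj₁ (_ , e)) i≢j | inj₁ refl = inj₂ e
      far-end j t (inj₂ (e , _)) i≢j | inj₁ refl = ⊥-elim (i≢j (just-injective (trans (sym e₀) e)))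
      far-end j t (inj₁ (_ , e)) i≢j | inj₂ refl =
        ⊥-elim (i≢j (just-injective (trans (sym e₀) (trans (cong β (sym tgt-f)) e))))
      far-end j t (inj₂ (e , _)) i≢j | inj₂ refl = inj₁ e
      toward : ∀ k → β (suc a) ≡ just (punchIn i k) ⊎ β (suc b) ≡ just (punchIn i k)
      toward k with adj i (punchIn i k) (punchInᵢ≢i i k ∘ sym)
      ... | t , e = far-end _ t e (punchInᵢ≢i i k ∘ sym)
      same : ∀ {v k l} → β v ≡ just (punchIn i k) → β v ≡ just (punchIn i l) → k ≡ l
      same e e′ = punchIn-injective i _ _ (just-injective (trans (sym e) e′))
      Toward : Fin 3 → Set
      Toward k = β (suc a) ≡ just (punchIn i k) ⊎ β (suc b) ≡ just (punchIn i k)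
      pigeon : Toward zero → Toward (suc zero) → Toward (suc (suc zero)) → ⊥
      pigeon (inj₁ p) (inj₁ q) _ = case same p q of λ ()
      pigeon (inj₂ p) (inj₂ q) _ = case same p q of λ ()
      pigeon (inj₁ p) (inj₂ q) (inj₁ r) = case same p r of λ ()
      pigeon (inj₁ p) (inj₂ q) (inj₂ r) = case same q r of λ ()
      pigeon (inj₂ p) (inj₁ q) (inj₁ r) = case same q r of λ ()
      pigeon (inj₂ p) (inj₁ q) (inj₂ r) = case same p r of λ ()

  robust : Robust G → Robust G₁
  robust R = record
    { two-edges = m≤n⇒m≤1+n (two-edges R)
    ; connected = λ u v → reach-sym G₁ (from-b u) ◅◅ from-b v
    ; no-K4     = no-K4 R ∘ model
    ; no-loop   = loop
    ; no-bridge = bridge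
    ; no-cut    = cut
    }
    where
    from-b : ∀ v → Reach G₁ (AllEdges G₁) (suc b) v
    from-b zero = reach-sym G₁ (second-half tt)
    from-b (suc v) = up (λ _ _ _ → tt) (λ _ → tt , tt) (connected R b v)
    loop : ∀ t → ¬ IsLoop G₁ t
    loop (suc g) e with g ≟ f
    ... | no _ = no-loop R g (suc-injective e)
    bridge : ∀ t → Reach G₁ (_≢ t) (src G₁ t) (tgt G₁ t)
    bridge zero = reach-sym G₁ (first-half λ ())
      ◅◅ up (λ _ _ _ ()) (λ f≢f → ⊥-elim (f≢f refl)) (no-bridge R f)
    bridge (suc g) with g ≟ f
    ... | yes refl = up (λ _ h≢f _ → h≢f ∘ suc-injective) (λ f≢f → ⊥-elim (f≢f refl)) (no-bridge R f)
                     ◅◅ reach-sym G₁ (second-half λ ())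
    ... | no g≢f = up (λ _ _ h≢g → h≢g ∘ suc-injective) (λ _ → g≢f ∘ sym ∘ suc-injective , λ ()) (no-bridge R g)
    Avoid : Fin (suc (n G)) → Fin (suc (m G)) → Set
    Avoid w t = src G₁ t ≢ w × tgt G₁ t ≢ w
    cut : ∀ w → ConnectedWithout G₁ w
    cut zero zero v u≢0 _ = ⊥-elim (u≢0 refl)
    cut zero (suc u) zero _ v≢0 = ⊥-elim (v≢0 refl)
    -- Walks in `G` survive the deletion of the new vertex except where they use `f`; as `f` is not
    -- a bridge, they are rerouted there.
    cut zero (suc u) (suc v) _ _ = reach-map G G₁ suc around (connected R u v)
      where
      detour : ∀ {u v} → Reach G (_≢ f) u v → Reach G₁ (Avoid zero) (suc u) (suc v)
      detour = up (λ g g≢f _ → (λ ()) , λ e → case trans (sym (tgt-other g≢f)) e of λ ())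
                  (λ f≢f → ⊥-elim (f≢f refl))
      around : ∀ g → ⊤ → Reach G₁ (Avoid zero) (suc (src G g)) (suc (tgt G g))
      around g _ with g ≟ f
      ... | yes refl = detour (no-bridge R f)
      ... | no g≢f = detour (step G g g≢f)
    cut (suc w) u v u≢w v≢w =
      let (u′ , u′≢w , ru) = old u u≢w
          (v′ , v′≢w , rv) = old v v≢w
      in ru ◅◅ up (λ g g≢f (p , q) → p ∘ suc-injective , λ e → q (suc-injective (trans (sym (tgt-other g≢f)) e)))
                  (λ (p , q) → (p ∘ suc-injective , λ e → case trans (sym tgt-f) e of λ ()) , (λ ()) , q ∘ suc-injective)
                  (no-cut R w u′ v′ u′≢w v′≢w)
            ◅◅ reach-sym G₁ rv
      where
      old : ∀ u → u ≢ suc w → ∃[ u′ ] (u′ ≢ w × Reach G₁ (Avoid (suc w)) u (suc u′))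
      old (suc u) u≢w = u , u≢w ∘ cong suc , ε
      -- The new vertex escapes to an end of `f` other than the deleted vertex; there is one because
      -- `f` is no loop.
      old zero _ with a ≟ w
      ... | no a≢w = a , a≢w , reach-sym G₁ (first-half (a≢w ∘ suc-injective , λ e → case trans (sym tgt-f) e of λ ()))
      ... | yes refl = b , no-loop R f ∘ sym , second-half ((λ ()) , no-loop R f ∘ sym ∘ suc-injective)

  -- The alternatives unfold `Joined true`: both halves, only `suc f`, only `zero`. In the last two
  -- the new vertex is a leaf hung on a tree that avoids `f`.
  tree : ∀ {S c b₁ b₂} → S f ≡ c →
    (c ≡ true × b₁ ≡ true × b₂ ≡ true) ⊎ (c ≡ false × b₁ ≡ true × b₂ ≡ false) ⊎ (c ≡ false × b₁ ≡ false × b₂ ≡ true) →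
    Tree G S → Tree G₁ (split S f b₁ b₂)
  tree {S} Sf (inj₁ (refl , refl , refl)) (spans , acyclic) =
    (λ u v _ _ → reach-sym G₁ (from-b u) ◅◅ from-b v) , acyc
    where
    S₁ = split S f true true
    on-f : S₁ ∋ suc f
    on-f = set-same S f
    from-b : ∀ v → Reach G₁ (S₁ ∋_) (suc b) v
    from-b zero = reach-sym G₁ (second-half refl)
    from-b (suc v) = up (λ g g≢f p → split-on S f p g≢f) (λ _ → on-f , refl) (spans b v tt tt)
    acyc : ∀ t → S₁ ∋ t → ¬ Reach G₁ (λ s → S₁ ∋ s × s ≢ t) (src G₁ t) (tgt G₁ t)
    -- With one half omitted, the new vertex is sent to the end at which the other half sits; a walk
    -- around the omitted half becomes a walk around `f`.
    acyc zero _ r = acyclic f Sf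
      (down a (λ g g≢f (p , _) → split-off S f p g≢f , g≢f) (λ _ → ε) (λ (_ , 0≢0) → ⊥-elim (0≢0 refl)) r)
    acyc (suc g) p r with g ≟ f
    ... | yes refl = acyclic f Sf
      (down b (λ g g≢f (p , _) → split-off S f p g≢f , g≢f) (λ (_ , f≢f) → ⊥-elim (f≢f refl)) (λ _ → ε) r)
    ... | no g≢f = acyclic g p
      (down b (λ h h≢f (q , h≢g) → split-off S f q h≢f , h≢g ∘ cong suc)
        (λ _ → step G f (Sf , g≢f ∘ sym)) (λ _ → ε) r)
  tree {S} Sf (inj₂ (inj₁ (refl , refl , refl))) (spans , acyclic) =
    (λ u v _ _ → reach-sym G₁ (from-a u) ◅◅ from-a v) , acyc
    where
    S₁ = split S f true false
    from-a : ∀ v → Reach G₁ (S₁ ∋_) (suc a) v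
    from-a zero = first-half (set-same S f)
    from-a (suc v) = up (λ g g≢f p → split-on S f p g≢f) (λ p → ⊥-elim (true≢false p Sf)) (spans a v tt tt)
    acyc : ∀ t → S₁ ∋ t → ¬ Reach G₁ (λ s → S₁ ∋ s × s ≢ t) (src G₁ t) (tgt G₁ t)
    acyc (suc g) p r with g ≟ f
    ... | yes refl = isolated (reach-sym G₁ r)
      where
      isolated : ¬ Reach G₁ (λ s → S₁ ∋ s × s ≢ suc f) zero (suc a)
      isolated ((t , (p , t≢f) , e) ◅ _) with at-zero t ([ inj₁ ∘ proj₁ , inj₂ ∘ proj₂ ]′ e)
      ... | inj₁ refl = case p of λ ()
      ... | inj₂ refl = t≢f refl
    ... | no g≢f = acyclic g p
      (down a (λ h h≢f (q , h≢g) → split-off S f q h≢f , h≢g ∘ cong suc)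
        (λ _ → ε) (λ { (() , _) }) r)
  tree {S} Sf (inj₂ (inj₂ (refl , refl , refl))) (spans , acyclic) =
    (λ u v _ _ → reach-sym G₁ (from-b u) ◅◅ from-b v) , acyc
    where
    S₁ = split S f false true
    off-f : ¬ (S₁ ∋ suc f)
    off-f p = case split-f S f p of λ ()
    from-b : ∀ v → Reach G₁ (S₁ ∋_) (suc b) v
    from-b zero = reach-sym G₁ (second-half refl)
    from-b (suc v) = up (λ g g≢f p → split-on S f p g≢f) (λ p → ⊥-elim (true≢false p Sf)) (spans b v tt tt)
    acyc : ∀ t → S₁ ∋ t → ¬ Reach G₁ (λ s → S₁ ∋ s × s ≢ t) (src G₁ t) (tgt G₁ t)
    acyc zero _ r = isolated r
      where
      isolated : ¬ Reach G₁ (λ s → S₁ ∋ s × s ≢ zero) zero (suc b)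
      isolated ((t , (p , t≢0) , e) ◅ _) with at-zero t ([ inj₁ ∘ proj₁ , inj₂ ∘ proj₂ ]′ e)
      ... | inj₁ refl = t≢0 refl
      ... | inj₂ refl = off-f p
    acyc (suc g) p r with g ≟ f
    ... | no g≢f = acyclic g p
      (down b (λ h h≢f (q , h≢g) → split-off S f q h≢f , h≢g ∘ cong suc)
        (λ (q , _) → ⊥-elim (off-f q)) (λ _ → ε) r)

tree-cong : ∀ G {A S S′} → (∀ t → S t ≡ S′ t) → IsTree G A S → IsTree G A S′
tree-cong G S≗S′ = tree-rename (src G) (tgt G) (src G) (tgt G) id id
  (λ t p → trans (sym (S≗S′ t)) p , inj₁ (refl , refl))
  (λ t p → trans (S≗S′ t) p , inj₁ (refl , refl))
  (λ _ _ _ _ e → e)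

SameOff : ∀ {k} → Fin k → Mask k → Mask k → Set
SameOff f S S′ = ∀ g → g ≢ f → S g ≡ S′ g

-- The network of t replaces the edge f; encode S x is S off f and x inside the network.
record Expansion (G : Multigraph) (f : Fin (m G)) (t : Term) : Set where
  field
    result      : Multigraph
    robust      : Robust result
    keep        : Fin (m G) → Fin (m result)
    keep-inj    : ∀ {g h} → g ≢ f → h ≢ f → keep g ≡ keep h → g ≡ h
    encode      : Mask (m G) → V (K t) → Mask (m result)
    encode-keep : ∀ S x {g} → g ≢ f → encode S x (keep g) ≡ S g
    encode-tree : ∀ S x → S f ≡ colour t x → Tree G S → Tree result (encode S x)
    encode-inj  : ∀ S S′ x x′ → (∀ g → encode S x g ≡ encode S′ x′ g) → x ≡ x′
    -- The masks may differ at `f`: a move of `x` changes its colour, which is the bit of `f` that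
    -- `encode-tree` demands.
    encode-adj  : ∀ S S′ x x′ → SameOff f S S′ → _~_ (K t) x x′ →
                  ∃[ h ] (encode S x h ≢ encode S′ x′ h × SameOff h (encode S x) (encode S′ x′))
    encode-same : ∀ S S′ x g₀ → (∀ g → g ≢ f → g ≢ g₀ → S g ≡ S′ g) →
                  SameOff (keep g₀) (encode S x) (encode S′ x)
open Expansion

expand-leaf : ∀ G f → Robust G → Expansion G f leaf
expand-leaf G f R = record
  { result      = G
  ; robust      = R
  ; keep        = id
  ; keep-inj    = λ _ _ e → e
  ; encode      = λ S x → S [ f ≔ x ]
  ; encode-keep = λ S x → set-other S f
  ; encode-tree = λ S x e → tree-cong G (unchanged S x e)
  ; encode-inj  = λ S S′ x x′ e → trans (sym (set-same S f)) (trans (e f) (set-same S′ f))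
  ; encode-adj  = λ S S′ x x′ off x≢x′ → f ,
      (λ e → x≢x′ (trans (sym (set-same S f)) (trans e (set-same S′ f)))) ,
      λ g g≢f → trans (set-other S f g≢f) (trans (off g g≢f) (sym (set-other S′ f g≢f)))
  ; encode-same = same
  }
  where
  unchanged : ∀ S x → S f ≡ x → ∀ g → S g ≡ (S [ f ≔ x ]) g
  unchanged S x e g with g ≟ f
  ... | yes refl = e
  ... | no _ = refl
  same : ∀ (S S′ : Mask (m G)) x g₀ → (∀ g → g ≢ f → g ≢ g₀ → S g ≡ S′ g) → SameOff g₀ (S [ f ≔ x ]) (S′ [ f ≔ x ])
  same S S′ x g₀ off g g≢g₀ with g ≟ f
  ... | yes _ = refl
  ... | no g≢f = off g g≢f g≢g₀

Joined : Bool → Bool → Bool → Bool → Set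
Joined p c b₁ b₂ = (c ≡ p × b₁ ≡ p × b₂ ≡ p) ⊎ (c ≡ not p × b₁ ≡ p × b₂ ≡ not p) ⊎ (c ≡ not p × b₁ ≡ not p × b₂ ≡ p)

colours-joined : ∀ p t u (w : V (K (join p t u))) →
  Joined p (colour (join p t u) w) (colour t (Join.fst p t u w)) (colour u (Join.snd p t u w))
colours-joined p t u w with Bool-cases (colour t (fst w)) p | Bool-cases (colour u (snd w)) p
  where open Join p t u
... | inj₁ e | inj₁ f = inj₁ (Join.colour-both p t u w e f , e , f)
... | inj₁ e | inj₂ f = inj₂ (inj₁ (Join.colour-one p t u w (inj₂ f) , e , f))
... | inj₂ e | inj₁ f = inj₂ (inj₂ (Join.colour-one p t u w (inj₁ e) , e , f))
... | inj₂ e | inj₂ f with Join.some p t u w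
... | inj₁ e′ = ⊥-elim (not-≢ p (trans (sym e′) e))
... | inj₂ f′ = ⊥-elim (not-≢ p (trans (sym f′) f))

-- The edge `suc f` is expanded into the network of `t`, then the surviving copy of `zero` into that
-- of `u`. Series and parallel differ only in the graph supplied and in `tree₁`.
module ExpandJoin (p : Bool) (t u : Term) (G : Multigraph) (f : Fin (m G))
  {k : ℕ} (s₁ t₁ : Fin (suc (m G)) → Fin k)
  (tree₁ : ∀ {S c b₁ b₂} → S f ≡ c → Joined p c b₁ b₂ → Tree G S → Tree (graph s₁ t₁) (split S f b₁ b₂))
  (E : Expansion (graph s₁ t₁) (suc f) t)
  (F : Expansion (result E) (keep E zero) u)
  where
  open Join p t u hiding (graph)

  keep-≢ : ∀ {g} → g ≢ f → keep E (suc g) ≢ keep E zero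
  keep-≢ g≢f e = case keep-inj E (g≢f ∘ suc-injective) (λ ()) e of λ ()

  kept : Fin (m G) → Fin (m (result F))
  kept g = keep F (keep E (suc g))

  before : Mask (m G) → W → Mask (suc (m G))
  before S w = split S f (colour t (fst w)) (colour u (snd w))

  between : Mask (m G) → W → Mask (m (result E))
  between S w = encode E (before S w) (fst w)

  after : Mask (m G) → W → Mask (m (result F))
  after S w = encode F (between S w) (snd w)

  before-off : ∀ S w {g} → g ≢ f → before S w (suc g) ≡ S g
  before-off S w = set-other S f

  between-keep : ∀ S w {g} → g ≢ f → between S w (keep E (suc g)) ≡ S g
  between-keep S w g≢f = trans (encode-keep E _ _ (g≢f ∘ suc-injective)) (before-off S w g≢f)

  between-zero : ∀ S w → between S w (keep E zero) ≡ colour u (snd w)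
  between-zero S w = encode-keep E _ _ λ ()

  off-both : ∀ S S′ w w′ → SameOff f S S′ → ∀ g → g ≢ suc f → g ≢ zero → before S w g ≡ before S′ w′ g
  off-both S S′ w w′ off zero _ 0≢0 = ⊥-elim (0≢0 refl)
  off-both S S′ w w′ off (suc g) g≢f _ =
    trans (before-off S w (g≢f ∘ cong suc)) (trans (off g (g≢f ∘ cong suc)) (sym (before-off S′ w′ (g≢f ∘ cong suc))))

  -- The second coordinate is read off directly from `F`. It determines the bit of the edge that `F`
  -- replaced, and `F` keeps all other bits, so the intermediate masks agree and `E` yields the
  -- first coordinate.
  after-inj : ∀ S S′ w w′ → (∀ g → after S w g ≡ after S′ w′ g) → w ≡ w′
  after-inj S S′ w w′ e = pair-injective w w′ (encode-inj E _ _ _ _ same) snd≡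
    where
    snd≡ : snd w ≡ snd w′
    snd≡ = encode-inj F _ _ _ _ e
    same : ∀ g → between S w g ≡ between S′ w′ g
    same g with g ≟ keep E zero
    ... | yes refl = trans (between-zero S w) (trans (cong (colour u) snd≡) (sym (between-zero S′ w′)))
    ... | no g≢0 = trans (sym (encode-keep F _ _ g≢0)) (trans (e (keep F g)) (encode-keep F _ _ g≢0))

  after-adj : ∀ S S′ w w′ → SameOff f S S′ → Adj w w′ →
    ∃[ h ] (after S w h ≢ after S′ w′ h × SameOff h (after S w) (after S′ w′))
  after-adj S S′ w w′ off adj with adj-cases w w′ adj
  -- A move of the second coordinate also changes the bit of `zero`, but `E` copies that bit to the
  -- very edge that `F` replaces.
  ... | inj₂ (eq , s) = encode-adj F _ _ _ _
      (subst (λ x → SameOff (keep E zero) (between S w) (encode E (before S′ w′) x)) eq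
        (encode-same E _ _ (fst w) zero (off-both S S′ w w′ off))) s
  ... | inj₁ (s , eq) with encode-adj E (before S w) (before S′ w′) (fst w) (fst w′) off′ s
    where
    off′ : SameOff (suc f) (before S w) (before S′ w′)
    off′ zero _ = cong (colour u) eq
    off′ (suc g) g≢f = off-both S S′ w w′ off (suc g) g≢f λ ()
  ... | h , differ , same = keep F h ,
      (λ e → differ (trans (sym (encode-keep F _ _ h≢0)) (trans e (encode-keep F _ _ h≢0)))) ,
      subst (λ y → SameOff (keep F h) (after S w) (encode F (between S′ w′) y)) eq
        (encode-same F _ _ (snd w) h λ g _ g≢h → same g g≢h)
    where
    -- The bit at `keep E zero` is the colour of the second coordinate, which does not move here; so
    -- the changed edge survives in `F`.
    h≢0 : h ≢ keep E zero
    h≢0 refl = differ (trans (between-zero S w) (trans (cong (colour u) eq) (sym (between-zero S′ w′))))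

  after-same : ∀ S S′ w g₀ → (∀ g → g ≢ f → g ≢ g₀ → S g ≡ S′ g) → SameOff (kept g₀) (after S w) (after S′ w)
  after-same S S′ w g₀ off = encode-same F _ _ (snd w) (keep E (suc g₀)) λ g _ → same g
    where
    off′ : ∀ g → g ≢ suc f → g ≢ suc g₀ → before S w g ≡ before S′ w g
    off′ zero _ _ = refl
    off′ (suc g) g≢f g≢g₀ = trans (before-off S w (g≢f ∘ cong suc))
      (trans (off g (g≢f ∘ cong suc) (g≢g₀ ∘ cong suc)) (sym (before-off S′ w (g≢f ∘ cong suc))))
    same : SameOff (keep E (suc g₀)) (between S w) (between S′ w)
    same = encode-same E _ _ (fst w) (suc g₀) off′

  expansion : Expansion G f (join p t u)
  expansion = record
    { result      = result F
    ; robust      = robust F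
    ; keep        = kept
    ; keep-inj    = λ g≢f h≢f e → suc-injective (keep-inj E (g≢f ∘ suc-injective) (h≢f ∘ suc-injective)
                      (keep-inj F (keep-≢ g≢f) (keep-≢ h≢f) e))
    ; encode      = after
    ; encode-keep = λ S w g≢f → trans (encode-keep F _ _ (keep-≢ g≢f)) (between-keep S w g≢f)
    ; encode-tree = λ S w e tr → encode-tree F _ _ (between-zero S w)
                      (encode-tree E _ _ (set-same S f) (tree₁ e (colours-joined p t u w) tr))
    ; encode-inj  = after-inj
    ; encode-adj  = after-adj
    ; encode-same = after-same
    }

expand : ∀ t G f → Robust G → Expansion G f t
expand leaf G f R = expand-leaf G f R
expand (join true t u) G f R = ExpandJoin.expansion true t u G f (src G₁) (tgt G₁) tree E F
  where
  open Subdivide G f using (G₁; tree) renaming (robust to robust₁)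
  E = expand t G₁ (suc f) (robust₁ R)
  F = expand u (result E) (keep E zero) (robust E)
expand (join false t u) G f R = ExpandJoin.expansion false t u G f (src G₁) (tgt G₁) tree E F
  where
  open Duplicate G f using (G₁; tree) renaming (robust to robust₁)
  E = expand t G₁ (suc f) (robust₁ R)
  F = expand u (result E) (keep E zero) (robust E)

-- The digon and the realisation of `K t` inside H(G,e)

digon : Multigraph
digon = graph {2} {2} (λ _ → zero) (λ _ → suc zero)

digon-reach : ∀ {P : Fin 2 → Set} t → P t → ∀ u v → Reach digon P u v
digon-reach t p zero       zero       = ε
digon-reach t p zero       (suc zero) = step digon t p
digon-reach t p (suc zero) zero       = reach-sym digon (step digon t p)
digon-reach t p (suc zero) (suc zero) = ε

digon-robust : Robust digon
digon-robust = record
  { two-edges = s≤s (s≤s z≤n)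
  ; connected = digon-reach zero tt
  ; no-K4     = no-model
  ; no-loop   = λ _ ()
  ; no-bridge = λ { zero → step digon (suc zero) (λ ()) ; (suc zero) → step digon zero (λ ()) }
  ; no-cut    = cut
  }
  where
  no-model : ¬ K4MinorModel digon
  no-model (β , nonempty , _) = pigeon (nonempty zero) (nonempty (suc zero)) (nonempty (suc (suc zero)))
    where
    same : ∀ {v i j} → β v ≡ just i → β v ≡ just j → i ≡ j
    same e e′ = just-injective (trans (sym e) e′)
    Branch : Fin 4 → Set
    Branch i = ∃[ v ] β v ≡ just i
    pigeon : Branch zero → Branch (suc zero) → Branch (suc (suc zero)) → ⊥
    pigeon (zero     , p) (zero     , q) _ = case same p q of λ ()
    pigeon (suc zero , p) (suc zero , q) _ = case same p q of λ ()
    pigeon (zero     , p) (suc zero , q) (zero     , r) = case same p r of λ ()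
    pigeon (zero     , p) (suc zero , q) (suc zero , r) = case same q r of λ ()
    pigeon (suc zero , p) (zero     , q) (zero     , r) = case same q r of λ ()
    pigeon (suc zero , p) (zero     , q) (suc zero , r) = case same p r of λ ()
  cut : ∀ w → ConnectedWithout digon w
  cut w          zero       zero       _   _   = ε
  cut w          (suc zero) (suc zero) _   _   = ε
  cut zero       zero       (suc zero) 0≢0 _   = ⊥-elim (0≢0 refl)
  cut zero       (suc zero) zero       _   0≢0 = ⊥-elim (0≢0 refl)
  cut (suc zero) zero       (suc zero) _   1≢1 = ⊥-elim (1≢1 refl)
  cut (suc zero) (suc zero) zero       1≢1 _   = ⊥-elim (1≢1 refl)

digon-tree : ∀ b → Tree digon (not b ∷ λ _ → b)
digon-tree true = (λ u v _ _ → digon-reach (suc zero) refl u v) , acyclic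
  where
  acyclic : ∀ t → (false ∷ λ _ → true) ∋ t → ¬ Reach digon (λ s → (false ∷ λ _ → true) ∋ s × s ≢ t) zero (suc zero)
  acyclic (suc zero) _ ((zero , (() , _) , _) ◅ _)
  acyclic (suc zero) _ ((suc zero , (_ , t≢t) , _) ◅ _) = t≢t refl
digon-tree false = (λ u v _ _ → digon-reach zero refl u v) , acyclic
  where
  acyclic : ∀ t → (true ∷ λ _ → false) ∋ t → ¬ Reach digon (λ s → (true ∷ λ _ → false) ∋ s × s ≢ t) zero (suc zero)
  acyclic zero _ ((zero , (_ , t≢t) , _) ◅ _) = t≢t refl
  acyclic zero _ ((suc zero , (() , _) , _) ◅ _)

tree⇒SpanningTree : ∀ G T S → (∀ t → lookup T t ≡ S t) → Tree G S → SpanningTree G T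
tree⇒SpanningTree G T S e (spans , acyclic) =
  (λ u v → reach-mono G (λ t p → lookup⇒[]= t T (trans (e t) p)) (spans u v tt tt)) ,
  λ t t∈T r → acyclic t (on t∈T) (reach-mono G (λ s (s∈T , s≢t) → on s∈T , s≢t) r)
  where
  on : ∀ {t} → t ∈ˢ T → S ∋ t
  on {t} t∈T = trans (sym (e t)) ([]=⇒lookup t∈T)

module Realisation (t : Term) where
  E : Expansion digon (suc zero) t
  E = expand t digon (suc zero) digon-robust

  G : Multigraph
  G = result E

  e : Fin (m G)
  e = keep E zero

  inner : Mask 2
  inner _ = false

  place : V (K t) → Subset (m G)
  place x = tabulate (encode E inner x)

  place-lookup : ∀ x g → lookup (place x) g ≡ encode E inner x g
  place-lookup x g = lookup∘tabulate _ g

  -- Vertices of the cube must omit `e`, whereas `encode-tree` starts from a spanning tree of the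
  -- digon, which contains `e` exactly when the network is not joined up. Hence two masks; by
  -- `encode-same` their encodings agree off `e`, even though the masks may also differ at the
  -- expanded edge.
  full : V (K t) → Mask 2
  full x = not (colour t x) ∷ λ _ → colour t x

  full-e : ∀ x → encode E (full x) x e ≡ not (colour t x)
  full-e x = encode-keep E _ x λ ()

  full-off : ∀ x g → g ≢ e → encode E inner x g ≡ encode E (full x) x g
  full-off x = encode-same E inner (full x) x zero λ where
    zero       _   0≢0 → ⊥-elim (0≢0 refl)
    (suc zero) 1≢1 _   → ⊥-elim (1≢1 refl)

  without-e : ∀ x → lookup (place x) e ≡ false
  without-e x = trans (place-lookup x e) (encode-keep E _ x λ ())

  full-tree : ∀ x → Tree G (encode E (full x) x)
  full-tree x = encode-tree E _ x refl (digon-tree (colour t x))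

  in-X : ∀ x → InX G e (place x)
  in-X x = without-e x , by-colour (colour t x) refl
    where
    by-colour : ∀ b → colour t x ≡ b → SpanningTree G (place x ∪ ⁅ e ⁆) ⊎ SpanningTree G (place x)
    by-colour true c = inj₂ (tree⇒SpanningTree G (place x) _ same (full-tree x))
      where
      same : ∀ g → lookup (place x) g ≡ encode E (full x) x g
      same g with g ≟ e
      ... | yes refl = trans (without-e x) (sym (trans (full-e x) (cong not c)))
      ... | no g≢e = trans (place-lookup x g) (full-off x g g≢e)
    by-colour false c = inj₁ (tree⇒SpanningTree G (place x ∪ ⁅ e ⁆) _ same (full-tree x))
      where
      same : ∀ g → lookup (place x ∪ ⁅ e ⁆) g ≡ encode E (full x) x g
      same g with g ≟ e
      ... | yes refl = trans (lookup-∪⁅⁆-same (place x) e) (sym (trans (full-e x) (cong not c)))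
      ... | no g≢e = trans (lookup-∪⁅⁆-other (place x) e g≢e) (trans (place-lookup x g) (full-off x g g≢e))

  realises : IsoToSubgraphOfH (K t) G e
  realises = place ,
    (λ x y eq → encode-inj E _ _ x y λ g →
      trans (sym (place-lookup x g)) (trans (cong (λ T → lookup T g) eq) (place-lookup y g))) ,
    in-X , λ {x} {y} s → let (h , differ , same) = encode-adj E inner inner x y (λ _ _ → refl) s in
      h , (λ eq → differ (trans (sym (place-lookup x h)) (trans eq (place-lookup y h)))) ,
      λ g g≢h → trans (place-lookup x g) (trans (same g g≢h) (sym (place-lookup y g)))

  two-connected : InG″ G e
  two-connected =
    (connected R , no-K4 R , (λ bridge → bridge (no-bridge R e)) , no-loop R e) ,
    two-edges R , no-loop R , connected R , no-cut R
    where R = robust E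

reducible⇒subgraph : ∀ H → PJReducible H → Σ[ G ∈ Multigraph ] Σ[ e ∈ Fin (m G) ] (InG″ G e × IsoToSubgraphOfH H G e)
reducible⇒subgraph H red with reducible-term red
... | t , f , f-inj , f-adj = G , e , two-connected ,
  let (place , place-inj , in-X , place-adj) = realises in
  place ∘ f , (λ x y → f-inj x y ∘ place-inj _ _) , in-X ∘ f , λ s → place-adj (f-adj s)
  where open Realisation t

theorem4p3 : (H : Graph) → Connected H →
    (PJReducible H ⇔ (Σ[ G ∈ Multigraph ] Σ[ e ∈ Fin (m G) ] (InG′ G e × IsoToSubgraphOfH H G e)))
    × (PJReducible H ⇔ (Σ[ G ∈ Multigraph ] Σ[ e ∈ Fin (m G) ] (InG″ G e × IsoToSubgraphOfH H G e)))
theorem4p3 H conn =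
  mk⇔ (λ red → let (G , e , (in-G′ , _) , emb) = reducible⇒subgraph H red in G , e , in-G′ , emb)
      (λ (G , e , in-G′ , emb) → subgraph⇒reducible H conn G e in-G′ emb) ,
  mk⇔ (reducible⇒subgraph H)
      (λ (G , e , (in-G′ , _) , emb) → subgraph⇒reducible H conn G e in-G′ emb)
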